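{- Let $\Gamma=(X,\mathcal E)$ be the complete bipartite graph $K_{3,3}$ (the distance-regular graph with $6$ vertices and intersection array $\{3,2;1,3\}$); the spectrum of its adjacency matrix $A$ is $3^10^4(-3)^1$. Let $x\in X$, $T=T(x)$, and fix any ordering of the three vertices of $\Gamma_1(x)$ and of the two vertices of $\Gamma_2(x)$. Then the standard module $V=\mathbb C^X$ is an orthogonal direct sum of irreducible $T$-modules $V=W_0\oplus W_{1,a}\oplus W_{1,b}\oplus W_2$, where two summands are isomorphic if and only if they have the same type in the following list, and the data are as listed. Each listed basis is a pure basis of the module. For each summand other than $W_0$, the seed vector $\nu$ spans $E_r^*W$ (so $\dim E_r^*W=1$), where $r$ is the endpoint of the summand $W$, and is given by its essential part. Type I ($W_0$): endpoint 0, multiplicity 1, dimension 3, diameter 2, shape $(1,1,1)$; basis $e_0^*,e_1^*,e_2^*$; matrix representing $A$: $\begin{pmatrix}0&3&0\\1&0&2\\0&3&0\end{pmatrix}$, with eigenvalues $3,0,-3$. Type II ($W_{1,a},W_{1,b}$): endpoint 1, multiplicity 2, dimension 1, diameter 0, shape $(1)$; basis $\nu$, where $\nu=[1,-1,0]$ for $W_{1,a}$ and $\nu=[1,1,-2]$ for $W_{1,b}$; matrix representing $A$: $\begin{pmatrix}0\end{pmatrix}$, with eigenvalue $0$. Type III ($W_2$): endpoint 2, multiplicity 1, dimension 1, diameter 0, shape $(1)$; basis $\nu$, where $\nu=[1,-1]$; matrix representing $A$: $\begin{pmatrix}0\end{pmatrix}$. Moreover $\dim T=3^2+1^2+1^2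=11$.
   Context: Let $\Gamma=(X,\mathcal E)$ be a finite undirected connected graph without loops or multiple edges, with path-length distance $d$ and diameter $D\ge1$; put $\Gamma_i(x)=\{y\in X:d(x,y)=i\}$. $\Gamma$ is distance-regular if for all $0\le h,i,j\le D$ the number $p^h_{i,j}=|\Gamma_i(y)\cap\Gamma_j(z)|$ is the same for all $y,z\in X$ with $d(y,z)=h$. Its intersection array is $\{b_0,\dots,b_{D-1};c_1,\dots,c_D\}$ with $b_i=p^i_{1,i+1}$, $c_i=p^i_{1,i-1}$. $A\in\mathrm{Mat}_X(\mathbb C)$ is the adjacency matrix; in its spectrum, exponents denote multiplicities. The standard module $V=\mathbb C^X$ (column vectors) carries the Hermitian inner product $\langle u,v\rangle=u^t\bar v$. Fix a base vertex $x\in X$. For $0\le i\le D$, $E_i^*=E_i^*(x)$ is the diagonal matrix with $(y,y)$-entry $1$ if $d(x,y)=i$ and $0$ otherwise, and $e_i^*\in V$ is the vector with $y$-entry $1$ if $d(x,y)=i$ and $0$ otherwise. The Terwilliger algebra $T=T(x)$ is the subalgebra of $\mathrm{Mat}_X(\mathbb C)$ generated by $A$ and $E_0^*,\dots,E_D^*$. A $T$-module is a subspace $W\subseteq V$ with $BW\subseteq W$ for all $B\in T$; it is irreducible if $W\ne0$ and it properly contains no nonzero $T$-module. Isomorphisms of $T$-modules are vector space isomorphisms commuting with every $B\in T$. The endpoint of $W$ is $r=\min\{i:E_i^*W\ne0\}$; the diameter of an irreducible $W$ is $\delta=|\{i:E_i^*W\ne0\}|-1$, and its shape is $(\dim E_r^*W,\dots,\dim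 E_{r+\delta}^*W)$. The multiplicity of an irreducible module is the number of summands isomorphic to it in an orthogonal decomposition of $V$ into irreducible $T$-modules. A nonzero vector is pure with support $i$ if it lies in $E_i^*V$; its essential part is the row vector of its coordinates at the vertices of $\Gamma_i(x)$ (all its other coordinates are $0$). A pure basis of an irreducible $T$-module is an ordered basis of pure vectors with weakly increasing supports. The matrix $B$ representing $A$ with respect to a basis $v_1,\dots,v_\ell$ is given by $Av_j=\sum_iB_{ij}v_i$. -}

module Defs where

open import Algebra.Module.Bundles.Raw using (RawLeftSemimodule)
open import Algebra.Module.Morphism.Structures using (module LeftSemimoduleMorphisms)
import Algebra.Definitions.RawMonoid as RawMonoidDefs
open import Data.Bool using (Bool; true; false; if_then_else_)
import Data.Bool.Properties as Bool
open import Data.Fin using (Fin; zero; suc; toℕ; fromℕ<; splitAt; _↑ˡ_; _↑ʳ_)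
import Data.Fin as Fin
open import Data.Fin.Properties using (any?; splitAt-↑ˡ; splitAt-↑ʳ)
open import Data.Fin.Subset using (Subset; _∈_; ∣_∣)
open import Data.Integer using (ℤ; 0ℤ; 1ℤ)
open import Data.List using (List; length; filter; allFin; map; upTo)
open import Data.Nat using (ℕ; zero; suc; _≤_; _<_; _⊔_; _≟_)
import Data.Nat as ℕ
import Data.Nat.Properties as ℕ
open import Data.Product using (Σ-syntax; ∃; ∃-syntax; _×_; _,_; proj₁; proj₂)
open import Data.Rational using (ℚ; 0ℚ; 1ℚ; ½; Positive; positive)
import Data.Rational as ℚ
import Data.Rational.Properties as ℚ
open import Data.Rational.Solver using (module +-*-Solver)
open import Data.Sum using ([_,_]′)
open import Data.Vec using (Vec; lookup)
import Data.Vec.Functional as Vector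
open import Function using (const; _∘_; _⇔_; _↔_; Inverse)
open import Level using (0ℓ)
open import Relation.Binary using (Rel; Decidable; Symmetric; Irreflexive)
open import Relation.Binary.PropositionalEquality
open import Relation.Nullary using (¬_; yes; no; does)
open import Relation.Nullary.Decidable using (map′; _×-dec_; ¬?)
open import Relation.Unary using (Pred; _⊆_; _⊂_; U)
import Relation.Unary as Unary

IsCauchy : (ℕ → ℚ) → Set
IsCauchy s = ∀ ε → 0ℚ ℚ.< ε →
  ∃[ N ] ∀ m n → N ≤ m → N ≤ n → ℚ.∣ s m ℚ.- s n ∣ ℚ.< ε

record ℝ : Set where
  constructor mkℝ
  field
    seq    : ℕ → ℚ
    cauchy : IsCauchy seq

open ℝ

infix 4 _≈ℝ_
_≈ℝ_ : Rel ℝ 0ℓ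
a ≈ℝ b = ∀ ε → 0ℚ ℚ.< ε →
  ∃[ N ] ∀ n → N ≤ n → ℚ.∣ seq a n ℚ.- seq b n ∣ ℚ.< ε

abstract

  private
    halves : ∀ ε → ½ ℚ.* ε ℚ.+ ½ ℚ.* ε ≡ ε
    halves = solve 1 (λ e → con ½ :* e :+ con ½ :* e := e) refl
      where open +-*-Solver

    half-positive : ∀ {ε} → 0ℚ ℚ.< ε → 0ℚ ℚ.< ½ ℚ.* ε
    half-positive {ε} 0<ε =
      ℚ.positive⁻¹ (½ ℚ.* ε) {{ℚ.pos*pos⇒pos ½ ε {{positive 0<ε}}}}

    sum-bound : ∀ p q {ε} → ℚ.∣ p ∣ ℚ.< ½ ℚ.* ε → ℚ.∣ q ∣ ℚ.< ½ ℚ.* ε →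
                ℚ.∣ p ℚ.+ q ∣ ℚ.< ε
    sum-bound p q {ε} p< q< = ℚ.≤-<-trans (ℚ.∣p+q∣≤∣p∣+∣q∣ p q)
      (subst (ℚ.∣ p ∣ ℚ.+ ℚ.∣ q ∣ ℚ.<_) (halves ε) (ℚ.+-mono-< p< q<))

  constant-cauchy : ∀ q → IsCauchy (const q)
  constant-cauchy q ε 0<ε = 0 , λ _ _ _ _ →
    subst (λ t → ℚ.∣ t ∣ ℚ.< ε) (sym (ℚ.+-inverseʳ q)) 0<ε

  neg-cauchy : ∀ {s} → IsCauchy s → IsCauchy (λ n → ℚ.- s n)
  neg-cauchy {s} cs ε 0<ε with cs ε 0<ε
  ... | N , close = N , λ m n N≤m N≤n → subst (ℚ._< ε)
          (trans (sym (ℚ.∣-p∣≡∣p∣ (s m ℚ.- s n))) (cong ℚ.∣_∣ (rearrange (s m) (s n))))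
          (close m n N≤m N≤n)
    where
    open +-*-Solver
    rearrange : ∀ a b → ℚ.- (a ℚ.- b) ≡ ℚ.- a ℚ.- ℚ.- b
    rearrange = solve 2 (λ a b → :- (a :- b) := :- a :- :- b) refl

  +-cauchy : ∀ {s t} → IsCauchy s → IsCauchy t → IsCauchy (λ n → s n ℚ.+ t n)
  +-cauchy {s} {t} cs ct ε 0<ε
    with cs (½ ℚ.* ε) (half-positive 0<ε) | ct (½ ℚ.* ε) (half-positive 0<ε)
  ... | M , closeₛ | N , closeₜ = M ⊔ N , λ m n p q → subst (λ u → ℚ.∣ u ∣ ℚ.< ε)
          (sym (rearrange (s m) (t m) (s n) (t n)))
          (sum-bound (s m ℚ.- s n) (t m ℚ.- t n)
            (closeₛ m n (ℕ.m⊔n≤o⇒m≤o M N p) (ℕ.m⊔n≤o⇒m≤o M N q))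
            (closeₜ m n (ℕ.m⊔n≤o⇒n≤o M N p) (ℕ.m⊔n≤o⇒n≤o M N q)))
    where
    open +-*-Solver
    rearrange : ∀ a b c d → (a ℚ.+ b) ℚ.- (c ℚ.+ d) ≡ (a ℚ.- c) ℚ.+ (b ℚ.- d)
    rearrange = solve 4 (λ a b c d → (a :+ b) :- (c :+ d) := (a :- c) :+ (b :- d)) refl

  private
    eventually-bounded : ∀ {s} → IsCauchy s →
      ∃[ K ] 0ℚ ℚ.< K × ∃[ N ] ∀ n → N ≤ n → ℚ.∣ s n ∣ ℚ.< K
    eventually-bounded {s} cs with cs 1ℚ (ℚ.positive⁻¹ 1ℚ)
    ... | N , close = 1ℚ ℚ.+ ℚ.∣ s N ∣
      , ℚ.+-mono-<-≤ (ℚ.positive⁻¹ 1ℚ) (ℚ.0≤∣p∣ (s N))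
      , N , λ n N≤n → ℚ.≤-<-trans
          (subst (λ u → ℚ.∣ u ∣ ℚ.≤ ℚ.∣ s n ℚ.- s N ∣ ℚ.+ ℚ.∣ s N ∣)
            (rearrange (s n) (s N)) (ℚ.∣p+q∣≤∣p∣+∣q∣ (s n ℚ.- s N) (s N)))
          (ℚ.+-monoˡ-< ℚ.∣ s N ∣ (close n N N≤n ℕ.≤-refl))
      where
      open +-*-Solver
      rearrange : ∀ a b → (a ℚ.- b) ℚ.+ b ≡ a
      rearrange = solve 2 (λ a b → (a :- b) :+ b := a) refl

    shrink : ∀ {K ε} → 0ℚ ℚ.< K → 0ℚ ℚ.< ε → ∃[ η ] 0ℚ ℚ.< η × K ℚ.* η ≡ ε
    shrink {K} {ε} 0<K 0<ε = 1/K ℚ.* ε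
      , ℚ.positive⁻¹ _ {{ℚ.pos*pos⇒pos 1/K {{ℚ.1/pos⇒pos K}} ε {{positive 0<ε}}}}
      , trans (sym (ℚ.*-assoc K 1/K ε))
          (trans (cong (ℚ._* ε) (ℚ.*-inverseʳ K)) (ℚ.*-identityˡ ε))
      where
      instance
        K-positive : Positive K
        K-positive = positive 0<K
        K-nonZero : ℚ.NonZero K
        K-nonZero = ℚ.pos⇒nonZero K
      1/K : ℚ
      1/K = ℚ.1/ K

    product-bound : ∀ p q {K η ε} → 0ℚ ℚ.< K → K ℚ.* η ≡ ε →
      ℚ.∣ p ∣ ℚ.< K → ℚ.∣ q ∣ ℚ.< η → ℚ.∣ p ℚ.* q ∣ ℚ.< ε
    product-bound p q {K} {η} 0<K Kη≡ε p<K q<η =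
      subst₂ ℚ._<_ (sym (ℚ.∣p*q∣≡∣p∣*∣q∣ p q)) Kη≡ε
        (ℚ.≤-<-trans
          (ℚ.*-monoʳ-≤-nonNeg ℚ.∣ q ∣ {{ℚ.∣-∣-nonNeg q}} (ℚ.<⇒≤ p<K))
          (ℚ.*-monoʳ-<-pos K {{positive 0<K}} q<η))

    product-difference : ∀ a b c d →
      a ℚ.* b ℚ.- c ℚ.* d ≡ a ℚ.* (b ℚ.- d) ℚ.+ d ℚ.* (a ℚ.- c)
    product-difference =
      solve 4 (λ a b c d → a :* b :- c :* d := a :* (b :- d) :+ d :* (a :- c)) refl
      where open +-*-Solver

    difference-bound : ∀ a b c d {K η L θ ε} →
      0ℚ ℚ.< K → K ℚ.* η ≡ ½ ℚ.* ε → 0ℚ ℚ.< L → L ℚ.* θ ≡ ½ ℚ.* ε →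
      ℚ.∣ a ∣ ℚ.< K → ℚ.∣ b ℚ.- d ∣ ℚ.< η → ℚ.∣ d ∣ ℚ.< L → ℚ.∣ a ℚ.- c ∣ ℚ.< θ →
      ℚ.∣ a ℚ.* b ℚ.- c ℚ.* d ∣ ℚ.< ε
    difference-bound a b c d {ε = ε} 0<K Kη 0<L Lθ a<K bd<η d<L ac<θ =
      subst (λ u → ℚ.∣ u ∣ ℚ.< ε) (sym (product-difference a b c d))
        (sum-bound (a ℚ.* (b ℚ.- d)) (d ℚ.* (a ℚ.- c)) {ε}
          (product-bound a (b ℚ.- d) 0<K Kη a<K bd<η)
          (product-bound d (a ℚ.- c) 0<L Lθ d<L ac<θ))

  *-cauchy : ∀ {s t} → IsCauchy s → IsCauchy t → IsCauchy (λ n → s n ℚ.* t n)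
  *-cauchy {s} {t} cs ct ε 0<ε =
    let K , 0<K , Nₛ , s<K = eventually-bounded cs
        L , 0<L , Nₜ , t<L = eventually-bounded ct
        η , 0<η , Kη = shrink 0<K (half-positive 0<ε)
        θ , 0<θ , Lθ = shrink 0<L (half-positive 0<ε)
        Mₜ , closeₜ = ct η 0<η
        Mₛ , closeₛ = cs θ 0<θ
        ≥N : ∀ {k} → (Nₛ ⊔ Nₜ) ⊔ (Mₜ ⊔ Mₛ) ≤ k → Nₛ ⊔ Nₜ ≤ k
        ≥N = ℕ.m⊔n≤o⇒m≤o (Nₛ ⊔ Nₜ) (Mₜ ⊔ Mₛ)
        ≥M : ∀ {k} → (Nₛ ⊔ Nₜ) ⊔ (Mₜ ⊔ Mₛ) ≤ k → Mₜ ⊔ Mₛ ≤ k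
        ≥M = ℕ.m⊔n≤o⇒n≤o (Nₛ ⊔ Nₜ) (Mₜ ⊔ Mₛ)
    in (Nₛ ⊔ Nₜ) ⊔ (Mₜ ⊔ Mₛ) , λ m n p q →
      difference-bound (s m) (t m) (s n) (t n) {K} {η} {L} {θ} {ε} 0<K Kη 0<L Lθ
        (s<K m (ℕ.m⊔n≤o⇒m≤o Nₛ Nₜ (≥N p)))
        (closeₜ m n (ℕ.m⊔n≤o⇒m≤o Mₜ Mₛ (≥M p)) (ℕ.m⊔n≤o⇒m≤o Mₜ Mₛ (≥M q)))
        (t<L n (ℕ.m⊔n≤o⇒n≤o Nₛ Nₜ (≥N q)))
        (closeₛ m n (ℕ.m⊔n≤o⇒n≤o Mₜ Mₛ (≥M p)) (ℕ.m⊔n≤o⇒n≤o Mₜ Mₛ (≥M q)))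

fromℚ : ℚ → ℝ
fromℚ q = mkℝ (const q) (constant-cauchy q)

infixl 6 _+ℝ_
infixl 7 _*ℝ_
infix  8 -ℝ_

_+ℝ_ : ℝ → ℝ → ℝ
a +ℝ b = mkℝ (λ n → seq a n ℚ.+ seq b n) (+-cauchy {seq a} {seq b} (cauchy a) (cauchy b))

_*ℝ_ : ℝ → ℝ → ℝ
a *ℝ b = mkℝ (λ n → seq a n ℚ.* seq b n) (*-cauchy {seq a} {seq b} (cauchy a) (cauchy b))

-ℝ_ : ℝ → ℝ
-ℝ a = mkℝ (λ n → ℚ.- seq a n) (neg-cauchy {seq a} (cauchy a))

infix 5 _+i_
record ℂ : Set where
  constructor _+i_
  field
    re im : ℝ

open ℂ

infix 4 _≈_
_≈_ : Rel ℂ 0ℓ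
a ≈ b = re a ≈ℝ re b × im a ≈ℝ im b

fromℤ : ℤ → ℂ
fromℤ z = fromℚ (z ℚ./ 1) +i fromℚ 0ℚ

0ℂ 1ℂ : ℂ
0ℂ = fromℤ 0ℤ
1ℂ = fromℤ 1ℤ

infixl 6 _+_
infixl 7 _*_

_+_ : ℂ → ℂ → ℂ
a + b = (re a +ℝ re b) +i (im a +ℝ im b)

_*_ : ℂ → ℂ → ℂ
a * b = (re a *ℝ re b +ℝ -ℝ (im a *ℝ im b)) +i (re a *ℝ im b +ℝ im a *ℝ re b)

conj : ℂ → ℂ
conj a = re a +i (-ℝ im a)

∑ : ∀ {n} → (Fin n → ℂ) → ℂ
∑ = RawMonoidDefs.sum record { _≈_ = _≈_ ; _∙_ = _+_ ; ε = 0ℂ }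

-- Negation is scalar multiplication by -1, so the semimodule operations
-- are all the structure a vector space carries.
Space : Set₁
Space = RawLeftSemimodule ℂ 0ℓ 0ℓ

scalars : Space
scalars = record { Carrierᴹ = ℂ ; _≈ᴹ_ = _≈_ ; _+ᴹ_ = _+_ ; _*ₗ_ = _*_ ; 0ᴹ = 0ℂ }

power : Set → Space → Space
power I M = record
  { Carrierᴹ = I → Carrierᴹ
  ; _≈ᴹ_     = λ u v → ∀ i → u i ≈ᴹ v i
  ; _+ᴹ_     = λ u v i → u i +ᴹ v i
  ; _*ₗ_     = λ c v i → c *ₗ v i
  ; 0ᴹ       = λ _ → 0ᴹ
  }
  where open RawLeftSemimodule M

columns matrices : ℕ → Space
columns n = power (Fin n) scalars
matrices n = power (Fin n) (columns n)

module LinearAlgebra (M : Space) where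
  open RawLeftSemimodule M

  total : ∀ {k} → (Fin k → Carrierᴹ) → Carrierᴹ
  total = RawMonoidDefs.sum +ᴹ-rawMonoid

  combination : ∀ {k} → (Fin k → ℂ) → (Fin k → Carrierᴹ) → Carrierᴹ
  combination c v = total (λ i → c i *ₗ v i)

  Span : ∀ {k} → (Fin k → Carrierᴹ) → Pred Carrierᴹ 0ℓ
  Span v w = ∃[ c ] w ≈ᴹ combination c v

  record IsSubspace (W : Pred Carrierᴹ 0ℓ) : Set where
    field
      respects   : ∀ {u v} → u ≈ᴹ v → W u → W v
      0-closed   : W 0ᴹ
      +-closed   : ∀ {u v} → W u → W v → W (u +ᴹ v)
      *ₗ-closed  : ∀ c {v} → W v → W (c *ₗ v)

    asSpace : Space
    asSpace = record
      { Carrierᴹ = ∃ W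
      ; _≈ᴹ_     = λ u v → proj₁ u ≈ᴹ proj₁ v
      ; _+ᴹ_     = λ (u , p) (v , q) → u +ᴹ v , +-closed p q
      ; _*ₗ_     = λ c (v , p) → c *ₗ v , *ₗ-closed c p
      ; 0ᴹ       = 0ᴹ , 0-closed
      }

  IsNonzero : Pred Carrierᴹ 0ℓ → Set
  IsNonzero W = ∃[ w ] W w × w ≉ᴹ 0ᴹ

  LinearlyIndependent : ∀ {k} → (Fin k → Carrierᴹ) → Set
  LinearlyIndependent v = ∀ c → combination c v ≈ᴹ 0ᴹ → ∀ i → c i ≈ 0ℂ

  record IsBasis (W : Pred Carrierᴹ 0ℓ) {k} (v : Fin k → Carrierᴹ) : Set where
    field
      members     : ∀ i → W (v i)
      independent : LinearlyIndependent v
      spanning    : W ⊆ Span v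

  HasDim : Pred Carrierᴹ 0ℓ → ℕ → Set
  HasDim W k = ∃[ v ] IsBasis W {k} v

Column Mat : ℕ → Set
Column n = Fin n → ℂ
Mat n = Fin n → Fin n → ℂ

infix 4 _≈ᵛ_ _≈ᵐ_
_≈ᵛ_ : ∀ {n} → Rel (Column n) 0ℓ
_≈ᵛ_ {n} = RawLeftSemimodule._≈ᴹ_ (columns n)
_≈ᵐ_ : ∀ {n} → Rel (Mat n) 0ℓ
_≈ᵐ_ {n} = RawLeftSemimodule._≈ᴹ_ (matrices n)

infixr 7 _·_ _⊗_
_·_ : ∀ {n} → Mat n → Column n → Column n
(B · v) y = ∑ (λ z → B y z * v z)

_⊗_ : ∀ {n} → Mat n → Mat n → Mat n
(B ⊗ C) y z = ∑ (λ w → B y w * C w z)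

diagonal : ∀ {n} → Column n → Mat n
diagonal v y z = if does (y Fin.≟ z) then v y else 0ℂ

integral : ∀ {n} → Vec (Vec ℤ n) n → Mat n
integral B i j = fromℤ (lookup (lookup B i) j)

⟨_,_⟩ : ∀ {n} → Column n → Column n → ℂ
⟨ u , v ⟩ = ∑ (λ y → u y * conj (v y))

module _ {n : ℕ} where
  open LinearAlgebra (columns n)
  open RawLeftSemimodule (columns n) using (_*ₗ_)

  Eigenspace : Mat n → ℂ → Pred (Column n) 0ℓ
  Eigenspace B θ v = B · v ≈ᵛ θ *ₗ v

  record HasEigenvalues (B : Mat n) {k} (θ : Vec ℂ k) : Set where
    field
      distinct   : ∀ i j → lookup θ i ≈ lookup θ j → i ≡ j
      eigenvalue : ∀ i → IsNonzero (Eigenspace B (lookup θ i))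
      exhaustive : ∀ η → IsNonzero (Eigenspace B η) → ∃[ i ] η ≈ lookup θ i

  -- For the (real symmetric) adjacency matrices to which this is applied,
  -- the multiplicity of an eigenvalue is the dimension of its eigenspace.
  HasSpectrum : Mat n → ∀ {k} → Vec ℂ k → Vec ℕ k → Set
  HasSpectrum B θ m =
    HasEigenvalues B θ × (∀ i → HasDim (Eigenspace B (lookup θ i)) (lookup m i))

  Represents : ∀ {ℓ} → Mat ℓ → Mat n → Vec (Column n) ℓ → Set
  Represents B M v =
    ∀ j → M · lookup v j ≈ᵛ combination (λ i → B i j) (lookup v)

  Image : Mat n → Pred (Column n) 0ℓ → Pred (Column n) 0ℓ
  Image B W v = ∃[ w ] W w × v ≈ᵛ B · w

data Walk {A : Set} (_~_ : Rel A 0ℓ) : ℕ → Rel A 0ℓ where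
  []  : ∀ {x} → Walk _~_ 0 x x
  _∷_ : ∀ {k x y z} → x ~ y → Walk _~_ k y z → Walk _~_ (suc k) x z

record Graph (n : ℕ) : Set₁ where
  infix 4 _~_ _~?_
  field
    _~_         : Rel (Fin n) 0ℓ
    _~?_        : Decidable _~_
    symmetric   : Symmetric _~_
    irreflexive : Irreflexive _≡_ _~_
    connected   : ∀ x y → ∃[ k ] Walk _~_ k x y

-- The least k ≤ b with P k, provided there is one.
least : ∀ {P : Pred ℕ 0ℓ} → Unary.Decidable P → (b : ℕ) → ℕ
least P? zero = zero
least P? (suc b) with P? 0
... | yes _ = 0
... | no  _ = suc (least (P? ∘ suc) b)

module _ {n : ℕ} (Γ : Graph n) where
  open Graph Γ

  walk? : ∀ k → Decidable (Walk _~_ k)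
  walk? zero x y = map′ (λ { refl → [] }) (λ { [] → refl }) (x Fin.≟ y)
  walk? (suc k) x y =
    map′ (λ { (_ , e , w) → e ∷ w }) (λ { (e ∷ w) → _ , e , w })
         (any? (λ z → (x ~? z) ×-dec walk? k z y))

  dist : Fin n → Fin n → ℕ
  dist x y = least (λ k → walk? k x y) (proj₁ (connected x y))

  diameter : ℕ
  diameter = Vector.foldr _⊔_ 0 (λ x → Vector.foldr _⊔_ 0 (dist x))

  Sphere : ℕ → Fin n → Set
  Sphere i x = ∃[ y ] dist x y ≡ i

  commonCount : ℕ → ℕ → Fin n → Fin n → ℕ
  commonCount i j y z =
    length (filter (λ w → (dist y w ≟ i) ×-dec (dist z w ≟ j)) (allFin n))

  record DistanceRegular : Set where
    field
      p        : ℕ → ℕ → ℕ → ℕ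
      constant : ∀ {h i j} → h ≤ diameter → i ≤ diameter → j ≤ diameter →
                 ∀ y z → dist y z ≡ h → commonCount i j y z ≡ p h i j

  HasIntersectionArray : List ℕ → List ℕ → Set
  HasIntersectionArray b c = Σ[ dr ∈ DistanceRegular ]
    (let open DistanceRegular dr in
      map (λ i → p i 1 (suc i)) (upTo diameter) ≡ b ×
      map (λ i → p (suc i) 1 i) (upTo diameter) ≡ c)

  adjacency : Mat n
  adjacency y z = if does (y ~? z) then 1ℂ else 0ℂ

infix 4 _≅ᴳ_
_≅ᴳ_ : ∀ {m n} → Graph m → Graph n → Set
_≅ᴳ_ {m} {n} Γ Δ = Σ[ f ∈ Fin m ↔ Fin n ]
  (∀ x y → x Γ.~ y ⇔ Inverse.to f x Δ.~ Inverse.to f y)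
  where
  module Γ = Graph Γ
  module Δ = Graph Δ

module _ (m n : ℕ) .{{_ : ℕ.NonZero m}} .{{_ : ℕ.NonZero n}} where

  -- The parts are the first m and the last n vertices.
  isLeft : Fin (m ℕ.+ n) → Bool
  isLeft x = [ const true , const false ]′ (splitAt m x)

  private
    opposite : ∀ x → ∃[ z ] isLeft x ≢ isLeft z
    opposite x with isLeft x
    ... | true  = m ↑ʳ fromℕ< (ℕ.>-nonZero⁻¹ n) , λ eq →
      true≢false (trans eq (cong [ const true , const false ]′ (splitAt-↑ʳ m n _)))
      where
      true≢false : true ≢ false
      true≢false ()
    ... | false = fromℕ< (ℕ.>-nonZero⁻¹ m) ↑ˡ n , λ eq →
      false≢true (trans eq (cong [ const true , const false ]′ (splitAt-↑ˡ m (fromℕ< _) n)))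
      where
      false≢true : false ≢ true
      false≢true ()

  completeBipartite : Graph (m ℕ.+ n)
  completeBipartite = record
    { _~_         = _~_
    ; _~?_        = λ x y → ¬? (isLeft x Bool.≟ isLeft y)
    ; symmetric   = λ x≢y → x≢y ∘ sym
    ; irreflexive = λ { refl x≢x → x≢x refl }
    ; connected   = walk
    }
    where
    _~_ : Rel (Fin (m ℕ.+ n)) 0ℓ
    x ~ y = isLeft x ≢ isLeft y

    walk : ∀ x y → ∃[ k ] Walk _~_ k x y
    walk x y with isLeft x Bool.≟ isLeft y
    ... | no  x~y = 1 , x~y ∷ []
    ... | yes x≡y with opposite x
    ...   | z , x~z = 2 , x~z ∷ ((λ z≡y → x~z (trans x≡y (sym z≡y))) ∷ [])

module Terwilliger {n : ℕ} (Γ : Graph n) (x : Fin n) where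

  open LinearAlgebra (columns n) public
  open RawLeftSemimodule (columns n) using (_≈ᴹ_; _≉ᴹ_; 0ᴹ)

  V : Set
  V = Column n

  D : ℕ
  D = diameter Γ

  e* : ℕ → V
  e* i y = if does (dist Γ x y ≟ i) then 1ℂ else 0ℂ

  E* : ℕ → Mat n
  E* i = diagonal (e* i)

  data T : Pred (Mat n) 0ℓ where
    gen-A    : T (adjacency Γ)
    gen-E*   : ∀ i → i ≤ D → T (E* i)
    identity : T (diagonal (λ _ → 1ℂ))
    add      : ∀ {B C} → T B → T C → T (λ y z → B y z + C y z)
    scale    : ∀ c {B} → T B → T (λ y z → c * B y z)
    mul      : ∀ {B C} → T B → T C → T (B ⊗ C)
    respects : ∀ {B C} → B ≈ᵐ C → T B → T C

  T-HasDim : ℕ → Set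
  T-HasDim = LinearAlgebra.HasDim (matrices n) T

  record TModule : Set₁ where
    field
      space      : Pred V 0ℓ
      isSubspace : IsSubspace space
      closed     : ∀ {B v} → T B → space v → space (B · v)

    open IsSubspace isSubspace public

  open TModule

  -- Since _≈_ is not decidable, ⊂ (inclusion whose converse is refuted) keeps
  -- minimality negative: a nonzero submodule is only not-not equal to W.
  record IsIrreducible (W : TModule) : Set₁ where
    field
      nonzero : IsNonzero (space W)
      minimal : ∀ (Y : TModule) → IsNonzero (space Y) → ¬ (space Y ⊂ space W)

  infix 4 _≅_
  record _≅_ (W Y : TModule) : Set where
    open LeftSemimoduleMorphisms (asSpace W) (asSpace Y)
    field
      to            : ∃ (space W) → ∃ (space Y)
      isIsomorphism : IsLeftSemimoduleIsomorphism to
      commutes      : ∀ {B} (b : T B) w (p : space W w) →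
                      proj₁ (to (B · w , closed W b p)) ≈ᴹ B · proj₁ (to (w , p))

  record IsOrthogonalDecomposition {k} (W : Vec TModule k) : Set₁ where
    field
      irreducible : ∀ i → IsIrreducible (lookup W i)
      orthogonal  : ∀ {i j} → i ≢ j → ∀ {u v} →
                    space (lookup W i) u → space (lookup W j) v → ⟨ u , v ⟩ ≈ 0ℂ
      spanning    : ∀ v → ∃[ w ] (∀ i → space (lookup W i) (w i)) × v ≈ᴹ total w
      direct      : ∀ w → (∀ i → space (lookup W i) (w i)) →
                    total w ≈ᴹ 0ᴹ → ∀ i → w i ≈ᴹ 0ᴹ

  component : ℕ → TModule → Pred V 0ℓ
  component i W = Image (E* i) (space W)

  HasEndpoint : TModule → ℕ → Set
  HasEndpoint W r =
    r ≤ D × IsNonzero (component r W) × (∀ i → i < r → ¬ IsNonzero (component i W))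

  HasDiameter : TModule → ℕ → Set
  HasDiameter W δ = Σ[ S ∈ Subset (suc D) ]
    (∀ i → i ∈ S ⇔ IsNonzero (component (toℕ i) W)) × ∣ S ∣ ≡ suc δ

  HasShape : TModule → ∀ {δ} → Vec ℕ (suc δ) → Set
  HasShape W {δ} ρ = ∃[ r ] HasEndpoint W r × HasDiameter W δ ×
    (∀ i → HasDim (component (r ℕ.+ toℕ i) W) (lookup ρ i))

  HasMultiplicityIn : ∀ {k} → Vec TModule k → TModule → ℕ → Set
  HasMultiplicityIn {k} U W m = Σ[ S ∈ Subset k ]
    (∀ i → i ∈ S ⇔ lookup U i ≅ W) × ∣ S ∣ ≡ m

  IsPure : V → ℕ → Set
  IsPure v i = i ≤ D × v ≉ᴹ 0ᴹ × Image (E* i) U v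

  record IsPureBasis (W : TModule) {ℓ} (v : Vec V ℓ) : Set where
    field
      isBasis    : IsBasis (space W) (lookup v)
      support    : Fin ℓ → ℕ
      pure       : ∀ j → IsPure (lookup v j) (support j)
      increasing : ∀ j k → j Fin.≤ k → support j ≤ support k

  -- The vector with the given essential part, relative to an ordering of Γᵢ(x).
  withEssentialPart : ∀ i {k} → Fin k ↔ Sphere Γ i x → Vec ℤ k → V
  withEssentialPart i order row y with dist Γ x y ≟ i
  ... | yes d≡i = fromℤ (lookup row (Inverse.from order (y , d≡i)))
  ... | no  _   = 0ℂ

data ModuleType : Set where
  I II III : ModuleType

{-# OPTIONS --safe #-}

-- When the vertices are listed in the order x, Γ₁(x), Γ₂(x), all vectors and matrices in question
-- have integral entries, so the identities between them are decided in ℤ.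
--
-- An eigenvalue is a root of t³ - 9 t because A³ = 9 A, and a rational approximation tells which one.
-- The modules are spanned by pure vectors with distinct supports, so a nonzero submodule contains one
-- of these vectors; in W₀ it then contains the others, because E*ⱼ (A² + 3 A) e*ᵢ is a nonzero multiple
-- of e*ⱼ.  An isomorphism W → W′ maps E*ᵢ W onto E*ᵢ W′, which separates the types, while T acts on the
-- two seed vectors of type II by the same scalars.  Finally T consists of the matrices that are constant
-- on the 11 orbits of the stabilizer S₃ × S₂ of x on pairs of vertices: the generators are invariant
-- under it, and A² + 3 A is three times the all-ones matrix, whose blocks and the E*ᵢ span that space.
--
-- A graph with the intersection array of K₃,₃ has no triangles, and then vertices at distance two have
-- the same neighbours.

module Submission where

open import Defs hiding (_+_)
open import Data.Fin using (Fin)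
open import Data.Integer using (+_; -_; 0ℤ; 1ℤ; -1ℤ)
open import Data.List using ([]; _∷_)
open import Data.Nat using (_+_; _^_)
open import Data.Product using (Σ-syntax; _×_)
open import Data.Vec using ([]; _∷_; lookup; map)
open import Function using (_⇔_; _↔_)
open import Relation.Binary.PropositionalEquality using (_≡_)
open import Relation.Unary using (_≐_)

open Defs using () renaming (_+_ to _+ᶜ_)
open import Algebra.Bundles using (CommutativeRing; RawRing)
open import Algebra.Module.Morphism.Structures using (module LeftSemimoduleMorphisms)
import Algebra.Properties.Semiring.Sum as SemiringSum
import Algebra.Solver.Ring as RingSolver
import Algebra.Solver.Ring.AlmostCommutativeRing as ACR
open import Algebra.Structures using (IsCommutativeRing)
open import Data.Bool using (Bool; true; false; if_then_else_; _xor_)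
import Data.Bool.Properties as Bool
open import Data.Empty using (⊥-elim)
open import Data.Fin using (zero; suc; toℕ; fromℕ<; join)
import Data.Fin as Fin
open import Data.Fin.Patterns
open import Data.Fin.Permutation using (Permutation′; _⟨$⟩ʳ_; _⟨$⟩ˡ_; inverseʳ; inverseˡ; transpose; permutation)
import Data.Fin.Permutation as Permutation
open import Data.Fin.Properties using (all?; any?; +↔⊎; splitAt-join; toℕ-fromℕ<; toℕ≤pred[n])
open import Data.Fin.Subset using (Subset; _∈_; ∣_∣)
open import Data.Integer using (ℤ; -[1+_])
import Data.Integer as ℤ
import Data.Integer.Properties as ℤ
open import Data.List using (List; length; filter; upTo)
import Data.List as List
open import Data.List.Properties using (∷-injective)
open import Data.Maybe using (Maybe; just; nothing)
open import Data.Nat using (ℕ; zero; suc; _≤_; _<_; _⊔_; _≡ᵇ_; z≤n; s≤s)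
import Data.Nat as ℕ
import Data.Nat.Properties as ℕ
open import Data.Product using (∃; ∃-syntax; _,_; proj₁; proj₂)
open import Data.Rational using (ℚ; 0ℚ; 1ℚ; ½)
import Data.Rational as ℚ
import Data.Rational.Properties as ℚ
open import Data.Rational.Solver using (module +-*-Solver)
import Data.Rational.Unnormalised as ℚᵘ
import Data.Rational.Unnormalised.Properties as ℚᵘ
open import Data.Sum using (_⊎_; inj₁; inj₂; [_,_]′)
import Data.Sum as Sum
open import Data.Sum.Properties using (swap-involutive)
open import Data.Vec using (Vec; tabulate)
import Data.Vec.Functional as Vector
open import Data.Vec.Properties using (lookup∘tabulate; lookup⇒[]=; []=⇒lookup)
open import Function using (_∘_; id; const; Inverse; Equivalence; mk↔ₛ′; mk⇔)
open import Function.Construct.Composition using (_↔-∘_)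
open import Function.Construct.Symmetry using (↔-sym)
open import Level using (0ℓ)
open import Relation.Binary.Bundles using (Setoid)
open import Relation.Binary.PropositionalEquality using (_≢_; refl; sym; trans; cong; cong₂; subst; subst₂)
import Relation.Binary.Reasoning.Setoid as SetoidReasoning
open import Relation.Nullary using (¬_; Dec; yes; no; does)
open import Relation.Nullary.Decidable using (from-yes; dec-true; dec-false; _×-dec_; _→-dec_; ¬?)
open import Relation.Unary using (Pred; Decidable; _⊆_; _⊂_)

open ℝ
open ℂ

-- Complex numbers are pairs of Cauchy sequences with undecidable equality, so no argument may ask
-- whether a coefficient vanishes or pick a nonzero coordinate of a nonzero vector. The substitute
-- is tightness: a number that is not invertible is 0. Conclusions that are equations or refutations
-- are reached by supposing a scalar invertible and deriving a contradiction; this covers the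
-- exhaustiveness of the eigenvalues and the minimality of the modules. Elimination is replaced by
-- two kinds of integer identities. A diagonal Gram matrix with nonzero diagonal gives independence,
-- since coefficients are recovered by pairing and dividing. An identity K = Σ mᵢ vᵢ vᵢᵗ between
-- tables gives spanning: an eigenvector of K for an invertible eigenvalue is a combination of the
-- vᵢ. With K a multiple of the identity this yields a basis of V, with K a quadratic polynomial in
-- A a basis of an eigenspace; the weights mᵢ are a constant divided by the norms.

Null : (ℕ → ℚ) → Set
Null s = ∀ ε → 0ℚ ℚ.< ε → ∃[ N ] ∀ n → N ℕ.≤ n → ℚ.∣ s n ∣ ℚ.< ε

-- The positive form of not tending to 0. The explicit bound δ is what later makes the reciprocals a
-- Cauchy sequence; a mere refutation of `Null s` carries no such bound.
Apart : (ℕ → ℚ) → Set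
Apart s = ∃[ δ ] 0ℚ ℚ.< δ × ∃[ N ] ∀ n → N ℕ.≤ n → δ ℚ.≤ ℚ.∣ s n ∣

abstract
  halve : ∀ {ε} → 0ℚ ℚ.< ε → ∃[ δ ] 0ℚ ℚ.< δ × δ ℚ.+ δ ≡ ε
  halve {ε} 0<ε = ½ ℚ.* ε
    , ℚ.positive⁻¹ _ {{ℚ.pos*pos⇒pos ½ ε {{ℚ.positive 0<ε}}}}
    , solve 1 (λ e → con ½ :* e :+ con ½ :* e := e) refl ε
    where open +-*-Solver

  divide : ∀ {K ε} → 0ℚ ℚ.< K → 0ℚ ℚ.< ε → ∃[ δ ] 0ℚ ℚ.< δ × K ℚ.* δ ≡ ε
  divide {K} {ε} 0<K 0<ε = (ℚ.1/ K) ℚ.* ε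
    , ℚ.positive⁻¹ _ {{ℚ.pos*pos⇒pos (ℚ.1/ K) {{ℚ.1/pos⇒pos K}} ε {{ℚ.positive 0<ε}}}}
    , trans (sym (ℚ.*-assoc K (ℚ.1/ K) ε))
        (trans (cong (ℚ._* ε) (ℚ.*-inverseʳ K)) (ℚ.*-identityˡ ε))
    where
    instance
      K-positive : ℚ.Positive K
      K-positive = ℚ.positive 0<K
      K-nonZero : ℚ.NonZero K
      K-nonZero = ℚ.pos⇒nonZero K

  ∣∣-triangle : ∀ p q → ℚ.∣ p ∣ ℚ.≤ ℚ.∣ q ∣ ℚ.+ ℚ.∣ p ℚ.- q ∣
  ∣∣-triangle p q = subst (λ r → ℚ.∣ r ∣ ℚ.≤ ℚ.∣ q ∣ ℚ.+ ℚ.∣ p ℚ.- q ∣)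
    (solve 2 (λ p q → q :+ (p :- q) := p) refl p q) (ℚ.∣p+q∣≤∣p∣+∣q∣ q (p ℚ.- q))
    where open +-*-Solver

*-positive : ∀ {p q} → 0ℚ ℚ.< p → 0ℚ ℚ.< q → 0ℚ ℚ.< p ℚ.* q
*-positive {p} {q} 0<p 0<q =
  ℚ.positive⁻¹ _ {{ℚ.pos*pos⇒pos p {{ℚ.positive 0<p}} q {{ℚ.positive 0<q}}}}

⊔-≤ˡ : ∀ m n {k} → m ⊔ n ℕ.≤ k → m ℕ.≤ k
⊔-≤ˡ m n = ℕ.m⊔n≤o⇒m≤o m n

⊔-≤ʳ : ∀ m n {k} → m ⊔ n ℕ.≤ k → n ℕ.≤ k
⊔-≤ʳ m n = ℕ.m⊔n≤o⇒n≤o m n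

-- Null sequences and their dichotomy with apartness from 0

null-resp : ∀ {s t} → (∀ n → s n ≡ t n) → Null s → Null t
null-resp s≡t null ε 0<ε with null ε 0<ε
... | N , small = N , λ n N≤n → subst (λ q → ℚ.∣ q ∣ ℚ.< ε) (s≡t n) (small n N≤n)

null-0 : ∀ {s} → (∀ n → s n ≡ 0ℚ) → Null s
null-0 s≡0 ε 0<ε = 0 , λ n _ → subst (λ q → ℚ.∣ q ∣ ℚ.< ε) (sym (s≡0 n)) 0<ε

null-+ : ∀ {s t} → Null s → Null t → Null (λ n → s n ℚ.+ t n)
null-+ {s} {t} null-s null-t ε 0<ε =
  let δ , 0<δ , δ+δ≡ε = halve 0<ε
      M , small-s = null-s δ 0<δ
      N , small-t = null-t δ 0<δ
  in M ⊔ N , λ n ≤n → ℚ.≤-<-trans (ℚ.∣p+q∣≤∣p∣+∣q∣ (s n) (t n))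
       (subst (ℚ.∣ s n ∣ ℚ.+ ℚ.∣ t n ∣ ℚ.<_) δ+δ≡ε
         (ℚ.+-mono-< (small-s n (⊔-≤ˡ M N ≤n)) (small-t n (⊔-≤ʳ M N ≤n))))

null-neg : ∀ {s} → Null s → Null (λ n → ℚ.- s n)
null-neg {s} null ε 0<ε with null ε 0<ε
... | N , small = N , λ n N≤n →
  subst (ℚ._< ε) (sym (ℚ.∣-p∣≡∣p∣ (s n))) (small n N≤n)

bounded : ∀ s → IsCauchy s → ∃[ K ] 0ℚ ℚ.< K × ∃[ N ] ∀ n → N ℕ.≤ n → ℚ.∣ s n ∣ ℚ.≤ K
bounded s cauchy-s with cauchy-s 1ℚ (ℚ.positive⁻¹ 1ℚ)
... | N , close = ℚ.∣ s N ∣ ℚ.+ 1ℚ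
  , ℚ.+-mono-≤-< (ℚ.0≤∣p∣ (s N)) (ℚ.positive⁻¹ 1ℚ)
  , N , λ n N≤n → ℚ.≤-trans (∣∣-triangle (s n) (s N))
      (ℚ.+-monoʳ-≤ ℚ.∣ s N ∣ (ℚ.<⇒≤ (close n N N≤n ℕ.≤-refl)))

null-* : ∀ s {t} → IsCauchy s → Null t → Null (λ n → s n ℚ.* t n)
null-* s {t} cauchy-s null-t ε 0<ε with bounded s cauchy-s
... | K , 0<K , M , s≤K with divide 0<K 0<ε
... | δ , 0<δ , Kδ≡ε with null-t δ 0<δ
... | N , small = M ⊔ N , λ n ≤n → subst₂ ℚ._<_ (sym (ℚ.∣p*q∣≡∣p∣*∣q∣ (s n) (t n))) Kδ≡ε
       (ℚ.≤-<-trans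
         (ℚ.*-monoʳ-≤-nonNeg ℚ.∣ t n ∣ {{ℚ.∣-∣-nonNeg (t n)}} (s≤K n (⊔-≤ˡ M N ≤n)))
         (ℚ.*-monoʳ-<-pos K {{ℚ.positive 0<K}} (small n (⊔-≤ʳ M N ≤n))))

-- One rational term decides. Beyond N the sequence oscillates by less than ε/4: if the term at N is
-- below ε/2, the tail stays below ε; otherwise the tail stays at or above ε/4. The alternatives
-- overlap, which is why the choice can be made.
small-or-apart : ∀ s → IsCauchy s → ∀ {ε} → 0ℚ ℚ.< ε →
  (∃[ N ] ∀ n → N ℕ.≤ n → ℚ.∣ s n ∣ ℚ.< ε) ⊎ Apart s
small-or-apart s cauchy-s {ε} 0<ε with halve 0<ε
... | δ , 0<δ , δ+δ≡ε with halve 0<δ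
... | γ , 0<γ , γ+γ≡δ with cauchy-s γ 0<γ
... | N , close with ℚ.∣ s N ∣ ℚ.<? δ
... | yes s<δ = inj₁ (N , λ n N≤n → ℚ.≤-<-trans (∣∣-triangle (s n) (s N))
        (subst (ℚ.∣ s N ∣ ℚ.+ ℚ.∣ s n ℚ.- s N ∣ ℚ.<_) δ+δ≡ε
          (ℚ.+-mono-< s<δ (ℚ.<-trans (close n N N≤n ℕ.≤-refl) γ<δ))))
  where
  γ<δ : γ ℚ.< δ
  γ<δ = subst₂ ℚ._<_ (ℚ.+-identityˡ γ) γ+γ≡δ (ℚ.+-monoˡ-< γ 0<γ)
... | no s≮δ = inj₂ (γ , 0<γ , N , far)
  where
  far : ∀ n → N ℕ.≤ n → γ ℚ.≤ ℚ.∣ s n ∣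
  far n N≤n with γ ℚ.≤? ℚ.∣ s n ∣
  ... | yes γ≤s = γ≤s
  ... | no γ≰s = ⊥-elim (s≮δ (ℚ.≤-<-trans (∣∣-triangle (s N) (s n))
        (subst (ℚ.∣ s n ∣ ℚ.+ ℚ.∣ s N ℚ.- s n ∣ ℚ.<_) γ+γ≡δ
          (ℚ.+-mono-< (ℚ.≰⇒> γ≰s) (close N n ℕ.≤-refl N≤n)))))

-- Tightness for sequences. The goal itself supplies an ε at which `small-or-apart` can be asked,
-- and its second answer is refuted.
¬apart⇒null : ∀ s → IsCauchy s → ¬ Apart s → Null s
¬apart⇒null s cauchy-s ¬apart ε 0<ε with small-or-apart s cauchy-s 0<ε
... | inj₁ small = small
... | inj₂ apart = ⊥-elim (¬apart apart)

abstract
  -- Made total by a default value at 0 so that it applies to every term of a sequence; for a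
  -- sequence that is `Apart`, only finitely many early terms can meet the default.
  inverse : ℚ → ℚ
  inverse q with q ℚ.≟ 0ℚ
  ... | yes _   = 0ℚ
  ... | no q≢0 = (ℚ.1/ q) {{ℚ.≢-nonZero q≢0}}

  *-inverse : ∀ {δ q} → 0ℚ ℚ.< δ → δ ℚ.≤ ℚ.∣ q ∣ → q ℚ.* inverse q ≡ 1ℚ
  *-inverse {δ} {q} 0<δ δ≤q with q ℚ.≟ 0ℚ
  ... | yes refl = ⊥-elim (ℚ.<-irrefl refl (ℚ.<-≤-trans 0<δ δ≤q))
  ... | no q≢0  = ℚ.*-inverseʳ q {{ℚ.≢-nonZero q≢0}}

abstract
  product-≤ : ∀ {δ} a b → 0ℚ ℚ.< δ → δ ℚ.≤ ℚ.∣ a ∣ → δ ℚ.≤ ℚ.∣ b ∣ → δ ℚ.* δ ℚ.≤ ℚ.∣ a ℚ.* b ∣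
  product-≤ {δ} a b 0<δ δ≤a δ≤b = subst (δ ℚ.* δ ℚ.≤_) (sym (ℚ.∣p*q∣≡∣p∣*∣q∣ a b))
    (ℚ.≤-trans (ℚ.*-monoʳ-≤-nonNeg δ {{ℚ.pos⇒nonNeg δ {{ℚ.positive 0<δ}}}} δ≤a)
               (ℚ.*-monoˡ-≤-nonNeg ℚ.∣ a ∣ {{ℚ.∣-∣-nonNeg a}} δ≤b))

  inverse-difference : ∀ a b → a ℚ.* inverse a ≡ 1ℚ → b ℚ.* inverse b ≡ 1ℚ →
    a ℚ.* b ℚ.* (inverse a ℚ.- inverse b) ≡ b ℚ.- a
  inverse-difference a b a⁻¹ b⁻¹ = trans
    (solve 4 (λ a b c d → a :* b :* (c :- d) := b :* (a :* c) :- a :* (b :* d)) refl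
      a b (inverse a) (inverse b))
    (cong₂ ℚ._-_ (trans (cong (b ℚ.*_) a⁻¹) (ℚ.*-identityʳ b))
                 (trans (cong (a ℚ.*_) b⁻¹) (ℚ.*-identityʳ a)))
    where open +-*-Solver

  -- From a b (1/a - 1/b) = b - a, with δ² as a lower bound for the absolute value of a b.
  inverse-lipschitz : ∀ {δ} a b → 0ℚ ℚ.< δ → δ ℚ.≤ ℚ.∣ a ∣ → δ ℚ.≤ ℚ.∣ b ∣ →
    δ ℚ.* δ ℚ.* ℚ.∣ inverse a ℚ.- inverse b ∣ ℚ.≤ ℚ.∣ b ℚ.- a ∣
  inverse-lipschitz {δ} a b 0<δ δ≤a δ≤b = ℚ.≤-trans
    (ℚ.*-monoʳ-≤-nonNeg ℚ.∣ inverse a ℚ.- inverse b ∣ {{ℚ.∣-∣-nonNeg (inverse a ℚ.- inverse b)}}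
      (product-≤ a b 0<δ δ≤a δ≤b))
    (ℚ.≤-reflexive (trans (sym (ℚ.∣p*q∣≡∣p∣*∣q∣ (a ℚ.* b) (inverse a ℚ.- inverse b)))
      (cong ℚ.∣_∣ (inverse-difference a b (*-inverse 0<δ δ≤a) (*-inverse 0<δ δ≤b)))))

inverse-cauchy : ∀ s → IsCauchy s → Apart s → IsCauchy (λ n → inverse (s n))
inverse-cauchy s cauchy-s (δ , 0<δ , M , far) ε 0<ε
  -- Asking s for precision δ² ε compensates the Lipschitz constant 1/δ² of the reciprocal.
  with cauchy-s (δ ℚ.* δ ℚ.* ε) (*-positive (*-positive 0<δ 0<δ) 0<ε)
... | N , close = M ⊔ N , λ m n ≤m ≤n →
  ℚ.*-cancelˡ-<-nonNeg (δ ℚ.* δ)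
    {{ℚ.pos⇒nonNeg (δ ℚ.* δ) {{ℚ.positive (*-positive 0<δ 0<δ)}}}}
    (ℚ.≤-<-trans
      (inverse-lipschitz (s m) (s n) 0<δ (far m (⊔-≤ˡ M N ≤m)) (far n (⊔-≤ˡ M N ≤n)))
      (close n m (⊔-≤ʳ M N ≤n) (⊔-≤ʳ M N ≤m)))

-- Unlike those of _≈_, which unfolds to a product of functions, the arguments of _≋_ can be inferred.
infix 4 _≋_
record _≋_ (a b : ℂ) : Set where
  constructor ⟪_⟫
  field ⟫_⟪ : a ≈ b
open _≋_ public

≋-from-null : ∀ {a b} → Null (λ n → seq (re a) n ℚ.- seq (re b) n) →
              Null (λ n → seq (im a) n ℚ.- seq (im b) n) → a ≋ b
≋-from-null p q = ⟪ p , q ⟫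

pointwise : ∀ {a b} → (∀ n → seq (re a) n ≡ seq (re b) n) →
            (∀ n → seq (im a) n ≡ seq (im b) n) → a ≋ b
pointwise {a} {b} p q = ≋-from-null
  (null-0 (λ n → trans (cong (ℚ._- seq (re b) n) (p n)) (ℚ.+-inverseʳ (seq (re b) n))))
  (null-0 (λ n → trans (cong (ℚ._- seq (im b) n) (q n)) (ℚ.+-inverseʳ (seq (im b) n))))

≋-refl : ∀ {a} → a ≋ a
≋-refl = pointwise (λ _ → refl) (λ _ → refl)

≋-sym : ∀ {a b} → a ≋ b → b ≋ a
≋-sym {a} {b} ⟪ p , q ⟫ = ≋-from-null
  (null-resp (λ n → flip (seq (re a) n) (seq (re b) n)) (null-neg p))
  (null-resp (λ n → flip (seq (im a) n) (seq (im b) n)) (null-neg q))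
  where
  open +-*-Solver
  flip : ∀ x y → ℚ.- (x ℚ.- y) ≡ y ℚ.- x
  flip = solve 2 (λ x y → :- (x :- y) := y :- x) refl

≋-trans : ∀ {a b c} → a ≋ b → b ≋ c → a ≋ c
≋-trans {a} {b} {c} ⟪ p , q ⟫ ⟪ r , s ⟫ = ≋-from-null
  (null-resp (λ n → telescope (seq (re a) n) (seq (re b) n) (seq (re c) n)) (null-+ p r))
  (null-resp (λ n → telescope (seq (im a) n) (seq (im b) n) (seq (im c) n)) (null-+ q s))
  where
  open +-*-Solver
  telescope : ∀ x y z → (x ℚ.- y) ℚ.+ (y ℚ.- z) ≡ x ℚ.- z
  telescope = solve 3 (λ x y z → (x :- y) :+ (y :- z) := x :- z) refl

-- The commutative ring ℂ

-ᶜ_ : ℂ → ℂ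
-ᶜ a = (-ℝ re a) +i (-ℝ im a)

+ᶜ-cong : ∀ {a b c d} → a ≋ b → c ≋ d → a +ᶜ c ≋ b +ᶜ d
+ᶜ-cong {a} {b} {c} {d} ⟪ p , q ⟫ ⟪ r , s ⟫ = ≋-from-null
  (null-resp (λ n → swap (seq (re a) n) (seq (re b) n) (seq (re c) n) (seq (re d) n)) (null-+ p r))
  (null-resp (λ n → swap (seq (im a) n) (seq (im b) n) (seq (im c) n) (seq (im d) n)) (null-+ q s))
  where
  open +-*-Solver
  swap : ∀ x y z w → (x ℚ.- y) ℚ.+ (z ℚ.- w) ≡ (x ℚ.+ z) ℚ.- (y ℚ.+ w)
  swap = solve 4 (λ x y z w → (x :- y) :+ (z :- w) := (x :+ z) :- (y :+ w)) refl

-ᶜ-cong : ∀ {a b} → a ≋ b → -ᶜ a ≋ -ᶜ b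
-ᶜ-cong {a} {b} ⟪ p , q ⟫ = ≋-from-null
  (null-resp (λ n → swap (seq (re a) n) (seq (re b) n)) (null-neg p))
  (null-resp (λ n → swap (seq (im a) n) (seq (im b) n)) (null-neg q))
  where
  open +-*-Solver
  swap : ∀ x y → ℚ.- (x ℚ.- y) ≡ ℚ.- x ℚ.- ℚ.- y
  swap = solve 2 (λ x y → :- (x :- y) := :- x :- :- y) refl

-- In a c - b d = a (c - d) + d (a - b) each summand is a Cauchy, hence bounded, sequence times a
-- null sequence.
null-product : ∀ (a b c d : ℝ) →
  Null (λ n → seq a n ℚ.- seq b n) → Null (λ n → seq c n ℚ.- seq d n) →
  Null (λ n → seq a n ℚ.* seq c n ℚ.- seq b n ℚ.* seq d n)
null-product a b c d p q =
  null-resp (λ n → split (seq a n) (seq b n) (seq c n) (seq d n))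
    (null-+ (null-* (seq a) (cauchy a) q) (null-* (seq d) (cauchy d) p))
  where
  open +-*-Solver
  split : ∀ x y z w → x ℚ.* (z ℚ.- w) ℚ.+ w ℚ.* (x ℚ.- y) ≡ x ℚ.* z ℚ.- y ℚ.* w
  split = solve 4 (λ x y z w → x :* (z :- w) :+ w :* (x :- y) := x :* z :- y :* w) refl

*-cong : ∀ {a b c d} → a ≋ b → c ≋ d → a * c ≋ b * d
*-cong {a} {b} {c} {d} ⟪ p , q ⟫ ⟪ r , s ⟫ = ≋-from-null
  (null-resp (λ n → difference (seq (re a) n ℚ.* seq (re c) n) (seq (re b) n ℚ.* seq (re d) n)
                               (seq (im a) n ℚ.* seq (im c) n) (seq (im b) n ℚ.* seq (im d) n))
    (null-+ (null-product (re a) (re b) (re c) (re d) p r)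
            (null-neg (null-product (im a) (im b) (im c) (im d) q s))))
  (null-resp (λ n → total (seq (re a) n ℚ.* seq (im c) n) (seq (re b) n ℚ.* seq (im d) n)
                          (seq (im a) n ℚ.* seq (re c) n) (seq (im b) n ℚ.* seq (re d) n))
    (null-+ (null-product (re a) (re b) (im c) (im d) p s)
            (null-product (im a) (im b) (re c) (re d) q r)))
  where
  open +-*-Solver
  difference : ∀ x y z w → (x ℚ.- y) ℚ.+ ℚ.- (z ℚ.- w) ≡ (x ℚ.+ ℚ.- z) ℚ.- (y ℚ.+ ℚ.- w)
  difference = solve 4 (λ x y z w → (x :- y) :+ :- (z :- w) := (x :+ :- z) :- (y :+ :- w)) refl
  total : ∀ x y z w → (x ℚ.- y) ℚ.+ (z ℚ.- w) ≡ (x ℚ.+ z) ℚ.- (y ℚ.+ w)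
  total = solve 4 (λ x y z w → (x :- y) :+ (z :- w) := (x :+ z) :- (y :+ w)) refl

-- The equational laws hold term by term, as polynomial identities over ℚ in the real and imaginary
-- parts; only the congruences are about limits.
ℂ-isCommutativeRing : IsCommutativeRing _≋_ _+ᶜ_ _*_ -ᶜ_ 0ℂ 1ℂ
ℂ-isCommutativeRing = record
  { isRing = record
    { +-isAbelianGroup = record
      { isGroup = record
        { isMonoid = record
          { isSemigroup = record
            { isMagma = record
              { isEquivalence = record { refl = ≋-refl ; sym = ≋-sym ; trans = ≋-trans }
              ; ∙-cong = +ᶜ-cong
              }
            ; assoc = λ a b c → pointwise
                (λ n → ℚ.+-assoc (seq (re a) n) (seq (re b) n) (seq (re c) n))
                (λ n → ℚ.+-assoc (seq (im a) n) (seq (im b) n) (seq (im c) n))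
            }
          ; identity =
              (λ a → pointwise (λ n → ℚ.+-identityˡ (seq (re a) n)) (λ n → ℚ.+-identityˡ (seq (im a) n)))
            , (λ a → pointwise (λ n → ℚ.+-identityʳ (seq (re a) n)) (λ n → ℚ.+-identityʳ (seq (im a) n)))
          }
        ; inverse =
            (λ a → pointwise (λ n → ℚ.+-inverseˡ (seq (re a) n)) (λ n → ℚ.+-inverseˡ (seq (im a) n)))
          , (λ a → pointwise (λ n → ℚ.+-inverseʳ (seq (re a) n)) (λ n → ℚ.+-inverseʳ (seq (im a) n)))
        ; ⁻¹-cong = -ᶜ-cong
        }
      ; comm = λ a b → pointwise
          (λ n → ℚ.+-comm (seq (re a) n) (seq (re b) n))
          (λ n → ℚ.+-comm (seq (im a) n) (seq (im b) n))
      }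
    ; *-cong = *-cong
    ; *-assoc = λ a b c → pointwise
        (λ n → assocʳ (seq (re a) n) (seq (im a) n) (seq (re b) n) (seq (im b) n) (seq (re c) n) (seq (im c) n))
        (λ n → assocⁱ (seq (re a) n) (seq (im a) n) (seq (re b) n) (seq (im b) n) (seq (re c) n) (seq (im c) n))
    ; *-identity =
        (λ a → pointwise (λ n → oneˡʳ (seq (re a) n) (seq (im a) n)) (λ n → oneˡⁱ (seq (re a) n) (seq (im a) n)))
      , (λ a → pointwise (λ n → oneʳʳ (seq (re a) n) (seq (im a) n)) (λ n → oneʳⁱ (seq (re a) n) (seq (im a) n)))
    ; distrib =
        (λ a b c → pointwise
          (λ n → distribˡʳ (seq (re a) n) (seq (im a) n) (seq (re b) n) (seq (im b) n) (seq (re c) n) (seq (im c) n))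
          (λ n → distribˡⁱ (seq (re a) n) (seq (im a) n) (seq (re b) n) (seq (im b) n) (seq (re c) n) (seq (im c) n)))
      , (λ a b c → pointwise
          (λ n → distribʳʳ (seq (re a) n) (seq (im a) n) (seq (re b) n) (seq (im b) n) (seq (re c) n) (seq (im c) n))
          (λ n → distribʳⁱ (seq (re a) n) (seq (im a) n) (seq (re b) n) (seq (im b) n) (seq (re c) n) (seq (im c) n)))
    }
  ; *-comm = λ a b → pointwise
      (λ n → commʳ (seq (re a) n) (seq (im a) n) (seq (re b) n) (seq (im b) n))
      (λ n → commⁱ (seq (re a) n) (seq (im a) n) (seq (re b) n) (seq (im b) n))
  }
  where
  open +-*-Solver
  assocʳ = solve 6 (λ a a′ b b′ c c′ →
    (a :* b :+ :- (a′ :* b′)) :* c :+ :- ((a :* b′ :+ a′ :* b) :* c′) :=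
    a :* (b :* c :+ :- (b′ :* c′)) :+ :- (a′ :* (b :* c′ :+ b′ :* c))) refl
  assocⁱ = solve 6 (λ a a′ b b′ c c′ →
    (a :* b :+ :- (a′ :* b′)) :* c′ :+ (a :* b′ :+ a′ :* b) :* c :=
    a :* (b :* c′ :+ b′ :* c) :+ a′ :* (b :* c :+ :- (b′ :* c′))) refl
  oneˡʳ = solve 2 (λ a a′ → con 1ℚ :* a :+ :- (con 0ℚ :* a′) := a) refl
  oneˡⁱ = solve 2 (λ a a′ → con 1ℚ :* a′ :+ con 0ℚ :* a := a′) refl
  oneʳʳ = solve 2 (λ a a′ → a :* con 1ℚ :+ :- (a′ :* con 0ℚ) := a) refl
  oneʳⁱ = solve 2 (λ a a′ → a :* con 0ℚ :+ a′ :* con 1ℚ := a′) refl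
  distribˡʳ = solve 6 (λ a a′ b b′ c c′ →
    a :* (b :+ c) :+ :- (a′ :* (b′ :+ c′)) :=
    (a :* b :+ :- (a′ :* b′)) :+ (a :* c :+ :- (a′ :* c′))) refl
  distribˡⁱ = solve 6 (λ a a′ b b′ c c′ →
    a :* (b′ :+ c′) :+ a′ :* (b :+ c) :=
    (a :* b′ :+ a′ :* b) :+ (a :* c′ :+ a′ :* c)) refl
  distribʳʳ = solve 6 (λ a a′ b b′ c c′ →
    (b :+ c) :* a :+ :- ((b′ :+ c′) :* a′) :=
    (b :* a :+ :- (b′ :* a′)) :+ (c :* a :+ :- (c′ :* a′))) refl
  distribʳⁱ = solve 6 (λ a a′ b b′ c c′ →
    (b :+ c) :* a′ :+ (b′ :+ c′) :* a :=
    (b :* a′ :+ b′ :* a) :+ (c :* a′ :+ c′ :* a)) refl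
  commʳ = solve 4 (λ a a′ b b′ → a :* b :+ :- (a′ :* b′) := b :* a :+ :- (b′ :* a′)) refl
  commⁱ = solve 4 (λ a a′ b b′ → a :* b′ :+ a′ :* b := b :* a′ :+ b′ :* a) refl

ℂ-commutativeRing : CommutativeRing 0ℓ 0ℓ
ℂ-commutativeRing = record { isCommutativeRing = ℂ-isCommutativeRing }

-- Conjugation

conj-cong : ∀ {a b} → a ≋ b → conj a ≋ conj b
conj-cong {a} {b} a≋b = ≋-from-null (proj₁ (⟫ a≋b ⟪)) (proj₂ (⟫ -ᶜ-cong {a} {b} a≋b ⟪))

conj-+ : ∀ a b → conj (a +ᶜ b) ≋ conj a +ᶜ conj b
conj-+ a b = pointwise (λ _ → refl) (λ n → ℚ.neg-distrib-+ (seq (im a) n) (seq (im b) n))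

conj-* : ∀ a b → conj (a * b) ≋ conj a * conj b
conj-* a b = pointwise
  (λ n → real (seq (re a) n) (seq (im a) n) (seq (re b) n) (seq (im b) n))
  (λ n → imaginary (seq (re a) n) (seq (im a) n) (seq (re b) n) (seq (im b) n))
  where
  open +-*-Solver
  real = solve 4 (λ a a′ b b′ → a :* b :+ :- (a′ :* b′) := a :* b :+ :- (:- a′ :* :- b′)) refl
  imaginary = solve 4 (λ a a′ b b′ → :- (a :* b′ :+ a′ :* b) := a :* (:- b′) :+ :- a′ :* b) refl

conj-fromℤ : ∀ z → conj (fromℤ z) ≋ fromℤ z
conj-fromℤ z = pointwise (λ _ → refl) (λ _ → refl)

-- The integers inside ℂ

abstract
  -- Normalised fractions are divided by a gcd that does not compute for variables. The homomorphism
  -- laws are therefore carried over from unnormalised fractions, where they hold up to `ℚᵘ.≃`, and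
  -- this uniqueness turns that equivalence into equality.
  fromℚᵘ-unique : ∀ p x → ℚ.toℚᵘ x ℚᵘ.≃ p → ℚ.fromℚᵘ p ≡ x
  fromℚᵘ-unique p x x≃p = ℚ.toℚᵘ-injective {ℚ.fromℚᵘ p} {x}
    (ℚᵘ.≃-trans {ℚ.toℚᵘ (ℚ.fromℚᵘ p)} {p} {ℚ.toℚᵘ x} (ℚ.toℚᵘ-fromℚᵘ p) (ℚᵘ.≃-sym {ℚ.toℚᵘ x} {p} x≃p))

  fromℚᵘ-+ : ∀ p q → ℚ.fromℚᵘ (p ℚᵘ.+ q) ≡ ℚ.fromℚᵘ p ℚ.+ ℚ.fromℚᵘ q
  fromℚᵘ-+ p q = fromℚᵘ-unique (p ℚᵘ.+ q) (ℚ.fromℚᵘ p ℚ.+ ℚ.fromℚᵘ q)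
    (ℚᵘ.≃-trans {ℚ.toℚᵘ (ℚ.fromℚᵘ p ℚ.+ ℚ.fromℚᵘ q)} {ℚ.toℚᵘ (ℚ.fromℚᵘ p) ℚᵘ.+ ℚ.toℚᵘ (ℚ.fromℚᵘ q)} {p ℚᵘ.+ q}
      (ℚ.toℚᵘ-homo-+ (ℚ.fromℚᵘ p) (ℚ.fromℚᵘ q))
      (ℚᵘ.+-cong {ℚ.toℚᵘ (ℚ.fromℚᵘ p)} {p} {ℚ.toℚᵘ (ℚ.fromℚᵘ q)} {q} (ℚ.toℚᵘ-fromℚᵘ p) (ℚ.toℚᵘ-fromℚᵘ q)))

  fromℚᵘ-* : ∀ p q → ℚ.fromℚᵘ (p ℚᵘ.* q) ≡ ℚ.fromℚᵘ p ℚ.* ℚ.fromℚᵘ q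
  fromℚᵘ-* p q = fromℚᵘ-unique (p ℚᵘ.* q) (ℚ.fromℚᵘ p ℚ.* ℚ.fromℚᵘ q)
    (ℚᵘ.≃-trans {ℚ.toℚᵘ (ℚ.fromℚᵘ p ℚ.* ℚ.fromℚᵘ q)} {ℚ.toℚᵘ (ℚ.fromℚᵘ p) ℚᵘ.* ℚ.toℚᵘ (ℚ.fromℚᵘ q)} {p ℚᵘ.* q}
      (ℚ.toℚᵘ-homo-* (ℚ.fromℚᵘ p) (ℚ.fromℚᵘ q))
      (ℚᵘ.*-cong {ℚ.toℚᵘ (ℚ.fromℚᵘ p)} {p} {ℚ.toℚᵘ (ℚ.fromℚᵘ q)} {q} (ℚ.toℚᵘ-fromℚᵘ p) (ℚ.toℚᵘ-fromℚᵘ q)))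

embed : ℤ → ℚ
embed z = z ℚ./ 1

abstract
  embed-* : ∀ m n → embed (m ℤ.* n) ≡ embed m ℚ.* embed n
  embed-* m n = fromℚᵘ-* (ℚᵘ.mkℚᵘ m 0) (ℚᵘ.mkℚᵘ n 0)

  embed-+ : ∀ m n → embed (m ℤ.+ n) ≡ embed m ℚ.+ embed n
  -- The unnormalised sum of m/1 and n/1 has numerator m * 1 + n * 1.
  embed-+ m n = trans (cong embed (sym (cong₂ ℤ._+_ (ℤ.*-identityʳ m) (ℤ.*-identityʳ n)))) sum
    where
    sum : embed (m ℤ.* 1ℤ ℤ.+ n ℤ.* 1ℤ) ≡ embed m ℚ.+ embed n
    sum = fromℚᵘ-+ (ℚᵘ.mkℚᵘ m 0) (ℚᵘ.mkℚᵘ n 0)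

  embed-injective : ∀ {m n} → embed m ≡ embed n → m ≡ n
  embed-injective {m} {n} eq with ℚ./-injective-≃ (ℚᵘ.mkℚᵘ m 0) (ℚᵘ.mkℚᵘ n 0) eq
  ... | ℚᵘ.*≡* m1≡n1 = trans (sym (ℤ.*-identityʳ m)) (trans m1≡n1 (ℤ.*-identityʳ n))

fromℤ-+ : ∀ m n → fromℤ (m ℤ.+ n) ≋ fromℤ m +ᶜ fromℤ n
fromℤ-+ m n = pointwise (λ _ → embed-+ m n) (λ _ → refl)

fromℤ-* : ∀ m n → fromℤ (m ℤ.* n) ≋ fromℤ m * fromℤ n
fromℤ-* m n = pointwise
  (λ _ → trans (embed-* m n) (real (embed m) (embed n)))
  (λ _ → imaginary (embed m) (embed n))
  where
  open +-*-Solver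
  real = solve 2 (λ p q → p :* q := p :* q :+ :- (con 0ℚ :* con 0ℚ)) refl
  imaginary = solve 2 (λ p q → con 0ℚ := p :* con 0ℚ :+ con 0ℚ :* q) refl

-- Invertibility in the place of being nonzero

Invertible : ℂ → Set
Invertible z = ∃[ w ] w * z ≋ 1ℂ

private
  modulus² : ℂ → ℝ
  modulus² z = re z *ℝ re z +ℝ im z *ℝ im z

  -- The inverse is the conjugate of z divided by the squared modulus. The real part of the product
  -- is exactly 1 only from the index N on, where the squared modulus is bounded away from 0; the
  -- imaginary part vanishes at every term.
  modulus²-invertible : ∀ z → Apart (seq (modulus² z)) → Invertible z
  modulus²-invertible z apart@(δ , 0<δ , N , far) = (re z *ℝ r) +i (-ℝ (im z *ℝ r)) , ≋-from-null
    (λ ε 0<ε → N , λ n N≤n → subst (λ q → ℚ.∣ q ∣ ℚ.< ε) (sym (real n N≤n)) 0<ε)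
    (null-0 (λ n → imaginary (seq (re z) n) (seq (im z) n) (seq r n)))
    where
    open +-*-Solver
    r : ℝ
    r = mkℝ (λ n → inverse (seq (modulus² z) n)) (inverse-cauchy (seq (modulus² z)) (cauchy (modulus² z)) apart)
    imaginary = solve 3 (λ a b c → (a :* c :* b :+ :- (b :* c) :* a) :- con 0ℚ := con 0ℚ) refl
    real : ∀ n → N ℕ.≤ n →
      (seq (re z) n ℚ.* seq r n ℚ.* seq (re z) n
        ℚ.+ ℚ.- (ℚ.- (seq (im z) n ℚ.* seq r n) ℚ.* seq (im z) n)) ℚ.- 1ℚ ≡ 0ℚ
    real n N≤n = trans
      (solve 3 (λ a b c → (a :* c :* a :+ :- (:- (b :* c) :* b)) :- con 1ℚ
                          := (a :* a :+ b :* b) :* c :- con 1ℚ) refl (seq (re z) n) (seq (im z) n) (seq r n))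
      (cong (ℚ._- 1ℚ) (*-inverse 0<δ (far n N≤n)))

  square-≥0 : ∀ q → 0ℚ ℚ.≤ q ℚ.* q
  square-≥0 q = subst (0ℚ ℚ.≤_) (∣q∣²≡q² q) (ℚ.nonNegative⁻¹ _
    {{ℚ.nonNeg*nonNeg⇒nonNeg ℚ.∣ q ∣ {{ℚ.∣-∣-nonNeg q}} ℚ.∣ q ∣ {{ℚ.∣-∣-nonNeg q}}}})
    where
    ∣q∣²≡q² : ∀ q → ℚ.∣ q ∣ ℚ.* ℚ.∣ q ∣ ≡ q ℚ.* q
    ∣q∣²≡q² q with ℚ.∣p∣≡p∨∣p∣≡-p q
    ... | inj₁ eq rewrite eq = refl
    ... | inj₂ eq rewrite eq = solve 1 (λ q → :- q :* :- q := q :* q) refl q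
      where open +-*-Solver

  sum-of-squares-≥ : ∀ {δ} p q → 0ℚ ℚ.< δ → δ ℚ.≤ ℚ.∣ p ∣ → δ ℚ.* δ ℚ.≤ ℚ.∣ p ℚ.* p ℚ.+ q ℚ.* q ∣
  sum-of-squares-≥ {δ} p q 0<δ δ≤p = ℚ.≤-trans (product-≤ p p 0<δ δ≤p δ≤p)
    (subst₂ ℚ._≤_ (sym (ℚ.0≤p⇒∣p∣≡p (square-≥0 p)))
      (sym (ℚ.0≤p⇒∣p∣≡p (ℚ.+-mono-≤ (square-≥0 p) (square-≥0 q))))
      (subst (ℚ._≤ p ℚ.* p ℚ.+ q ℚ.* q) (ℚ.+-identityʳ (p ℚ.* p))
        (ℚ.+-monoʳ-≤ (p ℚ.* p) (square-≥0 q))))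

apart-re⇒invertible : ∀ z → Apart (seq (re z)) → Invertible z
apart-re⇒invertible z (δ , 0<δ , N , far) =
  modulus²-invertible z (δ ℚ.* δ , *-positive 0<δ 0<δ , N , λ n N≤n →
    sum-of-squares-≥ (seq (re z) n) (seq (im z) n) 0<δ (far n N≤n))

apart-im⇒invertible : ∀ z → Apart (seq (im z)) → Invertible z
apart-im⇒invertible z (δ , 0<δ , N , far) =
  modulus²-invertible z (δ ℚ.* δ , *-positive 0<δ 0<δ , N , λ n N≤n →
    subst (λ q → δ ℚ.* δ ℚ.≤ ℚ.∣ q ∣)
      (ℚ.+-comm (seq (im z) n ℚ.* seq (im z) n) (seq (re z) n ℚ.* seq (re z) n))
      (sum-of-squares-≥ (seq (im z) n) (seq (re z) n) 0<δ (far n N≤n)))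

-- Apartness of either the real or the imaginary part would make z invertible, so neither is apart
-- from 0 and both are null. This is the tool that stands in for every case distinction on whether a
-- scalar vanishes.
¬invertible⇒≋0 : ∀ {z} → ¬ Invertible z → z ≋ 0ℂ
¬invertible⇒≋0 {z} ¬inv = ≋-from-null
  (null-resp (λ n → minus-0 (seq (re z) n)) (¬apart⇒null (seq (re z)) (cauchy (re z)) (λ a → ¬inv (apart-re⇒invertible z a))))
  (null-resp (λ n → minus-0 (seq (im z) n)) (¬apart⇒null (seq (im z)) (cauchy (im z)) (λ a → ¬inv (apart-im⇒invertible z a))))
  where
  open +-*-Solver
  minus-0 = solve 1 (λ q → q := q :- con 0ℚ) refl

private
  embed-distance : ∀ {m n} → m ≢ n → 0ℚ ℚ.< ℚ.∣ embed m ℚ.- embed n ∣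
  embed-distance {m} {n} m≢n with 0ℚ ℚ.<? ℚ.∣ embed m ℚ.- embed n ∣
  ... | yes 0<d = 0<d
  ... | no  0≮d = ⊥-elim (m≢n (embed-injective (trans
          (solve 2 (λ p q → p := (p :- q) :+ q) refl (embed m) (embed n))
          (trans (cong (ℚ._+ embed n) (ℚ.∣p∣≡0⇒p≡0 (embed m ℚ.- embed n) (ℚ.≤-antisym (ℚ.≮⇒≥ 0≮d) (ℚ.0≤∣p∣ _))))
                 (ℚ.+-identityˡ (embed n))))))
    where open +-*-Solver

fromℤ-injective : ∀ {m n} → fromℤ m ≋ fromℤ n → m ≡ n
fromℤ-injective {m} {n} ⟪ null , _ ⟫ with m ℤ.≟ n
... | yes m≡n = m≡n
-- The precision asked for is the distance of m and n itself, and the difference of two constant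
-- sequences never falls below it.
... | no  m≢n with null _ (embed-distance m≢n)
...   | N , small = ⊥-elim (ℚ.<-irrefl refl (small N ℕ.≤-refl))

fromℤ-invertible : ∀ {z} → z ≢ 0ℤ → Invertible (fromℤ z)
fromℤ-invertible {z} z≢0 = apart-re⇒invertible (fromℤ z)
  (_ , embed-distance z≢0 , 0 , λ _ _ → ℚ.≤-reflexive (cong ℚ.∣_∣ (ℚ.+-identityʳ (embed z))))

-- Comparing z with m and with n to a precision below ∣m - n∣/2 decides the disjunction.
separate : ∀ z {m n} → m ≢ n → Invertible (z +ᶜ -ᶜ fromℤ m) ⊎ Invertible (z +ᶜ -ᶜ fromℤ n)
separate z {m} {n} m≢n with halve (embed-distance m≢n)
... | δ , 0<δ , δ+δ≡d
  with small-or-apart (seq (re (z +ᶜ -ᶜ fromℤ m))) (cauchy (re (z +ᶜ -ᶜ fromℤ m))) 0<δ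
     | small-or-apart (seq (re (z +ᶜ -ᶜ fromℤ n))) (cauchy (re (z +ᶜ -ᶜ fromℤ n))) 0<δ
... | inj₂ apart | _          = inj₁ (apart-re⇒invertible (z +ᶜ -ᶜ fromℤ m) apart)
... | inj₁ _     | inj₂ apart = inj₂ (apart-re⇒invertible (z +ᶜ -ᶜ fromℤ n) apart)
... | inj₁ (M , small-m) | inj₁ (N , small-n) = ⊥-elim (ℚ.<-irrefl refl (ℚ.≤-<-trans bound
        (subst (ℚ.∣ zₖ ℚ.- embed n ∣ ℚ.+ ℚ.∣ zₖ ℚ.- embed m ∣ ℚ.<_) δ+δ≡d
          (ℚ.+-mono-< (small-n (M ⊔ N) (ℕ.m≤n⊔m M N)) (small-m (M ⊔ N) (ℕ.m≤m⊔n M N))))))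
  where
  open +-*-Solver
  zₖ = seq (re z) (M ⊔ N)
  bound : ℚ.∣ embed m ℚ.- embed n ∣ ℚ.≤ ℚ.∣ zₖ ℚ.- embed n ∣ ℚ.+ ℚ.∣ zₖ ℚ.- embed m ∣
  bound = subst (λ q → ℚ.∣ q ∣ ℚ.≤ ℚ.∣ zₖ ℚ.- embed n ∣ ℚ.+ ℚ.∣ zₖ ℚ.- embed m ∣)
    (solve 3 (λ z m n → (z :- n) :- (z :- m) := m :- n) refl zₖ (embed m) (embed n))
    (ℚ.∣p-q∣≤∣p∣+∣q∣ (zₖ ℚ.- embed n) (zₖ ℚ.- embed m))

-- Ring laws and a solver for identities over ℂ

private module R = CommutativeRing ℂ-commutativeRing

ℂ-setoid : Setoid 0ℓ 0ℓ
ℂ-setoid = R.setoid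

module ≋-Reasoning = SetoidReasoning ℂ-setoid

+ᶜ-identityˡ : ∀ a → 0ℂ +ᶜ a ≋ a
+ᶜ-identityˡ = R.+-identityˡ

+ᶜ-identityʳ : ∀ a → a +ᶜ 0ℂ ≋ a
+ᶜ-identityʳ = R.+-identityʳ

-ᶜ-inverseʳ : ∀ a → a +ᶜ -ᶜ a ≋ 0ℂ
-ᶜ-inverseʳ = R.-‿inverseʳ

*-assoc : ∀ a b c → (a * b) * c ≋ a * (b * c)
*-assoc = R.*-assoc

*-comm : ∀ a b → a * b ≋ b * a
*-comm = R.*-comm

*-identityˡ : ∀ a → 1ℂ * a ≋ a
*-identityˡ = R.*-identityˡ

*-identityʳ : ∀ a → a * 1ℂ ≋ a
*-identityʳ = R.*-identityʳ

*-zeroˡ : ∀ a → 0ℂ * a ≋ 0ℂ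
*-zeroˡ = R.zeroˡ

*-zeroʳ : ∀ a → a * 0ℂ ≋ 0ℂ
*-zeroʳ = R.zeroʳ

*-distribʳ-+ᶜ : ∀ a b c → (b +ᶜ c) * a ≋ b * a +ᶜ c * a
*-distribʳ-+ᶜ = R.distribʳ

*-distribˡ-+ᶜ : ∀ a b c → a * (b +ᶜ c) ≋ a * b +ᶜ a * c
*-distribˡ-+ᶜ = R.distribˡ

*-congˡ : ∀ {a b c} → b ≋ c → a * b ≋ a * c
*-congˡ = *-cong ≋-refl

*-congʳ : ∀ {a b c} → b ≋ c → b * a ≋ c * a
*-congʳ p = *-cong p ≋-refl

≋-reflexive : ∀ {a b} → a ≡ b → a ≋ b
≋-reflexive refl = ≋-refl

*-exchange : ∀ a b c → a * (b * c) ≋ b * (a * c)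
*-exchange a b c = ≋-trans (≋-sym (*-assoc a b c)) (≋-trans (*-congʳ (*-comm a b)) (*-assoc b a c))

fromℤ-neg : ∀ z → fromℤ (ℤ.- z) ≋ -ᶜ fromℤ z
fromℤ-neg z = ≋-trans (≋-sym (+ᶜ-identityʳ (fromℤ (ℤ.- z))))
  (≋-trans (+ᶜ-cong ≋-refl (≋-sym (-ᶜ-inverseʳ (fromℤ z))))
  (≋-trans (≋-sym (R.+-assoc (fromℤ (ℤ.- z)) (fromℤ z) (-ᶜ fromℤ z)))
  (≋-trans (+ᶜ-cong (≋-trans (≋-sym (fromℤ-+ (ℤ.- z) z)) (≋-reflexive (cong fromℤ (ℤ.+-inverseˡ z)))) ≋-refl)
           (+ᶜ-identityˡ (-ᶜ fromℤ z)))))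

private
  ℤ-rawRing : RawRing 0ℓ 0ℓ
  ℤ-rawRing = record { Carrier = ℤ ; _≈_ = _≡_ ; _+_ = ℤ._+_ ; _*_ = ℤ._*_ ; -_ = ℤ.-_ ; 0# = 0ℤ ; 1# = 1ℤ }

  fromℤ-morphism : ℤ-rawRing ACR.-Raw-AlmostCommutative⟶ ACR.fromCommutativeRing ℂ-commutativeRing
  fromℤ-morphism = record
    { ⟦_⟧ = fromℤ ; +-homo = fromℤ-+ ; *-homo = fromℤ-* ; -‿homo = fromℤ-neg
    ; 0-homo = ≋-refl ; 1-homo = ≋-refl }

  coefficient≟ : (m n : ℤ) → Maybe (fromℤ m ≋ fromℤ n)
  coefficient≟ m n with m ℤ.≟ n
  ... | yes m≡n = just (≋-reflexive (cong fromℤ m≡n))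
  ... | no  _   = nothing

-- Coefficients are taken from ℤ because normalisation has to compare them, and equality is
-- decidable there but not in ℂ.
module ℂ-Solver = RingSolver ℤ-rawRing (ACR.fromCommutativeRing ℂ-commutativeRing) fromℤ-morphism coefficient≟

-- Invertible scalars

cancelˡ : ∀ {a b} → Invertible a → a * b ≋ 0ℂ → b ≋ 0ℂ
cancelˡ {a} {b} (a⁻¹ , a⁻¹a≋1) ab≋0 = begin
  b               ≈⟨ *-identityˡ b ⟨
  1ℂ * b          ≈⟨ *-congʳ a⁻¹a≋1 ⟨
  (a⁻¹ * a) * b   ≈⟨ *-assoc a⁻¹ a b ⟩
  a⁻¹ * (a * b)   ≈⟨ *-congˡ ab≋0 ⟩
  a⁻¹ * 0ℂ        ≈⟨ *-zeroʳ a⁻¹ ⟩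
  0ℂ              ∎
  where open ≋-Reasoning

difference-≋0 : ∀ a b → a +ᶜ -ᶜ b ≋ 0ℂ → a ≋ b
difference-≋0 a b a-b≋0 = begin
  a                   ≈⟨ solve 2 (λ a b → a := (a :- b) :+ b) ≋-refl a b ⟩
  (a +ᶜ -ᶜ b) +ᶜ b    ≈⟨ +ᶜ-cong a-b≋0 ≋-refl ⟩
  0ℂ +ᶜ b             ≈⟨ +ᶜ-identityˡ b ⟩
  b                   ∎
  where
  open ≋-Reasoning
  open ℂ-Solver

*-injectiveʳ : ∀ {a b c} → Invertible c → a * c ≋ b * c → a ≋ b
*-injectiveʳ {a} {b} {c} inv ac≋bc = difference-≋0 a b (cancelˡ inv (begin
  c * (a +ᶜ -ᶜ b)          ≈⟨ solve 3 (λ a b c → c :* (a :- b) := a :* c :- b :* c) ≋-refl a b c ⟩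
  a * c +ᶜ -ᶜ (b * c)      ≈⟨ +ᶜ-cong ac≋bc ≋-refl ⟩
  b * c +ᶜ -ᶜ (b * c)      ≈⟨ -ᶜ-inverseʳ (b * c) ⟩
  0ℂ                       ∎))
  where
  open ≋-Reasoning
  open ℂ-Solver

-- Finite sums

private module Σℂ = SemiringSum R.semiring

∑-cong : ∀ {n} {f g : Fin n → ℂ} → (∀ i → f i ≋ g i) → ∑ f ≋ ∑ g
∑-cong = Σℂ.sum-cong-≋

∑-distrib : ∀ {n} (f g : Fin n → ℂ) → ∑ (λ i → f i +ᶜ g i) ≋ ∑ f +ᶜ ∑ g
∑-distrib = Σℂ.∑-distrib-+

*-∑ : ∀ {n} c (f : Fin n → ℂ) → c * ∑ f ≋ ∑ (λ i → c * f i)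
*-∑ = Σℂ.*-distribˡ-sum

∑-* : ∀ {n} c (f : Fin n → ℂ) → ∑ f * c ≋ ∑ (λ i → f i * c)
∑-* = Σℂ.*-distribʳ-sum

∑-comm : ∀ {m n} (f : Fin m → Fin n → ℂ) → ∑ (λ i → ∑ (λ j → f i j)) ≋ ∑ (λ j → ∑ (λ i → f i j))
∑-comm = Σℂ.∑-comm

∑-permute : ∀ {n} (f : Fin n → ℂ) (π : Permutation′ n) → ∑ f ≋ ∑ (λ i → f (π ⟨$⟩ʳ i))
∑-permute = Σℂ.sum-permute

∑-0 : ∀ {n} {f : Fin n → ℂ} → (∀ i → f i ≋ 0ℂ) → ∑ f ≋ 0ℂ
∑-0 {n} f≋0 = ≋-trans (∑-cong f≋0) (Σℂ.sum-replicate-zero n)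

∑-single : ∀ {n} (f : Fin n → ℂ) i → (∀ j → j ≢ i → f j ≋ 0ℂ) → ∑ f ≋ f i
∑-single f zero f≋0 = ≋-trans (+ᶜ-cong ≋-refl (∑-0 (λ j → f≋0 (suc j) (λ ())))) (+ᶜ-identityʳ (f zero))
∑-single f (suc i) f≋0 = ≋-trans
  (+ᶜ-cong (f≋0 zero (λ ())) (∑-single (f ∘ suc) i (λ j j≢i → f≋0 (suc j) (λ { refl → j≢i refl }))))
  (+ᶜ-identityˡ (f (suc i)))

δ : ∀ {n} → Fin n → Fin n → ℂ
δ i j = if does (i Fin.≟ j) then 1ℂ else 0ℂ

δ-same : ∀ {n} (i : Fin n) → δ i i ≋ 1ℂ
δ-same i rewrite dec-true (i Fin.≟ i) refl = ≋-refl

δ-distinct : ∀ {n} {i j : Fin n} → i ≢ j → δ i j ≋ 0ℂ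
δ-distinct {i = i} {j} i≢j rewrite dec-false (i Fin.≟ j) i≢j = ≋-refl

∑-δ : ∀ {n} i (f : Fin n → ℂ) → ∑ (λ j → δ i j * f j) ≋ f i
∑-δ i f = ≋-trans
  (∑-single (λ j → δ i j * f j) i (λ j j≢i → ≋-trans (*-congʳ (δ-distinct (j≢i ∘ sym))) (*-zeroˡ (f j))))
  (≋-trans (*-congʳ (δ-same i)) (*-identityˡ (f i)))

∑ℤ : ∀ {n} → (Fin n → ℤ) → ℤ
∑ℤ {zero}  f = 0ℤ
∑ℤ {suc n} f = f zero ℤ.+ ∑ℤ (f ∘ suc)

fromℤ-∑ : ∀ {n} (f : Fin n → ℤ) → fromℤ (∑ℤ f) ≋ ∑ (λ i → fromℤ (f i))
fromℤ-∑ {zero}  f = ≋-refl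
fromℤ-∑ {suc n} f = ≋-trans (fromℤ-+ (f zero) (∑ℤ (f ∘ suc))) (+ᶜ-cong ≋-refl (fromℤ-∑ (f ∘ suc)))

-- Matrices and columns

infix 4 _≋ᵛ_ _≋ᵐ_
_≋ᵛ_ : ∀ {n} → Column n → Column n → Set
u ≋ᵛ v = ∀ y → u y ≋ v y

_≋ᵐ_ : ∀ {n} → Mat n → Mat n → Set
B ≋ᵐ C = ∀ y z → B y z ≋ C y z

·-cong : ∀ {n} {B C : Mat n} {u v : Column n} → B ≋ᵐ C → u ≋ᵛ v → B · u ≋ᵛ C · v
·-cong B≋C u≋v y = ∑-cong (λ z → *-cong (B≋C y z) (u≋v z))

·-congˡ : ∀ {n} (B : Mat n) {u v : Column n} → u ≋ᵛ v → B · u ≋ᵛ B · v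
·-congˡ B u≋v y = ∑-cong (λ z → *-congˡ (u≋v z))

·-* : ∀ {n} (B : Mat n) c (v : Column n) → B · (λ z → c * v z) ≋ᵛ (λ y → c * (B · v) y)
·-* B c v y = ≋-trans (∑-cong (λ z → *-exchange (B y z) c (v z)))
  (≋-sym (*-∑ c (λ z → B y z * v z)))

·-∑ : ∀ {n k} (B : Mat n) (v : Fin k → Column n) →
      B · (λ z → ∑ (λ i → v i z)) ≋ᵛ (λ y → ∑ (λ i → (B · v i) y))
·-∑ B v y = ≋-trans (∑-cong (λ z → *-∑ (B y z) (λ i → v i z)))
  (∑-comm (λ z i → B y z * v i z))

+-· : ∀ {n} (B C : Mat n) v → (λ y z → B y z +ᶜ C y z) · v ≋ᵛ (λ y → (B · v) y +ᶜ (C · v) y)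
+-· B C v y = ≋-trans (∑-cong (λ z → *-distribʳ-+ᶜ (v z) (B y z) (C y z)))
  (∑-distrib (λ z → B y z * v z) (λ z → C y z * v z))

*-· : ∀ {n} c (B : Mat n) v → (λ y z → c * B y z) · v ≋ᵛ (λ y → c * (B · v) y)
*-· c B v y = ≋-trans (∑-cong (λ z → *-assoc c (B y z) (v z)))
  (≋-sym (*-∑ c (λ z → B y z * v z)))

⊗-· : ∀ {n} (B C : Mat n) v → (B ⊗ C) · v ≋ᵛ B · (C · v)
⊗-· B C v y = begin
  ∑ (λ z → ∑ (λ w → B y w * C w z) * v z)    ≈⟨ ∑-cong (λ z → ∑-* (v z) (λ w → B y w * C w z)) ⟩
  ∑ (λ z → ∑ (λ w → (B y w * C w z) * v z))  ≈⟨ ∑-cong (λ z → ∑-cong (λ w → *-assoc (B y w) (C w z) (v z))) ⟩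
  ∑ (λ z → ∑ (λ w → B y w * (C w z * v z)))  ≈⟨ ∑-comm (λ z w → B y w * (C w z * v z)) ⟩
  ∑ (λ w → ∑ (λ z → B y w * (C w z * v z)))  ≈⟨ ∑-cong (λ w → *-∑ (B y w) (λ z → C w z * v z)) ⟨
  ∑ (λ w → B y w * ∑ (λ z → C w z * v z))    ∎
  where open ≋-Reasoning

diagonal-same : ∀ {n} (d : Column n) y → diagonal d y y ≋ d y
diagonal-same d y rewrite dec-true (y Fin.≟ y) refl = ≋-refl

diagonal-distinct : ∀ {n} (d : Column n) {y z} → y ≢ z → diagonal d y z ≋ 0ℂ
diagonal-distinct d {y} {z} y≢z rewrite dec-false (y Fin.≟ z) y≢z = ≋-refl

diagonal-· : ∀ {n} (d v : Column n) → diagonal d · v ≋ᵛ (λ y → d y * v y)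
diagonal-· d v y = ≋-trans
  (∑-single (λ z → diagonal d y z * v z) y
    (λ z z≢y → ≋-trans (*-congʳ (diagonal-distinct d (z≢y ∘ sym))) (*-zeroˡ (v z))))
  (*-congʳ (diagonal-same d y))

identity-· : ∀ {n} (v : Column n) → diagonal (λ _ → 1ℂ) · v ≋ᵛ v
identity-· v y = ≋-trans (diagonal-· (λ _ → 1ℂ) v y) (*-identityˡ (v y))

≋⇒≈ : ∀ {n} (u v : Column n) → u ≋ᵛ v → u ≈ᵛ v
≋⇒≈ u v u≋v y = ⟫ u≋v y ⟪

≈⇒≋ : ∀ {n} (u v : Column n) → u ≈ᵛ v → u ≋ᵛ v
≈⇒≋ u v u≈v y = ⟪ u≈v y ⟫

-- Spans and orthogonal families

-- The coordinatewise form of `combination`. The latter is a sum of functions, which for a variable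
-- number of summands does not reduce to a sum in ℂ, where the summation laws apply.
lin : ∀ {n k} → (Fin k → ℂ) → (Fin k → Column n) → Column n
lin c v y = ∑ (λ i → c i * v i y)

module _ {n : ℕ} where
  open LinearAlgebra (columns n)

  combination-at : ∀ {k} (c : Fin k → ℂ) (v : Fin k → Column n) y → combination c v y ≡ lin c v y
  combination-at {zero}  c v y = refl
  combination-at {suc k} c v y = cong (c zero * v zero y +ᶜ_) (combination-at (c ∘ suc) (v ∘ suc) y)

  combination≋lin : ∀ {k} (c : Fin k → ℂ) (v : Fin k → Column n) → combination c v ≋ᵛ lin c v
  combination≋lin c v y = ≋-reflexive (combination-at c v y)

  span-intro : ∀ {k} (v : Fin k → Column n) c w → w ≋ᵛ lin c v → Span v w
  span-intro v c w w≋ = c , ≋⇒≈ w (combination c v) (λ y → ≋-trans (w≋ y) (≋-sym (combination≋lin c v y)))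

  span-elim : ∀ {k} (v : Fin k → Column n) w → Span v w → ∃[ c ] w ≋ᵛ lin c v
  span-elim v w (c , w≈) = c , λ y → ≋-trans (≈⇒≋ w (combination c v) w≈ y) (combination≋lin c v y)

  lin-δ : ∀ {k} (v : Fin k → Column n) i → v i ≋ᵛ lin (δ i) v
  lin-δ v i y = ≋-sym (∑-δ i (λ j → v j y))

  span-member : ∀ {k} (v : Fin k → Column n) i → Span v (v i)
  span-member v i = span-intro v (δ i) (v i) (lin-δ v i)

  span-isSubspace : ∀ {k} (v : Fin k → Column n) → IsSubspace (Span v)
  span-isSubspace v = record
    { respects = λ {u} {w} u≈w (c , u≈) → c , ≋⇒≈ w (combination c v) (λ y →
        ≋-trans (≋-sym (≈⇒≋ u w u≈w y)) (≈⇒≋ u (combination c v) u≈ y))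
    ; 0-closed = span-intro v (λ _ → 0ℂ) (λ _ → 0ℂ) (λ y → ≋-sym (∑-0 (λ i → *-zeroˡ (v i y))))
    ; +-closed = λ {u} {w} p q →
        let c , u≋ = span-elim v u p
            d , w≋ = span-elim v w q
        in span-intro v (λ i → c i +ᶜ d i) (λ y → u y +ᶜ w y) (λ y →
             ≋-trans (+ᶜ-cong (u≋ y) (w≋ y))
             (≋-trans (≋-sym (∑-distrib (λ i → c i * v i y) (λ i → d i * v i y)))
                      (∑-cong (λ i → ≋-sym (*-distribʳ-+ᶜ (v i y) (c i) (d i))))))
    ; *ₗ-closed = λ a {u} p →
        let c , u≋ = span-elim v u p
        in span-intro v (λ i → a * c i) (λ y → a * u y) (λ y →
             ≋-trans (*-congˡ (u≋ y))
             (≋-trans (*-∑ a (λ i → c i * v i y))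
                      (∑-cong (λ i → ≋-sym (*-assoc a (c i) (v i y))))))
    }

  lin-closed : ∀ {W} → IsSubspace W → ∀ {k} c (v : Fin k → Column n) → (∀ i → W (v i)) → W (lin c v)
  lin-closed {W} W-sub {zero}  c v v∈W = IsSubspace.0-closed W-sub
  lin-closed {W} W-sub {suc k} c v v∈W = IsSubspace.+-closed W-sub
    {λ y → c zero * v zero y} {lin (c ∘ suc) (v ∘ suc)}
    (IsSubspace.*ₗ-closed W-sub (c zero) {v zero} (v∈W zero))
    (lin-closed {W} W-sub (c ∘ suc) (v ∘ suc) (v∈W ∘ suc))

  respects-≋ : ∀ {W} → IsSubspace W → ∀ u v → u ≋ᵛ v → W u → W v
  respects-≋ W-sub u v u≋v = IsSubspace.respects W-sub {u} {v} (≋⇒≈ u v u≋v)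

  span-⊆ : ∀ {W} → IsSubspace W → ∀ {k} (v : Fin k → Column n) → (∀ i → W (v i)) → ∀ {w} → Span v w → W w
  span-⊆ {W} W-sub v v∈W {w} w∈ =
    let c , w≋ = span-elim v w w∈ in
    respects-≋ {W} W-sub (lin c v) w (λ y → ≋-sym (w≋ y)) (lin-closed {W} W-sub c v v∈W)

  ·-lin : ∀ (B : Mat n) {k} c (v : Fin k → Column n) → B · lin c v ≋ᵛ lin c (λ i → B · v i)
  ·-lin B c v y = ≋-trans (·-∑ B (λ i z → c i * v i z) y) (∑-cong (λ i → ·-* B (c i) (v i) y))

  span-closed : ∀ (B : Mat n) {k} (v : Fin k → Column n) → (∀ i → Span v (B · v i)) →
                ∀ {w} → Span v w → Span v (B · w)
  span-closed B v Bv∈ {w} w∈ =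
    let c , w≋ = span-elim v w w∈ in
    respects-≋ {Span v} (span-isSubspace v) (lin c (λ i → B · v i)) (B · w)
    (λ y → ≋-sym (≋-trans (·-congˡ B w≋ y) (·-lin B c v y)))
    (lin-closed {Span v} (span-isSubspace v) c (λ i → B · v i) Bv∈)

  ⟨⟩-congˡ : ∀ {u v} (w : Column n) → u ≋ᵛ v → ⟨ u , w ⟩ ≋ ⟨ v , w ⟩
  ⟨⟩-congˡ w u≋v = ∑-cong (λ y → *-congʳ (u≋v y))

  ⟨⟩-lin : ∀ {k} c (v : Fin k → Column n) w → ⟨ lin c v , w ⟩ ≋ ∑ (λ i → c i * ⟨ v i , w ⟩)
  ⟨⟩-lin c v w = begin
    ∑ (λ y → ∑ (λ i → c i * v i y) * conj (w y))      ≈⟨ ∑-cong (λ y → ∑-* (conj (w y)) (λ i → c i * v i y)) ⟩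
    ∑ (λ y → ∑ (λ i → (c i * v i y) * conj (w y)))    ≈⟨ ∑-comm (λ y i → (c i * v i y) * conj (w y)) ⟩
    ∑ (λ i → ∑ (λ y → (c i * v i y) * conj (w y)))    ≈⟨ ∑-cong (λ i → ∑-cong (λ y → *-assoc (c i) (v i y) (conj (w y)))) ⟩
    ∑ (λ i → ∑ (λ y → c i * (v i y * conj (w y))))    ≈⟨ ∑-cong (λ i → *-∑ (c i) (λ y → v i y * conj (w y))) ⟨
    ∑ (λ i → c i * ∑ (λ y → v i y * conj (w y)))      ∎
    where open ≋-Reasoning

conj-0 : conj 0ℂ ≋ 0ℂ
conj-0 = conj-fromℤ 0ℤ

conj-involutive : ∀ a → conj (conj a) ≋ a
conj-involutive a = pointwise (λ _ → refl) (λ m → solve 1 (λ q → :- (:- q) := q) refl (ℝ.seq (ℂ.im a) m))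
  where open +-*-Solver

conj-∑ : ∀ {n} (f : Fin n → ℂ) → conj (∑ f) ≋ ∑ (λ i → conj (f i))
conj-∑ {zero}  f = conj-0
conj-∑ {suc n} f = ≋-trans (conj-+ (f zero) (∑ (f ∘ suc))) (+ᶜ-cong ≋-refl (conj-∑ (f ∘ suc)))

⟨⟩-hermitian : ∀ {n} (u v : Column n) → ⟨ u , v ⟩ ≋ conj ⟨ v , u ⟩
⟨⟩-hermitian u v = ≋-sym (begin
  conj (∑ (λ y → v y * conj (u y)))         ≈⟨ conj-∑ (λ y → v y * conj (u y)) ⟩
  ∑ (λ y → conj (v y * conj (u y)))         ≈⟨ ∑-cong (λ y → conj-* (v y) (conj (u y))) ⟩
  ∑ (λ y → conj (v y) * conj (conj (u y)))  ≈⟨ ∑-cong (λ y → *-congˡ (conj-involutive (u y))) ⟩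
  ∑ (λ y → conj (v y) * u y)                ≈⟨ ∑-cong (λ y → *-comm (conj (v y)) (u y)) ⟩
  ∑ (λ y → u y * conj (v y))                ∎)
  where open ≋-Reasoning

⟨⟩-span-0 : ∀ {n k} (v : Fin k → Column n) u → (∀ i → ⟨ v i , u ⟩ ≋ 0ℂ) →
            ∀ {w} → LinearAlgebra.Span (columns n) v w → ⟨ w , u ⟩ ≋ 0ℂ
⟨⟩-span-0 v u v⊥u {w} w∈ =
  let c , w≋ = span-elim v w w∈ in
  ≋-trans (⟨⟩-congˡ u w≋) (≋-trans (⟨⟩-lin c v u)
                 (∑-0 (λ i → ≋-trans (*-congˡ (v⊥u i)) (*-zeroʳ (c i)))))

⟨⟩-sym-0 : ∀ {n} (u v : Column n) → ⟨ u , v ⟩ ≋ 0ℂ → ⟨ v , u ⟩ ≋ 0ℂ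
⟨⟩-sym-0 u v u⊥v = ≋-trans (⟨⟩-hermitian v u) (≋-trans (conj-cong u⊥v) conj-0)

-- The form is linear in its first argument only, so orthogonality is extended to a span there, the
-- arguments are exchanged, and it is extended once more.
spans-orthogonal : ∀ {n k l} (v : Fin k → Column n) (w : Fin l → Column n) →
  (∀ i j → ⟨ v i , w j ⟩ ≋ 0ℂ) →
  ∀ {a b} → LinearAlgebra.Span (columns n) v a → LinearAlgebra.Span (columns n) w b → ⟨ a , b ⟩ ≋ 0ℂ
spans-orthogonal v w v⊥w {a} {b} a∈ b∈ =
  ⟨⟩-span-0 v b (λ i → ⟨⟩-sym-0 b (v i) (⟨⟩-span-0 w (v i) (λ j → ⟨⟩-sym-0 (v i) (w j) (v⊥w i j)) {b} b∈)) {a} a∈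

-- The norms are integers because a nonzero integer is known to be invertible in ℂ; coefficients can
-- then be recovered by pairing with the family and cancelling a norm.
record IsOrthogonal {n k} (v : Fin k → Column n) (norm : Fin k → ℤ) : Set where
  field
    norm≢0     : ∀ i → norm i ≢ 0ℤ
    orthogonal : ∀ {i j} → i ≢ j → ⟨ v i , v j ⟩ ≋ 0ℂ
    normed     : ∀ i → ⟨ v i , v i ⟩ ≋ fromℤ (norm i)

  coefficient : ∀ c j → ⟨ lin c v , v j ⟩ ≋ c j * fromℤ (norm j)
  coefficient c j = ≋-trans (⟨⟩-lin c v (v j)) (≋-trans
    (∑-single (λ i → c i * ⟨ v i , v j ⟩) j
      (λ i i≢j → ≋-trans (*-congˡ (orthogonal i≢j)) (*-zeroʳ (c i))))
    (*-congˡ (normed j)))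

  coefficients-0 : ∀ {w} c → w ≋ᵛ lin c v → (∀ j → ⟨ w , v j ⟩ ≋ 0ℂ) → ∀ j → c j ≋ 0ℂ
  coefficients-0 {w} c w≋ w⊥v j = cancelˡ (fromℤ-invertible (norm≢0 j))
    (≋-trans (*-comm (fromℤ (norm j)) (c j))
    (≋-trans (≋-sym (coefficient c j))
    (≋-trans (≋-sym (⟨⟩-congˡ (v j) w≋)) (w⊥v j))))

  independent : LinearAlgebra.LinearlyIndependent (columns n) v
  independent c c≈0 i = ⟫ coefficients-0 {λ _ → 0ℂ} c
    (λ y → ≋-trans (≋-sym (≈⇒≋ (LinearAlgebra.combination (columns _) c v) (λ _ → 0ℂ) c≈0 y)) (combination≋lin c v y))
    (λ j → ∑-0 (λ y → *-zeroˡ (conj (v j y)))) i ⟪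

  nonzero : ∀ i → ¬ (v i ≋ᵛ (λ _ → 0ℂ))
  nonzero i v≋0 = norm≢0 i (fromℤ-injective (≋-trans (≋-sym (normed i))
    (≋-trans (⟨⟩-congˡ (v i) v≋0) (∑-0 (λ y → *-zeroˡ (conj (v i y)))))))

  span-0 : ∀ {w} → LinearAlgebra.Span (columns n) v w → (∀ j → ⟨ w , v j ⟩ ≋ 0ℂ) → w ≋ᵛ (λ _ → 0ℂ)
  span-0 {w} w∈ w⊥v y =
    let c , w≋ = span-elim v w w∈ in
    ≋-trans (w≋ y) (∑-0 (λ i →
        ≋-trans (*-congʳ (coefficients-0 {w} c w≋ w⊥v i)) (*-zeroˡ (v i y))))

-- Columns and matrices with integral entries, listed along a permutation of the indices

≡-table? : ∀ {m n} (f g : Fin m → Fin n → ℤ) → Dec (∀ i j → f i j ≡ g i j)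
≡-table? f g = all? (λ i → all? (λ j → f i j ℤ.≟ g i j))

Kronecker : ∀ {k} → (Fin k → ℤ) → Fin k → Fin k → ℤ
Kronecker d i j = if does (i Fin.≟ j) then d i else 0ℤ

Kronecker-same : ∀ {k} (d : Fin k → ℤ) i → Kronecker d i i ≡ d i
Kronecker-same d i rewrite dec-true (i Fin.≟ i) refl = refl

Kronecker-distinct : ∀ {k} (d : Fin k → ℤ) {i j} → i ≢ j → Kronecker d i j ≡ 0ℤ
Kronecker-distinct d {i} {j} i≢j rewrite dec-false (i Fin.≟ j) i≢j = refl

infixr 7 _·ℤ_ _⊗ℤ_
_·ℤ_ : ∀ {n} → (Fin n → Fin n → ℤ) → (Fin n → ℤ) → Fin n → ℤ
(B ·ℤ U) k = ∑ℤ (λ l → B k l ℤ.* U l)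

_⊗ℤ_ : ∀ {n} → (Fin n → Fin n → ℤ) → (Fin n → Fin n → ℤ) → Fin n → Fin n → ℤ
(B ⊗ℤ C) k m = ∑ℤ (λ l → B k l ℤ.* C l m)

⟨_,_⟩ℤ : ∀ {n} → (Fin n → ℤ) → (Fin n → ℤ) → ℤ
⟨ U , V ⟩ℤ = ∑ℤ (λ l → U l ℤ.* V l)

module Tables {n : ℕ} (φ : Permutation′ n) where

  infix 4 _∼_ _∼ᵐ_
  _∼_ : Column n → (Fin n → ℤ) → Set
  u ∼ U = ∀ l → u (φ ⟨$⟩ʳ l) ≋ fromℤ (U l)

  _∼ᵐ_ : Mat n → (Fin n → Fin n → ℤ) → Set
  B ∼ᵐ C = ∀ k l → B (φ ⟨$⟩ʳ k) (φ ⟨$⟩ʳ l) ≋ fromℤ (C k l)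

  everywhere : ∀ {P : Pred (Fin n) 0ℓ} → (∀ l → P (φ ⟨$⟩ʳ l)) → ∀ y → P y
  everywhere {P} p y = subst P (inverseʳ φ) (p (φ ⟨$⟩ˡ y))

  ∼-unique : ∀ {u v U V} → u ∼ U → v ∼ V → (∀ l → U l ≡ V l) → u ≋ᵛ v
  ∼-unique u∼U v∼V U≡V = everywhere
    (λ l → ≋-trans (u∼U l) (≋-trans (≋-reflexive (cong fromℤ (U≡V l))) (≋-sym (v∼V l))))

  ∼ᵐ-unique : ∀ {B C B₀ C₀} → B ∼ᵐ B₀ → C ∼ᵐ C₀ → (∀ k l → B₀ k l ≡ C₀ k l) → B ≋ᵐ C
  ∼ᵐ-unique B∼ C∼ B₀≡C₀ = everywhere (λ k → everywhere
    (λ l → ≋-trans (B∼ k l) (≋-trans (≋-reflexive (cong fromℤ (B₀≡C₀ k l))) (≋-sym (C∼ k l)))))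

  ∼-* : ∀ {u U} a → u ∼ U → (λ y → fromℤ a * u y) ∼ (λ l → a ℤ.* U l)
  ∼-* {U = U} a u∼U l = ≋-trans (*-congˡ (u∼U l)) (≋-sym (fromℤ-* a (U l)))

  ∼-lin : ∀ {k} {v : Fin k → Column n} {V : Fin k → Fin n → ℤ} (c : Fin k → ℤ) → (∀ i → v i ∼ V i) →
          lin (λ i → fromℤ (c i)) v ∼ (λ l → ∑ℤ (λ i → c i ℤ.* V i l))
  ∼-lin {V = V} c v∼V l = ≋-trans
    (∑-cong (λ i → ≋-trans (*-congˡ (v∼V i l)) (≋-sym (fromℤ-* (c i) (V i l)))))
    (≋-sym (fromℤ-∑ (λ i → c i ℤ.* V i l)))

  ∑-∼ : ∀ {u U} → u ∼ U → ∑ u ≋ fromℤ (∑ℤ U)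
  ∑-∼ {u} {U} u∼U = ≋-trans (∑-permute u φ) (≋-trans (∑-cong u∼U) (≋-sym (fromℤ-∑ U)))

  ∼-· : ∀ {B B₀ u U} → B ∼ᵐ B₀ → u ∼ U → B · u ∼ B₀ ·ℤ U
  ∼-· {B} {B₀} {u} {U} B∼ u∼ k = ∑-∼ {λ z → B (φ ⟨$⟩ʳ k) z * u z} {λ l → B₀ k l ℤ.* U l}
    (λ l → ≋-trans (*-cong (B∼ k l) (u∼ l)) (≋-sym (fromℤ-* (B₀ k l) (U l))))

  ∼ᵐ-⊗ : ∀ {B B₀ C C₀} → B ∼ᵐ B₀ → C ∼ᵐ C₀ → B ⊗ C ∼ᵐ B₀ ⊗ℤ C₀
  ∼ᵐ-⊗ {B} {B₀} {C} {C₀} B∼ C∼ k m =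
    ∼-· {B} {B₀} {λ z → C z (φ ⟨$⟩ʳ m)} {λ l → C₀ l m} B∼ (λ l → C∼ l m) k

  ∼ᵐ-+ : ∀ {B B₀ C C₀} → B ∼ᵐ B₀ → C ∼ᵐ C₀ → (λ y z → B y z +ᶜ C y z) ∼ᵐ (λ k l → B₀ k l ℤ.+ C₀ k l)
  ∼ᵐ-+ {B₀ = B₀} {C₀ = C₀} B∼ C∼ k l = ≋-trans (+ᶜ-cong (B∼ k l) (C∼ k l)) (≋-sym (fromℤ-+ (B₀ k l) (C₀ k l)))

  ∼ᵐ-* : ∀ {B B₀} a → B ∼ᵐ B₀ → (λ y z → fromℤ a * B y z) ∼ᵐ (λ k l → a ℤ.* B₀ k l)
  ∼ᵐ-* {B₀ = B₀} a B∼ k l = ≋-trans (*-congˡ (B∼ k l)) (≋-sym (fromℤ-* a (B₀ k l)))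

  ∼ᵐ-diagonal : ∀ {d d₀} → d ∼ d₀ → diagonal d ∼ᵐ Kronecker d₀
  ∼ᵐ-diagonal {d} {d₀} d∼ k l with k Fin.≟ l
  ... | yes refl = ≋-trans (diagonal-same d (φ ⟨$⟩ʳ k)) (d∼ k)
  ... | no k≢l = diagonal-distinct d (λ eq → k≢l (trans (sym (inverseˡ φ)) (trans (cong (φ ⟨$⟩ˡ_) eq) (inverseˡ φ))))

  ∼ᵐ-identity : diagonal (λ _ → 1ℂ) ∼ᵐ Kronecker (λ _ → 1ℤ)
  ∼ᵐ-identity = ∼ᵐ-diagonal {λ _ → 1ℂ} {λ _ → 1ℤ} (λ _ → ≋-refl)

  ⟨⟩-∼ : ∀ {u U v V} → u ∼ U → v ∼ V → ⟨ u , v ⟩ ≋ fromℤ ⟨ U , V ⟩ℤ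
  ⟨⟩-∼ {u} {U} {v} {V} u∼ v∼ = ∑-∼ {λ y → u y * conj (v y)} {λ l → U l ℤ.* V l}
    (λ l → ≋-trans (*-cong (u∼ l) (≋-trans (conj-cong (v∼ l)) (conj-fromℤ (V l))))
                   (≋-sym (fromℤ-* (U l) (V l))))

  isOrthogonal : ∀ {k} {v : Fin k → Column n} {V : Fin k → Fin n → ℤ} norm → (∀ i → v i ∼ V i) → (∀ i → norm i ≢ 0ℤ) →
    (∀ i j → ⟨ V i , V j ⟩ℤ ≡ Kronecker norm i j) → IsOrthogonal v norm
  isOrthogonal {v = v} {V} norm v∼V norm≢0 gram = record
    { norm≢0 = norm≢0
    ; orthogonal = λ {i} {j} i≢j → ≋-trans (⟨⟩-∼ {v i} {V i} {v j} {V j} (v∼V i) (v∼V j))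
        (≋-reflexive (cong fromℤ (trans (gram i j) (Kronecker-distinct norm i≢j))))
    ; normed = λ i → ≋-trans (⟨⟩-∼ {v i} {V i} {v i} {V i} (v∼V i) (v∼V i))
        (≋-reflexive (cong fromℤ (trans (gram i i) (Kronecker-same norm i))))
    }

  -- If K is a weighted sum of the projections onto the vᵢ, then every
  -- eigenvector of K for an invertible eigenvalue lies in their span.
  eigenvector∈span : ∀ {k} {v : Fin k → Column n} {V : Fin k → Fin n → ℤ} → (∀ i → v i ∼ V i) →
    ∀ {K K₀} (m : Fin k → ℤ) → K ∼ᵐ K₀ →
    (∀ j l → K₀ j l ≡ ∑ℤ (λ i → m i ℤ.* (V i j ℤ.* V i l))) →
    ∀ {μ w} → Invertible μ → (∀ y → (K · w) y ≋ μ * w y) →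
    LinearAlgebra.Span (columns n) v w
  eigenvector∈span {k} {v} {V} v∼V {K} {K₀} m K∼ K₀≡ {μ} {w} (μ⁻¹ , μ⁻¹μ≋1) Kw≋ =
    span-intro v (λ i → μ⁻¹ * (fromℤ (m i) * s i)) w (λ y → begin
      w y                                                    ≈⟨ *-identityˡ (w y) ⟨
      1ℂ * w y                                               ≈⟨ *-congʳ μ⁻¹μ≋1 ⟨
      (μ⁻¹ * μ) * w y                                        ≈⟨ *-assoc μ⁻¹ μ (w y) ⟩
      μ⁻¹ * (μ * w y)                                        ≈⟨ *-congˡ (Kw≋ y) ⟨
      μ⁻¹ * ∑ (λ z → K y z * w z)                            ≈⟨ *-congˡ (expand y) ⟩
      μ⁻¹ * ∑ (λ i → (fromℤ (m i) * s i) * v i y)            ≈⟨ *-∑ μ⁻¹ (λ i → (fromℤ (m i) * s i) * v i y) ⟩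
      ∑ (λ i → μ⁻¹ * ((fromℤ (m i) * s i) * v i y))          ≈⟨ ∑-cong (λ i → *-assoc μ⁻¹ (fromℤ (m i) * s i) (v i y)) ⟨
      ∑ (λ i → (μ⁻¹ * (fromℤ (m i) * s i)) * v i y)          ∎)
    where
    open ≋-Reasoning
    open ℂ-Solver using (solve; _:*_; _:=_)
    -- The kernel is Σ mᵢ vᵢ vᵢᵗ, so the pairing vᵢᵗ w that appears has no conjugation.
    s : Fin k → ℂ
    s i = ∑ (λ z → v i z * w z)
    kernel : ∀ y z → K y z ≋ ∑ (λ i → fromℤ (m i) * (v i y * v i z))
    kernel = everywhere (λ j → everywhere (λ l → begin
      K (φ ⟨$⟩ʳ j) (φ ⟨$⟩ʳ l)                                        ≈⟨ K∼ j l ⟩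
      fromℤ (K₀ j l)                                                 ≈⟨ ≋-reflexive (cong fromℤ (K₀≡ j l)) ⟩
      fromℤ (∑ℤ (λ i → m i ℤ.* (V i j ℤ.* V i l)))                   ≈⟨ fromℤ-∑ (λ i → m i ℤ.* (V i j ℤ.* V i l)) ⟩
      ∑ (λ i → fromℤ (m i ℤ.* (V i j ℤ.* V i l)))                    ≈⟨ ∑-cong (λ i → ≋-trans (fromℤ-* (m i) (V i j ℤ.* V i l)) (*-congˡ (fromℤ-* (V i j) (V i l)))) ⟩
      ∑ (λ i → fromℤ (m i) * (fromℤ (V i j) * fromℤ (V i l)))        ≈⟨ ∑-cong (λ i → *-congˡ (*-cong (v∼V i j) (v∼V i l))) ⟨
      ∑ (λ i → fromℤ (m i) * (v i (φ ⟨$⟩ʳ j) * v i (φ ⟨$⟩ʳ l)))      ∎))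
    expand : ∀ y → ∑ (λ z → K y z * w z) ≋ ∑ (λ i → (fromℤ (m i) * s i) * v i y)
    expand y = begin
      ∑ (λ z → K y z * w z)
        ≈⟨ ∑-cong (λ z → *-congʳ (kernel y z)) ⟩
      ∑ (λ z → ∑ (λ i → fromℤ (m i) * (v i y * v i z)) * w z)
        ≈⟨ ∑-cong (λ z → ∑-* (w z) (λ i → fromℤ (m i) * (v i y * v i z))) ⟩
      ∑ (λ z → ∑ (λ i → (fromℤ (m i) * (v i y * v i z)) * w z))
        ≈⟨ ∑-comm (λ z i → (fromℤ (m i) * (v i y * v i z)) * w z) ⟩
      ∑ (λ i → ∑ (λ z → (fromℤ (m i) * (v i y * v i z)) * w z))
        ≈⟨ ∑-cong (λ i → ∑-cong (λ z → reorder (fromℤ (m i)) (v i y) (v i z) (w z))) ⟩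
      ∑ (λ i → ∑ (λ z → (fromℤ (m i) * v i y) * (v i z * w z)))
        ≈⟨ ∑-cong (λ i → *-∑ (fromℤ (m i) * v i y) (λ z → v i z * w z)) ⟨
      ∑ (λ i → (fromℤ (m i) * v i y) * s i)
        ≈⟨ ∑-cong (λ i → swap (fromℤ (m i)) (v i y) (s i)) ⟩
      ∑ (λ i → (fromℤ (m i) * s i) * v i y)
        ∎
      where
      reorder : ∀ a b c d → (a * (b * c)) * d ≋ (a * b) * (c * d)
      reorder a b c d = ≋-trans (*-congʳ (≋-sym (*-assoc a b c))) (*-assoc (a * b) c d)
      swap : ∀ a b c → (a * b) * c ≋ (a * c) * b
      swap a b c = ≋-trans (*-assoc a b c) (≋-trans (*-congˡ (*-comm b c)) (≋-sym (*-assoc a c b)))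

  -- The case K = N · identity, of which every vector is an eigenvector for the invertible
  -- eigenvalue N.
  parseval⇒spanning : ∀ {k} {v : Fin k → Column n} {V : Fin k → Fin n → ℤ} → (∀ i → v i ∼ V i) →
    ∀ (m : Fin k → ℤ) N → N ≢ 0ℤ →
    (∀ j l → N ℤ.* Kronecker (λ _ → 1ℤ) j l ≡ ∑ℤ (λ i → m i ℤ.* (V i j ℤ.* V i l))) →
    ∀ w → LinearAlgebra.Span (columns n) v w
  parseval⇒spanning {v = v} {V} v∼V m N N≢0 parseval w =
    eigenvector∈span {v = v} {V} v∼V {λ y z → fromℤ N * diagonal (λ _ → 1ℂ) y z} m
      (∼ᵐ-* {diagonal (λ _ → 1ℂ)} {Kronecker (λ _ → 1ℤ)} N ∼ᵐ-identity) parseval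
      {fromℤ N} {w} (fromℤ-invertible N≢0)
      (λ y → ≋-trans (*-· (fromℤ N) (diagonal (λ _ → 1ℂ)) w y) (*-congˡ (identity-· w y)))

indicator : ∀ b → (if b then 1ℂ else 0ℂ) ≋ fromℤ (if b then 1ℤ else 0ℤ)
indicator true  = ≋-refl
indicator false = ≋-refl

-- Eigenvalues

-- For each pair of roots, `separate` makes one of the two corresponding factors invertible. The
-- three answers together give at least two invertible factors; cancelling them leaves the remaining
-- one equal to 0.
three-roots : ∀ z {m n p} → m ≢ n → m ≢ p → n ≢ p →
  (z +ᶜ -ᶜ fromℤ m) * ((z +ᶜ -ᶜ fromℤ n) * (z +ᶜ -ᶜ fromℤ p)) ≋ 0ℂ →
  z ≋ fromℤ m ⊎ z ≋ fromℤ n ⊎ z ≋ fromℤ p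
three-roots z {m} {n} {p} m≢n m≢p n≢p abc≋0 = split (separate z m≢n) (separate z m≢p) (separate z n≢p)
  where
  a b c : ℂ
  a = z +ᶜ -ᶜ fromℤ m
  b = z +ᶜ -ᶜ fromℤ n
  c = z +ᶜ -ᶜ fromℤ p
  a-root : Invertible b → Invertible c → z ≋ fromℤ m
  a-root b⁻¹ c⁻¹ = difference-≋0 z (fromℤ m) (cancelˡ c⁻¹ (cancelˡ b⁻¹
    (≋-trans (≋-trans (*-congˡ (*-comm c a)) (≋-trans (*-exchange b a c) ≋-refl)) abc≋0)))
  b-root : Invertible a → Invertible c → z ≋ fromℤ n
  b-root a⁻¹ c⁻¹ = difference-≋0 z (fromℤ n) (cancelˡ c⁻¹ (≋-trans (*-comm c b) (cancelˡ a⁻¹ abc≋0)))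
  c-root : Invertible a → Invertible b → z ≋ fromℤ p
  c-root a⁻¹ b⁻¹ = difference-≋0 z (fromℤ p) (cancelˡ b⁻¹ (cancelˡ a⁻¹ abc≋0))
  split : Invertible a ⊎ Invertible b → Invertible a ⊎ Invertible c → Invertible b ⊎ Invertible c →
          z ≋ fromℤ m ⊎ z ≋ fromℤ n ⊎ z ≋ fromℤ p
  split (inj₁ a⁻¹) _          (inj₁ b⁻¹) = inj₂ (inj₂ (c-root a⁻¹ b⁻¹))
  split (inj₁ a⁻¹) _          (inj₂ c⁻¹) = inj₂ (inj₁ (b-root a⁻¹ c⁻¹))
  split (inj₂ b⁻¹) (inj₁ a⁻¹) _          = inj₂ (inj₂ (c-root a⁻¹ b⁻¹))
  split (inj₂ b⁻¹) (inj₂ c⁻¹) _          = inj₁ (a-root b⁻¹ c⁻¹)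

eigen-⊗ : ∀ {n} (A B : Mat n) {α β w} → A · w ≋ᵛ (λ y → α * w y) → B · w ≋ᵛ (λ y → β * w y) →
          (A ⊗ B) · w ≋ᵛ (λ y → β * (α * w y))
eigen-⊗ A B {α} {β} {w} Aw Bw y = ≋-trans (⊗-· A B w y)
  (≋-trans (·-congˡ A Bw y) (≋-trans (·-* A β w y) (*-congˡ (Aw y))))

quadratic : ∀ {n} → ℤ → ℤ → ℤ → Mat n → Mat n
quadratic a b c A y z = fromℤ a * (A ⊗ A) y z +ᶜ (fromℤ b * A y z +ᶜ fromℤ c * diagonal (λ _ → 1ℂ) y z)

eigen-quadratic : ∀ {n} a b c (A : Mat n) θ {w} → A · w ≋ᵛ (λ y → fromℤ θ * w y) →
  quadratic a b c A · w ≋ᵛ (λ y → fromℤ (a ℤ.* (θ ℤ.* θ) ℤ.+ (b ℤ.* θ ℤ.+ c)) * w y)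
eigen-quadratic a b c A θ {w} Aw y = begin
  (quadratic a b c A · w) y
    ≈⟨ +-· (λ y z → fromℤ a * (A ⊗ A) y z) (λ y z → fromℤ b * A y z +ᶜ fromℤ c * Id y z) w y ⟩
  ((λ y z → fromℤ a * (A ⊗ A) y z) · w) y +ᶜ ((λ y z → fromℤ b * A y z +ᶜ fromℤ c * Id y z) · w) y
    ≈⟨ +ᶜ-cong (≋-trans (*-· (fromℤ a) (A ⊗ A) w y) (*-congˡ (eigen-⊗ A A Aw Aw y)))
         (≋-trans (+-· (λ y z → fromℤ b * A y z) (λ y z → fromℤ c * Id y z) w y)
           (+ᶜ-cong (≋-trans (*-· (fromℤ b) A w y) (*-congˡ (Aw y)))
                    (≋-trans (*-· (fromℤ c) Id w y) (*-congˡ (identity-· w y))))) ⟩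
  fromℤ a * (fromℤ θ * (fromℤ θ * w y)) +ᶜ (fromℤ b * (fromℤ θ * w y) +ᶜ fromℤ c * w y)
    ≈⟨ solve 5 (λ a b c θ w → a :* (θ :* (θ :* w)) :+ (b :* (θ :* w) :+ c :* w)
                               := (a :* (θ :* θ) :+ (b :* θ :+ c)) :* w) ≋-refl
         (fromℤ a) (fromℤ b) (fromℤ c) (fromℤ θ) (w y) ⟩
  (fromℤ a * (fromℤ θ * fromℤ θ) +ᶜ (fromℤ b * fromℤ θ +ᶜ fromℤ c)) * w y
    ≈⟨ *-congʳ (+ᶜ-cong (≋-trans (*-congˡ (≋-sym (fromℤ-* θ θ))) (≋-sym (fromℤ-* a (θ ℤ.* θ))))
                 (≋-trans (+ᶜ-cong (≋-sym (fromℤ-* b θ)) ≋-refl) (≋-sym (fromℤ-+ (b ℤ.* θ) c)))) ⟩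
  (fromℤ (a ℤ.* (θ ℤ.* θ)) +ᶜ fromℤ (b ℤ.* θ ℤ.+ c)) * w y
    ≈⟨ *-congʳ (fromℤ-+ (a ℤ.* (θ ℤ.* θ)) (b ℤ.* θ ℤ.+ c)) ⟨
  fromℤ (a ℤ.* (θ ℤ.* θ) ℤ.+ (b ℤ.* θ ℤ.+ c)) * w y ∎
  where
  open ≋-Reasoning
  open ℂ-Solver
  Id = diagonal (λ _ → 1ℂ)

module Spectra {n : ℕ} (φ : Permutation′ n) where
  open Tables φ
  open LinearAlgebra (columns n)

  column : (Fin n → ℤ) → Column n
  column U y = fromℤ (U (φ ⟨$⟩ˡ y))

  column-∼ : ∀ U → column U ∼ U
  column-∼ U l = ≋-reflexive (cong (fromℤ ∘ U) (inverseˡ φ))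

  ∼-eigen : ∀ {A A₀ v V} θ → A ∼ᵐ A₀ → v ∼ V → (∀ l → (A₀ ·ℤ V) l ≡ θ ℤ.* V l) →
            A · v ≋ᵛ (λ y → fromℤ θ * v y)
  ∼-eigen {A} {A₀} {v} {V} θ A∼ v∼ AV≡ = ∼-unique {A · v} {λ y → fromℤ θ * v y} {A₀ ·ℤ V} {λ l → θ ℤ.* V l}
    (∼-· {A} {A₀} {v} {V} A∼ v∼) (∼-* {v} {V} θ v∼) AV≡

  ∼-nonzero : ∀ {v V} → v ∼ V → ∀ l → V l ≢ 0ℤ → ¬ (v ≋ᵛ (λ _ → 0ℂ))
  ∼-nonzero v∼ l Vl≢0 v≋0 = Vl≢0 (fromℤ-injective (≋-trans (≋-sym (v∼ l)) (v≋0 (φ ⟨$⟩ʳ l))))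

  ∼ᵐ-quadratic : ∀ {A A₀} a b c → A ∼ᵐ A₀ → quadratic a b c A ∼ᵐ
    (λ k l → a ℤ.* (A₀ ⊗ℤ A₀) k l ℤ.+ (b ℤ.* A₀ k l ℤ.+ c ℤ.* Kronecker (λ _ → 1ℤ) k l))
  ∼ᵐ-quadratic {A} {A₀} a b c A∼ = ∼ᵐ-+ {λ y z → fromℤ a * (A ⊗ A) y z} {λ k l → a ℤ.* (A₀ ⊗ℤ A₀) k l}
    {λ y z → fromℤ b * A y z +ᶜ fromℤ c * Id y z} {λ k l → b ℤ.* A₀ k l ℤ.+ c ℤ.* Id₀ k l}
    (∼ᵐ-* {A ⊗ A} {A₀ ⊗ℤ A₀} a (∼ᵐ-⊗ {A} {A₀} {A} {A₀} A∼ A∼))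
    (∼ᵐ-+ {λ y z → fromℤ b * A y z} {λ k l → b ℤ.* A₀ k l} {λ y z → fromℤ c * Id y z} {λ k l → c ℤ.* Id₀ k l}
      (∼ᵐ-* {A} {A₀} b A∼) (∼ᵐ-* {Id} {Id₀} c ∼ᵐ-identity))
    where
    Id = diagonal (λ _ → 1ℂ)
    Id₀ = Kronecker (λ _ → 1ℤ)

  -- The quadratic a A² + b A + c is, up to the weights m, the orthogonal projection onto the eigenspace of θ.
  eigenspace-basis : ∀ {A A₀} → A ∼ᵐ A₀ → ∀ {k} {v : Fin k → Column n} {V : Fin k → Fin n → ℤ} {norm} →
    (∀ i → v i ∼ V i) → IsOrthogonal v norm → ∀ θ a b c (m : Fin k → ℤ) →
    (∀ i l → (A₀ ·ℤ V i) l ≡ θ ℤ.* V i l) →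
    (∀ j l → a ℤ.* (A₀ ⊗ℤ A₀) j l ℤ.+ (b ℤ.* A₀ j l ℤ.+ c ℤ.* Kronecker (λ _ → 1ℤ) j l)
             ≡ ∑ℤ (λ i → m i ℤ.* (V i j ℤ.* V i l))) →
    a ℤ.* (θ ℤ.* θ) ℤ.+ (b ℤ.* θ ℤ.+ c) ≢ 0ℤ →
    IsBasis (Eigenspace A (fromℤ θ)) v
  eigenspace-basis {A} {A₀} A∼ {v = v} {V} v∼ orth θ a b c m eigen projection value≢0 = record
    { members = λ i → ≋⇒≈ (A · v i) (λ y → fromℤ θ * v i y) (∼-eigen {A} {A₀} {v i} {V i} θ A∼ (v∼ i) (eigen i))
    ; independent = IsOrthogonal.independent orth
    ; spanning = λ {w} Aw≈ → eigenvector∈span {v = v} {V} v∼ {quadratic a b c A} m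
        (∼ᵐ-quadratic {A} {A₀} a b c A∼) projection {w = w} (fromℤ-invertible value≢0)
        (eigen-quadratic a b c A θ {w} (≈⇒≋ (A · w) (λ y → fromℤ θ * w y) Aw≈))
    }

  -- Kept general in the size because both the adjacency matrix and the 3 × 3 matrix of type I
  -- satisfy A³ = 9 A. The cubic bounds the eigenvalues, and the table V exhibits an eigenvector for
  -- each root.
  cubic-eigenvalues : ∀ {A A₀} → A ∼ᵐ A₀ →
    (∀ j l → (A₀ ⊗ℤ (A₀ ⊗ℤ A₀)) j l ≡ + 9 ℤ.* A₀ j l) →
    (V : Fin 3 → Fin n → ℤ) →
    (∀ i l → (A₀ ·ℤ V i) l ≡ lookup (+ 3 ∷ 0ℤ ∷ -[1+ 2 ] ∷ []) i ℤ.* V i l) →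
    (∀ i → ∃[ l ] V i l ≢ 0ℤ) →
    HasEigenvalues A (map fromℤ (+ 3 ∷ 0ℤ ∷ -[1+ 2 ] ∷ []))
  cubic-eigenvalues {A} {A₀} A∼ cubic V eigen V≢0 = record
    { distinct   = distinct
    ; eigenvalue = eigenvalue
    ; exhaustive = exhaustive
    }
    where
    θ : Vec ℤ 3
    θ = + 3 ∷ 0ℤ ∷ -[1+ 2 ] ∷ []
    distinct : ∀ i j → lookup (map fromℤ θ) i ≈ lookup (map fromℤ θ) j → i ≡ j
    distinct 0F 0F _ = refl
    distinct 1F 1F _ = refl
    distinct 2F 2F _ = refl
    distinct 0F 1F p with () ← fromℤ-injective {+ 3} {0ℤ} ⟪ p ⟫
    distinct 0F 2F p with () ← fromℤ-injective {+ 3} { -[1+ 2 ]} ⟪ p ⟫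
    distinct 1F 0F p with () ← fromℤ-injective {0ℤ} {+ 3} ⟪ p ⟫
    distinct 1F 2F p with () ← fromℤ-injective {0ℤ} { -[1+ 2 ]} ⟪ p ⟫
    distinct 2F 0F p with () ← fromℤ-injective { -[1+ 2 ]} {+ 3} ⟪ p ⟫
    distinct 2F 1F p with () ← fromℤ-injective { -[1+ 2 ]} {0ℤ} ⟪ p ⟫

    eigenvector : ∀ i → IsNonzero (Eigenspace A (fromℤ (lookup θ i)))
    eigenvector i = column (V i)
      , ≋⇒≈ (A · column (V i)) (λ y → fromℤ (lookup θ i) * column (V i) y)
          (∼-eigen {A} {A₀} {column (V i)} {V i} (lookup θ i) A∼ (column-∼ (V i)) (eigen i))
      , λ v≈0 → ∼-nonzero {column (V i)} {V i} (column-∼ (V i)) (proj₁ (V≢0 i)) (proj₂ (V≢0 i))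
          (≈⇒≋ (column (V i)) (λ _ → 0ℂ) v≈0)

    eigenvalue : ∀ i → IsNonzero (Eigenspace A (lookup (map fromℤ θ) i))
    eigenvalue 0F = eigenvector 0F
    eigenvalue 1F = eigenvector 1F
    eigenvalue 2F = eigenvector 2F

    A³ : A ⊗ (A ⊗ A) ≋ᵐ (λ y z → fromℤ (+ 9) * A y z)
    A³ = ∼ᵐ-unique {A ⊗ (A ⊗ A)} {λ y z → fromℤ (+ 9) * A y z}
      (∼ᵐ-⊗ {A} {A₀} {A ⊗ A} {A₀ ⊗ℤ A₀} A∼ (∼ᵐ-⊗ {A} {A₀} {A} {A₀} A∼ A∼)) (∼ᵐ-* {A} {A₀} (+ 9) A∼) cubic

    minimal : ℂ → ℂ
    minimal η = (η +ᶜ -ᶜ fromℤ (+ 3)) * ((η +ᶜ -ᶜ fromℤ 0ℤ) * (η +ᶜ -ᶜ fromℤ -[1+ 2 ]))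

    annihilates : ∀ η w → A · w ≋ᵛ (λ y → η * w y) → ∀ y → minimal η * w y ≋ 0ℂ
    annihilates η w Aw y = begin
      minimal η * w y
        ≈⟨ solve 2 (λ η w → (η :- con (+ 3)) :* ((η :- con 0ℤ) :* (η :- con -[1+ 2 ])) :* w
                             := (η :* η) :* (η :* w) :- con (+ 9) :* (η :* w)) ≋-refl η (w y) ⟩
      (η * η) * (η * w y) +ᶜ -ᶜ (fromℤ (+ 9) * (η * w y))
        -- On an eigenvector, η³ w is A³ w, which the cubic identity replaces by 9 A w.
        ≈⟨ +ᶜ-cong (begin
             (η * η) * (η * w y)         ≈⟨ *-assoc η η (η * w y) ⟩
             η * (η * (η * w y))         ≈⟨ *-congˡ (*-congˡ (Aw y)) ⟨
             η * (η * (A · w) y)         ≈⟨ *-congˡ (·-* A η w y) ⟨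
             η * (A · (λ z → η * w z)) y ≈⟨ *-congˡ (·-congˡ A Aw y) ⟨
             η * (A · (A · w)) y         ≈⟨ ·-* A η (A · w) y ⟨
             (A · (λ z → η * (A · w) z)) y ≈⟨ ·-congˡ A (λ z → ·-* A η w z) y ⟨
             (A · (A · (λ z → η * w z))) y ≈⟨ ·-congˡ A (·-congˡ A Aw) y ⟨
             (A · (A · (A · w))) y       ≈⟨ ·-congˡ A (⊗-· A A w) y ⟨
             (A · ((A ⊗ A) · w)) y       ≈⟨ ⊗-· A (A ⊗ A) w y ⟨
             ((A ⊗ (A ⊗ A)) · w) y       ≈⟨ ·-cong A³ (λ _ → ≋-refl) y ⟩
             ((λ y z → fromℤ (+ 9) * A y z) · w) y ≈⟨ *-· (fromℤ (+ 9)) A w y ⟩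
             fromℤ (+ 9) * (A · w) y     ≈⟨ *-congˡ (Aw y) ⟩
             fromℤ (+ 9) * (η * w y)     ∎) ≋-refl ⟩
      fromℤ (+ 9) * (η * w y) +ᶜ -ᶜ (fromℤ (+ 9) * (η * w y))
        ≈⟨ -ᶜ-inverseʳ (fromℤ (+ 9) * (η * w y)) ⟩
      0ℂ ∎
      where
      open ≋-Reasoning
      open ℂ-Solver

    exhaustive : ∀ η → IsNonzero (Eigenspace A η) → ∃[ i ] η ≈ lookup (map fromℤ θ) i
    exhaustive η (w , Aw≈ , w≉0) = which (three-roots η {+ 3} {0ℤ} { -[1+ 2 ]} (λ ()) (λ ()) (λ ())
      -- No nonzero coordinate of w can be exhibited. Instead, if `minimal η` were invertible it
      -- could be cancelled in every coordinate of the annihilation identity, making w zero.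
      (¬invertible⇒≋0 (λ inv → w≉0 (≋⇒≈ w (λ _ → 0ℂ) (λ y →
        cancelˡ inv (annihilates η w (≈⇒≋ (A · w) (λ y → η * w y) Aw≈) y))))))
      where
      which : η ≋ fromℤ (+ 3) ⊎ η ≋ fromℤ 0ℤ ⊎ η ≋ fromℤ -[1+ 2 ] → ∃[ i ] η ≈ lookup (map fromℤ θ) i
      which (inj₁ p)        = 0F , ⟫ p ⟪
      which (inj₂ (inj₁ p)) = 1F , ⟫ p ⟪
      which (inj₂ (inj₂ p)) = 2F , ⟫ p ⟪

integral-∼ᵐ : ∀ {n} (B : Vec (Vec ℤ n) n) →
  Tables._∼ᵐ_ Permutation.id (integral B) (λ i j → lookup (lookup B i) j)
integral-∼ᵐ B i j = ≋-refl

zero-eigenvalues : HasEigenvalues (integral ((0ℤ ∷ []) ∷ [])) (map fromℤ (0ℤ ∷ []))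
zero-eigenvalues = record
  { distinct   = λ { 0F 0F _ → refl }
  ; eigenvalue = λ { 0F → (λ _ → 1ℂ) , ≋⇒≈ (integral ((0ℤ ∷ []) ∷ []) · (λ _ → 1ℂ)) (λ _ → 0ℂ * 1ℂ)
                            (λ y → ≋-trans (vanish (λ _ → 1ℂ) y) (≋-sym (*-zeroˡ 1ℂ)))
                        , λ 1≈0 → 1≢0 (≈⇒≋ {1} (λ _ → 1ℂ) (λ _ → 0ℂ) 1≈0 0F) }
  ; exhaustive = λ η (w , Bw≈ , w≉0) → 0F , ⟫ ¬invertible⇒≋0 {η} (λ inv → w≉0 (≋⇒≈ w (λ _ → 0ℂ) (λ y →
      cancelˡ inv (≋-trans (≋-sym (≈⇒≋ (integral ((0ℤ ∷ []) ∷ []) · w) (λ y → η * w y) Bw≈ y)) (vanish w y))))) ⟪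
  }
  where
  vanish : ∀ w → integral ((0ℤ ∷ []) ∷ []) · w ≋ᵛ (λ _ → 0ℂ)
  vanish w 0F = ∑-0 {1} {λ z → integral ((0ℤ ∷ []) ∷ []) 0F z * w z} (λ { 0F → *-zeroˡ (w 0F) })
  1≢0 : ¬ (1ℂ ≋ 0ℂ)
  1≢0 p with () ← fromℤ-injective {1ℤ} {0ℤ} p

-- K₃,₃ and its intersection numbers

K₃₃ : Graph 6
K₃₃ = completeBipartite 3 3

private
  -- Vertices at distance 0, 1 and 2 from the vertex 0, at which the intersection numbers are read
  -- off.
  representative : ℕ → Fin 6
  representative 0 = 0F
  representative 1 = 3F
  representative _ = 1F

  intersectionNumber : ℕ → ℕ → ℕ → ℕ
  intersectionNumber h i j = commonCount K₃₃ i j 0F (representative h)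

  regular? : Dec (∀ (i j : Fin 3) (y z : Fin 6) →
    commonCount K₃₃ (toℕ i) (toℕ j) y z ≡ intersectionNumber (dist K₃₃ y z) (toℕ i) (toℕ j))
  regular? = all? {3} (λ i → all? {3} (λ j → all? {6} (λ y → all? {6} (λ z →
    commonCount K₃₃ (toℕ i) (toℕ j) y z ℕ.≟ intersectionNumber (dist K₃₃ y z) (toℕ i) (toℕ j)))))

K₃₃-distanceRegular : DistanceRegular K₃₃
K₃₃-distanceRegular = record { p = intersectionNumber ; constant = constant }
  where
  constant : ∀ {h i j} → h ≤ diameter K₃₃ → i ≤ diameter K₃₃ → j ≤ diameter K₃₃ →
             ∀ y z → dist K₃₃ y z ≡ h → commonCount K₃₃ i j y z ≡ intersectionNumber h i j
  -- The diameter evaluates to 2, so the bounds turn i and j into elements of `Fin 3`, over which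
  -- the finite check ranges.
  constant {i = i} {j} _ i≤2 j≤2 y z refl = subst₂
    (λ i j → commonCount K₃₃ i j y z ≡ intersectionNumber (dist K₃₃ y z) i j)
    (toℕ-fromℕ< (s≤s i≤2)) (toℕ-fromℕ< (s≤s j≤2))
    (from-yes regular? (fromℕ< (s≤s i≤2)) (fromℕ< (s≤s j≤2)) y z)

K₃₃-intersectionArray : HasIntersectionArray K₃₃ (3 ∷ 2 ∷ []) (1 ∷ 3 ∷ [])
K₃₃-intersectionArray = K₃₃-distanceRegular , refl , refl

-- Counting

count : ∀ {n} {P : Pred (Fin n) 0ℓ} → Decidable P → ℕ
count {zero}  P? = 0
count {suc n} P? = (if does (P? zero) then suc else id) (count (P? ∘ suc))

length-filter : ∀ {n} {A : Set} {P : Pred A 0ℓ} (P? : Decidable P) (f : Fin n → A) →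
  length (filter P? (List.tabulate f)) ≡ count (P? ∘ f)
length-filter {zero}  P? f = refl
length-filter {suc n} P? f with P? (f zero)
... | yes _ = cong suc (length-filter P? (f ∘ suc))
... | no  _ = length-filter P? (f ∘ suc)

count-mono : ∀ {n} {P Q : Pred (Fin n) 0ℓ} (P? : Decidable P) (Q? : Decidable Q) → P ⊆ Q → count P? ≤ count Q?
count-mono {zero}  P? Q? P⊆Q = z≤n
count-mono {suc n} P? Q? P⊆Q with P? zero | Q? zero
... | yes _ | yes _ = s≤s (count-mono (P? ∘ suc) (Q? ∘ suc) P⊆Q)
... | yes p | no ¬q = ⊥-elim (¬q (P⊆Q p))
... | no _  | yes _ = ℕ.m≤n⇒m≤1+n (count-mono (P? ∘ suc) (Q? ∘ suc) P⊆Q)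
... | no _  | no _  = count-mono (P? ∘ suc) (Q? ∘ suc) P⊆Q

count-strict : ∀ {n} {P Q : Pred (Fin n) 0ℓ} (P? : Decidable P) (Q? : Decidable Q) → P ⊆ Q →
  ∀ i → ¬ P i → Q i → count P? < count Q?
count-strict {suc n} P? Q? P⊆Q zero ¬p q with P? zero | Q? zero
... | yes p | _     = ⊥-elim (¬p p)
... | no _  | yes _ = s≤s (count-mono (P? ∘ suc) (Q? ∘ suc) P⊆Q)
... | no _  | no ¬q = ⊥-elim (¬q q)
count-strict {suc n} P? Q? P⊆Q (suc i) ¬p q with P? zero | Q? zero
... | yes _ | yes _ = s≤s (count-strict (P? ∘ suc) (Q? ∘ suc) P⊆Q i ¬p q)
... | yes p | no ¬q = ⊥-elim (¬q (P⊆Q p))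
... | no _  | yes _ = ℕ.m≤n⇒m≤1+n (count-strict (P? ∘ suc) (Q? ∘ suc) P⊆Q i ¬p q)
... | no _  | no _  = count-strict (P? ∘ suc) (Q? ∘ suc) P⊆Q i ¬p q

-- `sorted` is phrased by the same case function as `isLeft`, so that a sorting of the vertices can
-- be read as a map to the two parts of a complete bipartite graph.
record Partition {n} {P : Pred (Fin n) 0ℓ} (P? : Decidable P) : Set where
  field
    {m k}  : ℕ
    sort   : Fin n ↔ (Fin m ⊎ Fin k)
    sorted : ∀ i → [ const true , const false ]′ (Inverse.to sort i) ≡ does (P? i)
    m≡     : m ≡ count P?
    n≡     : n ≡ m + k

insertˡ : ∀ {n m k} → Fin n ↔ (Fin m ⊎ Fin k) → Fin (suc n) ↔ (Fin (suc m) ⊎ Fin k)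
insertˡ {n} {m} {k} f = mk↔ₛ′ to from to∘from from∘to
  where
  to : Fin (suc n) → Fin (suc m) ⊎ Fin k
  to zero    = inj₁ zero
  to (suc i) = Sum.map₁ suc (Inverse.to f i)
  from : Fin (suc m) ⊎ Fin k → Fin (suc n)
  from (inj₁ zero)    = zero
  from (inj₁ (suc i)) = suc (Inverse.from f (inj₁ i))
  from (inj₂ j)       = suc (Inverse.from f (inj₂ j))
  to∘from : ∀ s → to (from s) ≡ s
  to∘from (inj₁ zero)    = refl
  to∘from (inj₁ (suc i)) = cong (Sum.map₁ suc) (Inverse.strictlyInverseˡ f (inj₁ i))
  to∘from (inj₂ j)       = cong (Sum.map₁ suc) (Inverse.strictlyInverseˡ f (inj₂ j))
  from-map : ∀ s → from (Sum.map₁ suc s) ≡ suc (Inverse.from f s)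
  from-map (inj₁ i) = refl
  from-map (inj₂ j) = refl
  from∘to : ∀ i → from (to i) ≡ i
  from∘to zero    = refl
  from∘to (suc i) = trans (from-map (Inverse.to f i)) (cong suc (Inverse.strictlyInverseʳ f i))

insertʳ : ∀ {n m k} → Fin n ↔ (Fin m ⊎ Fin k) → Fin (suc n) ↔ (Fin m ⊎ Fin (suc k))
insertʳ f = swap-↔ ↔-∘ insertˡ (swap-↔ ↔-∘ f)
  where
  swap-↔ : ∀ {A B : Set} → (A ⊎ B) ↔ (B ⊎ A)
  swap-↔ = mk↔ₛ′ Sum.swap Sum.swap swap-involutive swap-involutive

partition : ∀ {n} {P : Pred (Fin n) 0ℓ} (P? : Decidable P) → Partition P?
partition {zero} P? = record
  { sort = mk↔ₛ′ (λ ()) [ (λ ()) , (λ ()) ]′ (λ { (inj₁ ()) ; (inj₂ ()) }) (λ ())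
  ; sorted = λ () ; m≡ = refl ; n≡ = refl }
partition {suc n} P? with P? zero in eq
... | yes _ = record
  { sort = insertˡ sort
  ; sorted = λ { zero → sym (cong does eq) ; (suc i) → trans (keep (Inverse.to sort i)) (sorted i) }
  ; m≡ = trans (cong suc m≡) (cong (λ b → (if b then suc else id) (count (P? ∘ suc))) (sym (cong does eq)))
  ; n≡ = cong suc n≡
  }
  where
  open Partition (partition (P? ∘ suc))
  keep : ∀ {a b} (s : Fin a ⊎ Fin b) → [ const true , const false ]′ (Sum.map₁ (Fin.suc {a}) s) ≡ [ const true , const false ]′ s
  keep (inj₁ _) = refl
  keep (inj₂ _) = refl
... | no _ = record
  { sort = insertʳ sort
  ; sorted = λ { zero → sym (cong does eq) ; (suc i) → trans (keep (Inverse.to sort i)) (sorted i) }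
  ; m≡ = trans m≡ (cong (λ b → (if b then suc else id) (count (P? ∘ suc))) (sym (cong does eq)))
  ; n≡ = trans (cong suc n≡) (sym (ℕ.+-suc m k))
  }
  where
  open Partition (partition (P? ∘ suc))
  keep : ∀ {a b} (s : Fin a ⊎ Fin b) →
         [ const true , const false ]′ (Sum.swap (Sum.map₁ (Fin.suc {b}) (Sum.swap s))) ≡ [ const true , const false ]′ s
  keep (inj₁ _) = refl
  keep (inj₂ _) = refl

-- Distances

least-holds : ∀ {P : Pred ℕ 0ℓ} (P? : Decidable P) b → P b → P (least P? b)
-- At bound 0 the search returns 0 without testing it; the hypothesis at the bound is what justifies
-- this answer.
least-holds P? zero    p = p
least-holds P? (suc b) p with P? 0
... | yes p₀ = p₀
... | no  _  = least-holds (P? ∘ suc) b p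

least-≤ : ∀ {P : Pred ℕ 0ℓ} (P? : Decidable P) b {k} → P k → least P? b ≤ k
least-≤ P? zero    p = z≤n
least-≤ P? (suc b) p with P? 0
... | yes _ = z≤n
least-≤ P? (suc b) {zero}  p | no ¬p₀ = ⊥-elim (¬p₀ p)
least-≤ P? (suc b) {suc k} p | no ¬p₀ = s≤s (least-≤ (P? ∘ suc) b p)

≤-maximum : ∀ {n} (f : Fin n → ℕ) i → f i ≤ Vector.foldr _⊔_ 0 f
≤-maximum f zero    = ℕ.m≤m⊔n (f zero) _
≤-maximum f (suc i) = ℕ.≤-trans (≤-maximum (f ∘ suc) i) (ℕ.m≤n⊔m (f zero) _)

module Distances {n} (Γ : Graph n) where
  open Graph Γ

  dist-walk : ∀ x y → Walk _~_ (dist Γ x y) x y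
  dist-walk x y = least-holds (λ k → walk? Γ k x y) (proj₁ (connected x y)) (proj₂ (connected x y))

  dist-≤ : ∀ {k x y} → Walk _~_ k x y → dist Γ x y ≤ k
  dist-≤ {x = x} {y} w = least-≤ (λ k → walk? Γ k x y) (proj₁ (connected x y)) w

  dist-refl : ∀ x → dist Γ x x ≡ 0
  dist-refl x = ℕ.n≤0⇒n≡0 (dist-≤ [])

  dist≡0⇒≡ : ∀ {x y} → dist Γ x y ≡ 0 → x ≡ y
  dist≡0⇒≡ {x} {y} d≡0 with [] ← subst (λ k → Walk _~_ k x y) d≡0 (dist-walk x y) = refl

  dist≡1⇒~ : ∀ {x y} → dist Γ x y ≡ 1 → x ~ y
  dist≡1⇒~ {x} {y} d≡1 with x~y ∷ [] ← subst (λ k → Walk _~_ k x y) d≡1 (dist-walk x y) = x~y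

  ~⇒dist≡1 : ∀ {x y} → x ~ y → dist Γ x y ≡ 1
  ~⇒dist≡1 {x} {y} x~y = ℕ.≤-antisym (dist-≤ (x~y ∷ [])) (ℕ.n≢0⇒n>0 (λ d≡0 → irreflexive (dist≡0⇒≡ d≡0) x~y))

  dist-≤-diameter : ∀ x y → dist Γ x y ≤ diameter Γ
  dist-≤-diameter x y = ℕ.≤-trans (≤-maximum (dist Γ x) y) (≤-maximum (λ x → Vector.foldr _⊔_ 0 (dist Γ x)) x)

-- The length of the list determines the diameter, since `upTo D` has D entries.
array-entries : ∀ D (f : ℕ → ℕ) {a b} → List.map f (upTo D) ≡ a ∷ b ∷ [] → D ≡ 2 × f 0 ≡ a × f 1 ≡ b
array-entries 2 f eq = refl , proj₁ (∷-injective eq) , proj₁ (∷-injective (proj₂ (∷-injective eq)))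
array-entries (suc (suc (suc D))) f ()

-- The absence of triangles makes any two non-adjacent vertices twins, so that being
-- adjacent to a fixed vertex splits the graph into the two parts of K₃,₃.
module Uniqueness (Γ : Graph 6) (array : HasIntersectionArray Γ (3 ∷ 2 ∷ []) (1 ∷ 3 ∷ [])) where
  open Graph Γ
  open Distances Γ
  open DistanceRegular (proj₁ array)

  private
    b-entries = array-entries (diameter Γ) (λ i → p i 1 (suc i)) (proj₁ (proj₂ array))
    c-entries = array-entries (diameter Γ) (λ i → p (suc i) 1 i) (proj₂ (proj₂ array))

    ≤-diameter : ∀ {i} → i ≤ 2 → i ≤ diameter Γ
    ≤-diameter i≤2 = ℕ.≤-trans i≤2 (ℕ.≤-reflexive (sym (proj₁ b-entries)))

    common? : ∀ i j y z w → Dec (dist Γ y w ≡ i × dist Γ z w ≡ j)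
    common? i j y z w = (dist Γ y w ℕ.≟ i) ×-dec (dist Γ z w ℕ.≟ j)

    common : ∀ {h i j} → h ≤ 2 → i ≤ 2 → j ≤ 2 → ∀ y z → dist Γ y z ≡ h → count (common? i j y z) ≡ p h i j
    common {i = i} {j} h≤2 i≤2 j≤2 y z d≡h = trans (sym (length-filter (common? i j y z) id))
      (constant (≤-diameter h≤2) (≤-diameter i≤2) (≤-diameter j≤2) y z d≡h)

  -- Here b₀ = p 0 1 1 = 3, so the neighbours of y are counted as common neighbours of y and y.
  degree : ∀ y → count (common? 1 1 y y) ≡ 3
  degree y = trans (common z≤n (s≤s z≤n) (s≤s z≤n) y y (dist-refl y)) (proj₁ (proj₂ b-entries))

  -- Of the three neighbours of y, b₁ = 2 lie at distance 2 from z, and z is the third; a common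
  -- neighbour w of y and z would be a fourth. The count runs through the neighbours of y other than
  -- z, by two strict inclusions.
  no-triangle : ∀ {y z w} → y ~ z → y ~ w → ¬ z ~ w
  no-triangle {y} {z} {w} y~z y~w z~w = ℕ.1+n≰n (ℕ.≤-trans
      (s≤s (ℕ.≤-trans (s≤s (ℕ.≤-reflexive (sym far)))
        (count-strict (common? 1 2 y z) other? P⊆Q w
          (λ { (_ , d≡2) → 1≢2 (trans (sym (~⇒dist≡1 z~w)) d≡2) })
          (~⇒dist≡1 y~w , λ w≡z → irreflexive (sym w≡z) z~w))))
      (ℕ.≤-trans (count-strict other? (common? 1 1 y y) (λ { (d≡1 , _) → d≡1 , d≡1 }) z
          (λ { (_ , z≢z) → z≢z refl }) (~⇒dist≡1 y~z , ~⇒dist≡1 y~z))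
        (ℕ.≤-reflexive (degree y))))
    where
    1≢2 : 1 ≢ 2
    1≢2 ()
    far : count (common? 1 2 y z) ≡ 2
    far = trans (common (s≤s z≤n) (s≤s z≤n) ℕ.≤-refl y z (~⇒dist≡1 y~z)) (proj₂ (proj₂ b-entries))
    other? : Decidable (λ v → dist Γ y v ≡ 1 × v ≢ z)
    other? v = (dist Γ y v ℕ.≟ 1) ×-dec ¬? (v Fin.≟ z)
    P⊆Q : ∀ {v} → dist Γ y v ≡ 1 × dist Γ z v ≡ 2 → dist Γ y v ≡ 1 × v ≢ z
    P⊆Q (d≡1 , d≡2) = d≡1 , λ { refl → 0≢2 (trans (sym (dist-refl z)) d≡2) }
      where
      0≢2 : 0 ≢ 2
      0≢2 ()

  -- c₂ = 3 equals the degree, so every neighbour of y is a common neighbour of y and z.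
  antipodal-neighbours : ∀ {y z w} → dist Γ y z ≡ 2 → y ~ w → z ~ w
  antipodal-neighbours {y} {z} {w} d≡2 y~w with z ~? w
  ... | yes z~w = z~w
  ... | no  z≁w = ⊥-elim (ℕ.<-irrefl (trans shared (sym (degree y)))
    (count-strict (common? 1 1 y z) (common? 1 1 y y) (λ { (d≡1 , _) → d≡1 , d≡1 }) w
      (λ { (_ , d≡1) → z≁w (dist≡1⇒~ d≡1) }) (~⇒dist≡1 y~w , ~⇒dist≡1 y~w)))
    where
    shared : count (common? 1 1 y z) ≡ 3
    shared = trans (common ℕ.≤-refl (s≤s z≤n) (s≤s z≤n) y z d≡2) (proj₂ (proj₂ c-entries))

  twins : ∀ {y z w} → ¬ y ~ z → y ~ w → z ~ w
  twins {y} {z} {w} y≁z y~w = go (dist Γ y z) refl (ℕ.≤-trans (dist-≤-diameter y z) (ℕ.≤-reflexive (proj₁ b-entries)))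
    where
    go : ∀ d → dist Γ y z ≡ d → d ≤ 2 → z ~ w
    go 0 d≡0 _ = subst (_~ w) (dist≡0⇒≡ d≡0) y~w
    go 1 d≡1 _ = ⊥-elim (y≁z (dist≡1⇒~ d≡1))
    go 2 d≡2 _ = antipodal-neighbours d≡2 y~w
    go (suc (suc (suc _))) _ (s≤s (s≤s ()))

  private
    x : Fin 6
    x = zero

  -- Two adjacent neighbours of x would close a triangle. If y is not a neighbour of x, it has the
  -- same neighbours as x, so its neighbour z is adjacent to x.
  adjacent⇒opposite : ∀ {y z} → y ~ z → does (x ~? y) ≢ does (x ~? z)
  adjacent⇒opposite {y} {z} y~z with x ~? y | x ~? z
  ... | yes x~y | yes x~z = λ _ → no-triangle x~y x~z y~z
  ... | yes _   | no _    = λ ()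
  ... | no _    | yes _   = λ ()
  ... | no x≁y  | no x≁z  = λ _ → x≁z (twins (λ y~x → x≁y (symmetric y~x)) y~z)

  -- One of the two vertices is a neighbour of x, and the other, not adjacent to x, has the same
  -- neighbours as x.
  opposite⇒adjacent : ∀ {y z} → does (x ~? y) ≢ does (x ~? z) → y ~ z
  opposite⇒adjacent {y} {z} with x ~? y | x ~? z
  ... | yes _   | yes _   = λ t≢t → ⊥-elim (t≢t refl)
  ... | yes x~y | no x≁z  = λ _ → symmetric (twins x≁z x~y)
  ... | no x≁y  | yes x~z = λ _ → twins x≁y x~z
  ... | no _    | no _    = λ f≢f → ⊥-elim (f≢f refl)

  isomorphic : Γ ≅ᴳ K₃₃
  isomorphic = build (partition (x ~?_)) neighbours
    where
    neighbours : count (x ~?_) ≡ 3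
    neighbours = trans (ℕ.≤-antisym
      (count-mono (x ~?_) (common? 1 1 x x) (λ x~y → ~⇒dist≡1 x~y , ~⇒dist≡1 x~y))
      (count-mono (common? 1 1 x x) (x ~?_) (λ { (d≡1 , _) → dist≡1⇒~ d≡1 }))) (degree x)

    build : Partition (x ~?_) → count (x ~?_) ≡ 3 → Γ ≅ᴳ K₃₃
    build part count≡3 = assemble m≡3 k≡3 sort sorted
      where
      open Partition part
      m≡3 : m ≡ 3
      m≡3 = trans m≡ count≡3
      k≡3 : k ≡ 3
      k≡3 = ℕ.+-cancelˡ-≡ 3 k 3 (trans (cong (_+ k) (sym m≡3)) (sym n≡))
      -- The sizes of the two classes are abstracted so that both equations can be matched with
      -- `refl`.
      assemble : ∀ {m k} → m ≡ 3 → k ≡ 3 → (sort : Fin 6 ↔ (Fin m ⊎ Fin k)) →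
        (∀ y → [ const true , const false ]′ (Inverse.to sort y) ≡ does (x ~? y)) → Γ ≅ᴳ K₃₃
      assemble refl refl sort sorted = ↔-sym +↔⊎ ↔-∘ sort , λ y z → mk⇔
        (λ y~z eq → adjacent⇒opposite y~z (trans (sym (side y)) (trans eq (side z))))
        (λ opposite → opposite⇒adjacent (λ eq → opposite (trans (side y) (trans eq (sym (side z))))))
        where
        side : ∀ y → isLeft 3 3 (join 3 3 (Inverse.to sort y)) ≡ does (x ~? y)
        side y = trans (cong [ const true , const false ]′ (splitAt-join 3 3 (Inverse.to sort y))) (sorted y)

-- Decidable predicates as subsets

comprehension : ∀ {n} {P : Pred (Fin n) 0ℓ} → Decidable P → Subset n
comprehension P? = tabulate (λ i → does (P? i))

∈-comprehension : ∀ {n} {P : Pred (Fin n) 0ℓ} (P? : Decidable P) i → i ∈ comprehension P? ⇔ P i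
∈-comprehension {P = P} P? i = mk⇔ to from
  where
  to : i ∈ comprehension P? → P i
  to i∈ with P? i | trans (sym (lookup∘tabulate (λ i → does (P? i)) i)) ([]=⇒lookup i∈)
  ... | yes p | _ = p
  from : P i → i ∈ comprehension P?
  from p = lookup⇒[]= i (comprehension P?) (trans (lookup∘tabulate (λ i → does (P? i)) i) (dec-true (P? i) p))

singleton : ∀ {n} → Column n → Fin 1 → Column n
singleton u = lookup (u ∷ [])

lin-one : ∀ {n} (c : Fin 1 → ℂ) (v : Fin 1 → Column n) → lin c v ≋ᵛ (λ y → c 0F * v 0F y)
lin-one c v y = +ᶜ-identityʳ (c 0F * v 0F y)

total-at : ∀ {n k} (w : Fin k → Column n) y → LinearAlgebra.total (columns n) w y ≡ ∑ (λ i → w i y)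
total-at {k = zero}  w y = refl
total-at {k = suc k} w y = cong (w zero y +ᶜ_) (total-at (w ∘ suc) y)

total≋ : ∀ {n k} (w : Fin k → Column n) → LinearAlgebra.total (columns n) w ≋ᵛ (λ y → ∑ (λ i → w i y))
total≋ w y = ≋-reflexive (total-at w y)

⟨⟩-∑ : ∀ {n k} (w : Fin k → Column n) u → ⟨ (λ y → ∑ (λ i → w i y)) , u ⟩ ≋ ∑ (λ i → ⟨ w i , u ⟩)
⟨⟩-∑ w u = ≋-trans (∑-cong (λ y → ∑-* (conj (u y)) (λ i → w i y))) (∑-comm (λ y i → w i y * conj (u y)))

⟨⟩-* : ∀ {n} a (u v : Column n) → ⟨ (λ y → a * u y) , v ⟩ ≋ a * ⟨ u , v ⟩
⟨⟩-* a u v = ≋-trans (∑-cong (λ y → *-assoc a (u y) (conj (v y)))) (≋-sym (*-∑ a (λ y → u y * conj (v y))))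

-- Modules over the Terwilliger algebra of an arbitrary graph

module TModules {n : ℕ} (Γ : Graph n) (x : Fin n) where
  open Terwilliger Γ x
  open TModule

  private
    A : Mat n
    A = adjacency Γ

  e*-own : ∀ {i y} → dist Γ x y ≡ i → e* i y ≋ 1ℂ
  e*-own {i} {y} d≡i rewrite dec-true (dist Γ x y ℕ.≟ i) d≡i = ≋-refl

  e*-other : ∀ {i y} → dist Γ x y ≢ i → e* i y ≋ 0ℂ
  e*-other {i} {y} d≢i rewrite dec-false (dist Γ x y ℕ.≟ i) d≢i = ≋-refl

  -- By induction on how an element of T is generated, only A and the `E* i` have to be checked.
  T-closed : ∀ {W} → IsSubspace W → (∀ {v} → W v → W (A · v)) → (∀ i → i ≤ D → ∀ {v} → W v → W (E* i · v)) →
             ∀ {B v} → T B → W v → W (B · v)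
  T-closed W-sub A-closed E-closed gen-A w = A-closed w
  T-closed W-sub A-closed E-closed (gen-E* i i≤D) w = E-closed i i≤D w
  T-closed {W} W-sub A-closed E-closed {v = v} identity w =
    respects-≋ {W = W} W-sub v (diagonal (λ _ → 1ℂ) · v) (λ y → ≋-sym (identity-· v y)) w
  T-closed {W} W-sub A-closed E-closed {v = v} (add {B} {C} b c) w =
    respects-≋ {W = W} W-sub (λ y → (B · v) y +ᶜ (C · v) y) ((λ y z → B y z +ᶜ C y z) · v)
      (λ y → ≋-sym (+-· B C v y))
      (IsSubspace.+-closed W-sub {B · v} {C · v}
        (T-closed {W} W-sub A-closed E-closed {B} {v} b w) (T-closed {W} W-sub A-closed E-closed {C} {v} c w))
  T-closed {W} W-sub A-closed E-closed {v = v} (scale a {B} b) w =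
    respects-≋ {W = W} W-sub (λ y → a * (B · v) y) ((λ y z → a * B y z) · v)
      (λ y → ≋-sym (*-· a B v y))
      (IsSubspace.*ₗ-closed W-sub a {B · v} (T-closed {W} W-sub A-closed E-closed {B} {v} b w))
  T-closed {W} W-sub A-closed E-closed {v = v} (mul {B} {C} b c) w =
    respects-≋ {W = W} W-sub (B · (C · v)) ((B ⊗ C) · v) (λ y → ≋-sym (⊗-· B C v y))
      (T-closed {W} W-sub A-closed E-closed {B} {C · v} b (T-closed {W} W-sub A-closed E-closed {C} {v} c w))
  T-closed {W} W-sub A-closed E-closed {v = v} (respects {B} {C} B≈C b) w =
    respects-≋ {W = W} W-sub (B · v) (C · v) (·-cong {B = B} {C} {v} {v} (λ y z → ⟪ B≈C y z ⟫) (λ _ → ≋-refl))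
      (T-closed {W} W-sub A-closed E-closed {B} {v} b w)

  quadratic∈T : ∀ a b c → T (quadratic a b c A)
  quadratic∈T a b c = add (scale (fromℤ a) (mul gen-A gen-A)) (add (scale (fromℤ b) gen-A) (scale (fromℤ c) identity))

  -- Isomorphisms

  ≅-refl : ∀ {W} → W ≅ W
  ≅-refl {W} = record
    { to = λ w → w
    ; isIsomorphism = record
      { isLeftSemimoduleMonomorphism = record
        { isLeftSemimoduleHomomorphism = record
          { +ᴹ-isMonoidHomomorphism = record
            { isMagmaHomomorphism = record
              { isRelHomomorphism = record { cong = λ u≈v → u≈v }
              ; homo = λ (u , _) (v , _) → ≈-refl (λ y → u y +ᶜ v y)
              }
            ; ε-homo = ≈-refl (λ _ → 0ℂ)
            }
          ; *ₗ-homo = λ c (u , _) → ≈-refl (λ y → c * u y)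
          }
        ; injective = λ u≈v → u≈v
        }
      ; surjective = λ w → w , λ u≈w → u≈w
      }
    ; commutes = λ {B} b w p → ≈-refl (B · w)
    }
    where
    ≈-refl : ∀ (u : Column n) → u ≈ᵛ u
    ≈-refl u = ≋⇒≈ u u (λ _ → ≋-refl)

  module Iso {W Y : TModule} (iso : W ≅ Y) where
    open _≅_ iso
    open LeftSemimoduleMorphisms.IsLeftSemimoduleIsomorphism isIsomorphism using (⟦⟧-cong; 0ᴹ-homo; injective; surjective)

    image : ∀ w → space W w → Column n
    image w p = proj₁ (to (w , p))

    zero-W : ∃ (space W)
    zero-W = (λ _ → 0ℂ) , 0-closed W

    image-0 : ∀ w p → w ≋ᵛ (λ _ → 0ℂ) → image w p ≋ᵛ (λ _ → 0ℂ)
    image-0 w p w≋0 y = ≋-trans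
      (≈⇒≋ (image w p) (proj₁ (to zero-W)) (⟦⟧-cong {w , p} {zero-W} (≋⇒≈ w (λ _ → 0ℂ) w≋0)) y)
      (≈⇒≋ (proj₁ (to zero-W)) (λ _ → 0ℂ) 0ᴹ-homo y)

    image-0⁻ : ∀ w p → image w p ≋ᵛ (λ _ → 0ℂ) → w ≋ᵛ (λ _ → 0ℂ)
    image-0⁻ w p image≋0 = ≈⇒≋ w (λ _ → 0ℂ) (injective {w , p} {zero-W}
      (≋⇒≈ (image w p) (proj₁ (to zero-W)) (λ y → ≋-trans (image≋0 y)
        (≋-sym (≈⇒≋ (proj₁ (to zero-W)) (λ _ → 0ℂ) 0ᴹ-homo y)))))

    image-· : ∀ {B} (b : T B) w p → image (B · w) (closed W b p) ≋ᵛ B · image w p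
    image-· {B} b w p = ≈⇒≋ (image (B · w) (closed W b p)) (B · image w p) (commutes b w p)

    component-⇒ : ∀ s → s ≤ D → IsNonzero (component s W) → IsNonzero (component s Y)
    component-⇒ s s≤D (u , (w , w∈ , u≈) , u≉0) =
      image (E* s · w) Ew∈
      , (image w w∈ , proj₂ (to (w , w∈)) , ≋⇒≈ (image (E* s · w) Ew∈) (E* s · image w w∈) (image-· (gen-E* s s≤D) w w∈))
      , λ image≈0 → u≉0 (≋⇒≈ u (λ _ → 0ℂ) (λ y → ≋-trans (≈⇒≋ u (E* s · w) u≈ y)
          (image-0⁻ (E* s · w) Ew∈ (≈⇒≋ (image (E* s · w) Ew∈) (λ _ → 0ℂ) image≈0) y)))
      where Ew∈ = closed W (gen-E* s s≤D) w∈

    component-⇐ : ∀ s → s ≤ D → IsNonzero (component s Y) → IsNonzero (component s W)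
    component-⇐ s s≤D (u , (v , v∈ , u≈) , u≉0) =
      E* s · w
      , (w , w∈ , ≋⇒≈ (E* s · w) (E* s · w) (λ _ → ≋-refl))
      , λ Ew≈0 → u≉0 (≋⇒≈ u (λ _ → 0ℂ) (λ y → begin
          u y                          ≈⟨ ≈⇒≋ u (E* s · v) u≈ y ⟩
          (E* s · v) y                 ≈⟨ ·-congˡ (E* s) w↦v y ⟨
          (E* s · image w w∈) y        ≈⟨ image-· (gen-E* s s≤D) w w∈ y ⟨
          image (E* s · w) Ew∈ y       ≈⟨ image-0 (E* s · w) Ew∈ (≈⇒≋ (E* s · w) (λ _ → 0ℂ) Ew≈0) y ⟩
          0ℂ                           ∎))
      where
      open ≋-Reasoning
      preimage = surjective (v , v∈)
      w = proj₁ (proj₁ preimage)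
      w∈ = proj₂ (proj₁ preimage)
      Ew∈ = closed W (gen-E* s s≤D) w∈
      w↦v : image w w∈ ≋ᵛ v
      w↦v = ≈⇒≋ (image w w∈) v (proj₂ preimage {w , w∈} (≋⇒≈ w w (λ _ → ≋-refl)))

  -- Modules spanned by pure vectors of distinct supports

  record IsPureFamily {k} (v : Fin k → V) (norm : Fin k → ℤ) (σ : Fin k → ℕ) : Set where
    field
      isOrthogonal : IsOrthogonal v norm
      A-closed     : ∀ i → Span v (A · v i)
      σ-≤          : ∀ i → σ i ≤ D
      σ-injective  : ∀ {i j} → σ i ≡ σ j → i ≡ j
      supported    : ∀ i y → dist Γ x y ≢ σ i → v i y ≋ 0ℂ

    open IsOrthogonal isOrthogonal

    E*-own : ∀ i → E* (σ i) · v i ≋ᵛ v i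
    E*-own i y = ≋-trans (diagonal-· (e* (σ i)) (v i) y) (own (dist Γ x y ℕ.≟ σ i))
      where
      own : Dec (dist Γ x y ≡ σ i) → e* (σ i) y * v i y ≋ v i y
      own (yes d≡σ) = ≋-trans (*-congʳ (e*-own d≡σ)) (*-identityˡ (v i y))
      own (no  d≢σ) = ≋-trans (*-congˡ (supported i y d≢σ))
                        (≋-trans (*-zeroʳ (e* (σ i) y)) (≋-sym (supported i y d≢σ)))

    E*-other : ∀ {s} i → σ i ≢ s → E* s · v i ≋ᵛ (λ _ → 0ℂ)
    E*-other {s} i σ≢s y = ≋-trans (diagonal-· (e* s) (v i) y) (other (dist Γ x y ℕ.≟ s))
      where
      other : Dec (dist Γ x y ≡ s) → e* s y * v i y ≋ 0ℂ
      other (yes d≡s) = ≋-trans (*-congˡ (supported i y (λ d≡σ → σ≢s (trans (sym d≡σ) d≡s)))) (*-zeroʳ (e* s y))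
      other (no  d≢s) = ≋-trans (*-congʳ (e*-other d≢s)) (*-zeroˡ (v i y))

    E*-closed : ∀ s i → Span v (E* s · v i)
    E*-closed s i = go (σ i ℕ.≟ s)
      where
      go : Dec (σ i ≡ s) → Span v (E* s · v i)
      go (yes refl) = respects-≋ {W = Span v} (span-isSubspace v) (v i) (E* s · v i)
                        (λ y → ≋-sym (E*-own i y)) (span-member v i)
      go (no σ≢s)   = respects-≋ {W = Span v} (span-isSubspace v) (λ _ → 0ℂ) (E* s · v i)
                        (λ y → ≋-sym (E*-other i σ≢s y)) (IsSubspace.0-closed (span-isSubspace v))

    W : TModule
    W = record
      { space = Span v
      ; isSubspace = span-isSubspace v
      ; closed = λ {B} {w} b w∈ → T-closed {Span v} (span-isSubspace v)
          (λ {u} u∈ → span-closed A v A-closed {u} u∈)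
          (λ s _ {u} u∈ → span-closed (E* s) v (E*-closed s) {u} u∈) {B} {w} b w∈
      }

    -- Since the supports are distinct, the dual idempotent isolates a single term. This is how one
    -- coefficient is extracted inside a submodule of which nothing else is known.
    E*-lin-own : ∀ c i → E* (σ i) · lin c v ≋ᵛ (λ y → c i * v i y)
    E*-lin-own c i y = ≋-trans (·-lin (E* (σ i)) c v y) (≋-trans
      (∑-single (λ j → c j * (E* (σ i) · v j) y) i
        (λ j j≢i → ≋-trans (*-congˡ (E*-other j (λ σ≡σ → j≢i (σ-injective σ≡σ)) y)) (*-zeroʳ (c j))))
      (*-congˡ (E*-own i y)))

    E*-lin-none : ∀ {s} c → (∀ i → σ i ≢ s) → E* s · lin c v ≋ᵛ (λ _ → 0ℂ)
    E*-lin-none {s} c σ≢s y = ≋-trans (·-lin (E* s) c v y)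
      (∑-0 (λ i → ≋-trans (*-congˡ (E*-other i (σ≢s i) y)) (*-zeroʳ (c i))))

    component-own : ∀ i → component (σ i) W ≐ Span (singleton (v i))
    component-own i = (λ {u} → ⊆ {u}) , (λ {u} → ⊇ {u})
      where
      ⊆ : ∀ {u} → component (σ i) W u → Span (singleton (v i)) u
      ⊆ {u} (w , w∈ , u≈) =
        let c , w≋ = span-elim v w w∈
        in span-intro (singleton (v i)) (λ _ → c i) u (λ y →
             ≋-trans (≈⇒≋ u (E* (σ i) · w) u≈ y)
             (≋-trans (·-congˡ (E* (σ i)) w≋ y)
             (≋-trans (E*-lin-own c i y) (≋-sym (lin-one (λ _ → c i) (singleton (v i)) y)))))
      ⊇ : ∀ {u} → Span (singleton (v i)) u → component (σ i) W u
      ⊇ {u} u∈ =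
        let c , u≋ = span-elim (singleton (v i)) u u∈
            u≋cv = λ y → ≋-trans (u≋ y) (lin-one c (singleton (v i)) y)
        in u , span-⊆ {W = Span v} (span-isSubspace v) (singleton (v i)) (λ { 0F → span-member v i }) {u} u∈
           , ≋⇒≈ u (E* (σ i) · u) (λ y →
             ≋-trans (u≋cv y)
             (≋-trans (*-congˡ (≋-sym (E*-own i y)))
             (≋-trans (≋-sym (·-* (E* (σ i)) (c 0F) (v i) y))
                      (·-congˡ (E* (σ i)) (λ z → ≋-sym (u≋cv z)) y))))

    component-none : ∀ {s} → (∀ i → σ i ≢ s) → ¬ IsNonzero (component s W)
    component-none {s} σ≢s (u , (w , w∈ , u≈) , u≉0) =
      let c , w≋ = span-elim v w w∈
      in u≉0 (≋⇒≈ u (λ _ → 0ℂ) (λ y → ≋-trans (≈⇒≋ u (E* s · w) u≈ y)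
           (≋-trans (·-congˡ (E* s) w≋ y) (E*-lin-none c σ≢s y))))

    v≉0 : ∀ i → ¬ (v i ≈ᵛ (λ _ → 0ℂ))
    v≉0 i v≈0 = nonzero i (≈⇒≋ (v i) (λ _ → 0ℂ) v≈0)

    component-nonzero : ∀ i → IsNonzero (component (σ i) W)
    component-nonzero i = v i , proj₂ (component-own i) {v i} (span-member (singleton (v i)) 0F) , v≉0 i

    occupied : ∀ s → IsNonzero (component s W) ⇔ (∃[ i ] σ i ≡ s)
    occupied s = mk⇔ to (λ { (i , refl) → component-nonzero i })
      where
      to : IsNonzero (component s W) → ∃[ i ] σ i ≡ s
      to nz with any? (λ i → σ i ℕ.≟ s)
      ... | yes found = found
      ... | no ¬found = ⊥-elim (component-none (λ i σ≡s → ¬found (i , σ≡s)) nz)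

    isOrthogonal-singleton : ∀ i → IsOrthogonal (singleton (v i)) (λ _ → norm i)
    isOrthogonal-singleton i = record
      { norm≢0 = λ _ → norm≢0 i
      ; orthogonal = λ { {0F} {0F} 0≢0 → ⊥-elim (0≢0 refl) }
      ; normed = λ { 0F → normed i }
      }

    component-dim : ∀ i → HasDim (component (σ i) W) 1
    component-dim i = singleton (v i) , record
      { members = λ { 0F → proj₂ (component-own i) {v i} (span-member (singleton (v i)) 0F) }
      ; independent = IsOrthogonal.independent (isOrthogonal-singleton i)
      ; spanning = λ {u} → proj₁ (component-own i) {u}
      }

    isBasis : IsBasis (space W) v
    isBasis = record { members = span-member v ; independent = independent ; spanning = λ p → p }

    endpoint : ∀ i → (∀ j → σ i ≤ σ j) → HasEndpoint W (σ i)
    endpoint i least = σ-≤ i , component-nonzero i , λ s s<σ → component-none (λ j σ≡s →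
      ℕ.<⇒≱ s<σ (ℕ.≤-trans (least j) (ℕ.≤-reflexive σ≡s)))

    support? : ∀ (s : Fin (suc D)) → Dec (∃[ i ] σ i ≡ toℕ s)
    support? s = any? (λ i → σ i ℕ.≟ toℕ s)

    hasDiameter : ∀ {d} → ∣ comprehension support? ∣ ≡ suc d → HasDiameter W d
    hasDiameter size≡ = comprehension support? , (λ s → mk⇔
        (λ s∈ → Equivalence.from (occupied (toℕ s)) (Equivalence.to (∈-comprehension support? s) s∈))
        (λ nz → Equivalence.from (∈-comprehension support? s) (Equivalence.to (occupied (toℕ s)) nz)))
      , size≡

    hasShape : ∀ i → (∀ j → σ i ≤ σ j) → ∀ {d} → ∣ comprehension support? ∣ ≡ suc d → (ρ : Vec ℕ (suc d)) →
      (∀ s → ∃[ j ] σ j ≡ σ i ℕ.+ toℕ s × 1 ≡ lookup ρ s) → HasShape W ρ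
    hasShape i least size≡ ρ filled = σ i , endpoint i least , hasDiameter size≡ , λ s →
      let j , σj≡ , 1≡ = filled s
      in subst₂ (λ r m → HasDim (component r W) m) σj≡ 1≡ (component-dim j)

    isPure : ∀ i → IsPure (v i) (σ i)
    isPure i = σ-≤ i , v≉0 i , v i , _ , ≋⇒≈ (v i) (E* (σ i) · v i) (λ y → ≋-sym (E*-own i y))

    -- Minimality is a refutation, so take w ≠ 0 in a proper submodule Y. If a coefficient of w were
    -- invertible, Y would contain the corresponding basis vector, by `connected` all of them, and
    -- so all of W. Hence no coefficient is invertible, all of them are 0 by tightness, and w
    -- vanishes after all.
    irreducible : Fin k → (∀ (Y : TModule) i j → space Y (v i) → space Y (v j)) → IsIrreducible W
    irreducible i₀ connected = record { nonzero = v i₀ , span-member v i₀ , v≉0 i₀ ; minimal = minimal }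
      where
      minimal : ∀ (Y : TModule) → IsNonzero (space Y) → ¬ (space Y ⊂ space W)
      minimal Y (w , w∈Y , w≉0) (Y⊆W , W⊈Y) = w≉0 (≋⇒≈ w (λ _ → 0ℂ) w≋0)
        where
        c : Fin k → ℂ
        c = proj₁ (span-elim v w (Y⊆W {w} w∈Y))
        w≋ : w ≋ᵛ lin c v
        w≋ = proj₂ (span-elim v w (Y⊆W {w} w∈Y))
        member : ∀ i → Invertible (c i) → space Y (v i)
        member i (c⁻¹ , c⁻¹c≋1) = respects-≋ {W = space Y} (isSubspace Y)
          (λ y → c⁻¹ * (E* (σ i) · w) y) (v i)
          (λ y → begin
            c⁻¹ * (E* (σ i) · w) y        ≈⟨ *-congˡ (·-congˡ (E* (σ i)) w≋ y) ⟩
            c⁻¹ * (E* (σ i) · lin c v) y  ≈⟨ *-congˡ (E*-lin-own c i y) ⟩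
            c⁻¹ * (c i * v i y)           ≈⟨ *-assoc c⁻¹ (c i) (v i y) ⟨
            (c⁻¹ * c i) * v i y           ≈⟨ *-congʳ c⁻¹c≋1 ⟩
            1ℂ * v i y                    ≈⟨ *-identityˡ (v i y) ⟩
            v i y                         ∎)
          (*ₗ-closed Y c⁻¹ {E* (σ i) · w} (closed Y (gen-E* (σ i) (σ-≤ i)) w∈Y))
          where open ≋-Reasoning
        c≋0 : ∀ i → c i ≋ 0ℂ
        c≋0 i = ¬invertible⇒≋0 (λ inv → W⊈Y (λ {u} → span-⊆ {W = space Y} (isSubspace Y) v
          (λ j → connected Y i j (member i inv)) {u}))
        w≋0 : w ≋ᵛ (λ _ → 0ℂ)
        w≋0 y = ≋-trans (w≋ y) (∑-0 (λ i → ≋-trans (*-congʳ (c≋0 i)) (*-zeroˡ (v i y))))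

  -- Isomorphisms between one-dimensional modules

  CommonEigenvalue : V → V → Mat n → Set
  CommonEigenvalue u v B = ∃[ α ] (B · u ≋ᵛ (λ y → α * u y)) × (B · v ≋ᵛ (λ y → α * v y))

  -- Having a common eigenvalue on u and v passes to sums, multiples and products, so it spreads
  -- from the generators to T. It is exactly what makes the linear map sending u to v commute with
  -- T.
  T-scalar : ∀ u v → CommonEigenvalue u v A → (∀ i → i ≤ D → CommonEigenvalue u v (E* i)) →
             ∀ {B} → T B → CommonEigenvalue u v B
  T-scalar u v A-scalar E-scalar gen-A = A-scalar
  T-scalar u v A-scalar E-scalar (gen-E* i i≤D) = E-scalar i i≤D
  T-scalar u v A-scalar E-scalar identity = 1ℂ
    , (λ y → ≋-trans (identity-· u y) (≋-sym (*-identityˡ (u y))))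
    , (λ y → ≋-trans (identity-· v y) (≋-sym (*-identityˡ (v y))))
  T-scalar u v A-scalar E-scalar (add {B} {C} b c) =
    let β , Bu , Bv = T-scalar u v A-scalar E-scalar b
        γ , Cu , Cv = T-scalar u v A-scalar E-scalar c
    in β +ᶜ γ
      , (λ y → ≋-trans (+-· B C u y) (≋-trans (+ᶜ-cong (Bu y) (Cu y)) (≋-sym (*-distribʳ-+ᶜ (u y) β γ))))
      , (λ y → ≋-trans (+-· B C v y) (≋-trans (+ᶜ-cong (Bv y) (Cv y)) (≋-sym (*-distribʳ-+ᶜ (v y) β γ))))
  T-scalar u v A-scalar E-scalar (scale a {B} b) =
    let β , Bu , Bv = T-scalar u v A-scalar E-scalar b
    in a * β
      , (λ y → ≋-trans (*-· a B u y) (≋-trans (*-congˡ (Bu y)) (≋-sym (*-assoc a β (u y)))))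
      , (λ y → ≋-trans (*-· a B v y) (≋-trans (*-congˡ (Bv y)) (≋-sym (*-assoc a β (v y)))))
  T-scalar u v A-scalar E-scalar (mul {B} {C} b c) =
    let β , Bu , Bv = T-scalar u v A-scalar E-scalar b
        γ , Cu , Cv = T-scalar u v A-scalar E-scalar c
    in γ * β
      , (λ y → ≋-trans (⊗-· B C u y) (≋-trans (·-congˡ B Cu y)
          (≋-trans (·-* B γ u y) (≋-trans (*-congˡ (Bu y)) (≋-sym (*-assoc γ β (u y)))))))
      , (λ y → ≋-trans (⊗-· B C v y) (≋-trans (·-congˡ B Cv y)
          (≋-trans (·-* B γ v y) (≋-trans (*-congˡ (Bv y)) (≋-sym (*-assoc γ β (v y)))))))
  T-scalar u v A-scalar E-scalar (respects {B} {C} B≈C b) =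
    let β , Bu , Bv = T-scalar u v A-scalar E-scalar b
    in β
      , (λ y → ≋-trans (≋-sym (·-cong {B = B} {C} {u} {u} (λ y z → ⟪ B≈C y z ⟫) (λ _ → ≋-refl) y)) (Bu y))
      , (λ y → ≋-trans (≋-sym (·-cong {B = B} {C} {v} {v} (λ y z → ⟪ B≈C y z ⟫) (λ _ → ≋-refl) y)) (Bv y))

  module OneDimensional {p q : Fin 1 → V} {k l : Fin 1 → ℤ} {σ τ : Fin 1 → ℕ}
    (P : IsPureFamily p k σ) (Q : IsPureFamily q l τ)
    (σ≡τ : σ 0F ≡ τ 0F) (A-scalar : CommonEigenvalue (p 0F) (q 0F) A) where
    private
      module P = IsPureFamily P
      module Q = IsPureFamily Q

      u v : V
      u = p 0F
      v = q 0F

    E*-scalar : ∀ s → Dec (σ 0F ≡ s) → CommonEigenvalue u v (E* s)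
    E*-scalar s (yes refl) = 1ℂ
      , (λ y → ≋-trans (P.E*-own 0F y) (≋-sym (*-identityˡ (u y))))
      , (λ y → ≋-trans (subst (λ s → (E* s · v) y ≋ v y) (sym σ≡τ) (Q.E*-own 0F y)) (≋-sym (*-identityˡ (v y))))
    E*-scalar s (no σ≢s) = 0ℂ
      , (λ y → ≋-trans (P.E*-other 0F σ≢s y) (≋-sym (*-zeroˡ (u y))))
      , (λ y → ≋-trans (Q.E*-other 0F (λ τ≡s → σ≢s (trans σ≡τ τ≡s)) y) (≋-sym (*-zeroˡ (v y))))

    scalar : ∀ {B} → T B → CommonEigenvalue u v B
    scalar = T-scalar u v A-scalar (λ s _ → E*-scalar s (σ 0F ℕ.≟ s))

    coordinate-unique : ∀ {q : Fin 1 → V} {l τ} → IsPureFamily q l τ →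
      ∀ a b → (λ y → a * q 0F y) ≋ᵛ (λ y → b * q 0F y) → a ≋ b
    coordinate-unique {q} {l} F a b av≋bv = *-injectiveʳ (fromℤ-invertible (norm≢0 0F)) (begin
      a * fromℤ (l 0F)                  ≈⟨ *-congˡ (normed 0F) ⟨
      a * ⟨ q 0F , q 0F ⟩               ≈⟨ ⟨⟩-* a (q 0F) (q 0F) ⟨
      ⟨ (λ y → a * q 0F y) , q 0F ⟩     ≈⟨ ⟨⟩-congˡ (q 0F) av≋bv ⟩
      ⟨ (λ y → b * q 0F y) , q 0F ⟩     ≈⟨ ⟨⟩-* b (q 0F) (q 0F) ⟩
      b * ⟨ q 0F , q 0F ⟩               ≈⟨ *-congˡ (normed 0F) ⟩
      b * fromℤ (l 0F)                  ∎)
      where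
      open ≋-Reasoning
      open IsOrthogonal (IsPureFamily.isOrthogonal F)

    coordinate : ∀ (q : Fin 1 → V) {w} → Span q w → ℂ
    coordinate q {w} w∈ = proj₁ (span-elim q w w∈) 0F

    coordinate-≋ : ∀ (q : Fin 1 → V) {w} (w∈ : Span q w) → w ≋ᵛ (λ y → coordinate q {w} w∈ * q 0F y)
    coordinate-≋ q {w} w∈ y = ≋-trans (proj₂ (span-elim q w w∈) y) (lin-one (proj₁ (span-elim q w w∈)) q y)

    -- Equal vectors may carry different span witnesses, and `coordinate` reads the witness. This
    -- shows that the choice does not matter up to `_≋_`; congruence and the homomorphism laws of
    -- `to` are instances of it.
    determined : ∀ {w} (w∈ : Span p w) a → w ≋ᵛ (λ y → a * u y) → coordinate p {w} w∈ ≋ a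
    determined {w} w∈ a w≋ = coordinate-unique P (coordinate p {w} w∈) a
      (λ y → ≋-trans (≋-sym (coordinate-≋ p {w} w∈ y)) (w≋ y))

    multiple : ℂ → V
    multiple a y = a * v y

    to : ∃ (Span p) → ∃ (Span q)
    to (w , w∈) = multiple (coordinate p {w} w∈)
      , span-intro q (λ _ → coordinate p {w} w∈) (multiple (coordinate p {w} w∈))
          (λ y → ≋-sym (lin-one (λ _ → coordinate p {w} w∈) q y))

    multiple-cong : ∀ a b → a ≋ b → multiple a ≈ᵛ multiple b
    multiple-cong a b a≋b = ≋⇒≈ (multiple a) (multiple b) (λ y → *-congʳ a≋b)

    isomorphic : P.W ≅ Q.W
    isomorphic = record
      { to = to
      ; isIsomorphism = record
        { isLeftSemimoduleMonomorphism = record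
          { isLeftSemimoduleHomomorphism = record
            { +ᴹ-isMonoidHomomorphism = record
              { isMagmaHomomorphism = record
                { isRelHomomorphism = record { cong = λ {a} {b} → to-cong a b }
                ; homo = λ (a , a∈) (b , b∈) →
                    let sum = λ y → a y +ᶜ b y
                        sum∈ = +-closed P.W {a} {b} a∈ b∈
                        α = coordinate p {a} a∈
                        β = coordinate p {b} b∈
                    in ≋⇒≈ (multiple (coordinate p {sum} sum∈)) (λ y → multiple α y +ᶜ multiple β y) (λ y → ≋-trans
                         (*-congʳ (determined {sum} sum∈ (α +ᶜ β) (λ z → ≋-trans
                           (+ᶜ-cong (coordinate-≋ p {a} a∈ z) (coordinate-≋ p {b} b∈ z))
                           (≋-sym (*-distribʳ-+ᶜ (u z) α β)))))
                         (*-distribʳ-+ᶜ (v y) α β))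
                }
              ; ε-homo = ≋⇒≈ (multiple (coordinate p {λ _ → 0ℂ} (0-closed P.W))) (λ _ → 0ℂ) (λ y → ≋-trans
                  (*-congʳ (determined {λ _ → 0ℂ} (0-closed P.W) 0ℂ (λ z → ≋-sym (*-zeroˡ (u z))))) (*-zeroˡ (v y)))
              }
            ; *ₗ-homo = λ c (a , a∈) →
                let product = λ y → c * a y
                    product∈ = *ₗ-closed P.W c {a} a∈
                    α = coordinate p {a} a∈
                in ≋⇒≈ (multiple (coordinate p {product} product∈)) (λ y → c * multiple α y) (λ y → ≋-trans
                     (*-congʳ (determined {product} product∈ (c * α) (λ z → ≋-trans
                       (*-congˡ (coordinate-≋ p {a} a∈ z)) (≋-sym (*-assoc c α (u z))))))
                     (*-assoc c α (v y)))
            }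
          ; injective = λ {a} {b} → to-injective a b
          }
        ; surjective = λ (w , w∈) →
            let α = coordinate q {w} w∈
                preimage = λ y → α * u y
            in (preimage , span-intro p (λ _ → α) preimage (λ y → ≋-sym (lin-one (λ _ → α) p y)))
               , λ { {a , a∈} a≈ → ≋⇒≈ (multiple (coordinate p {a} a∈)) w (λ y → ≋-trans
                   (*-congʳ (determined {a} a∈ α (≈⇒≋ a preimage a≈)))
                   (≋-sym (coordinate-≋ q {w} w∈ y))) }
        }
      ; commutes = λ {B} b w w∈ →
          let β , Bu , Bv = scalar b
              α = coordinate p {w} w∈
              Bw∈ = closed P.W b w∈
          in ≋⇒≈ (multiple (coordinate p {B · w} Bw∈)) (B · multiple α) (λ y → ≋-trans
               (*-congʳ (determined {B · w} Bw∈ (α * β) (λ z → ≋-trans (·-congˡ B (coordinate-≋ p {w} w∈) z)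
                 (≋-trans (·-* B α u z) (≋-trans (*-congˡ (Bu z)) (≋-sym (*-assoc α β (u z))))))))
               (≋-trans (*-assoc α β (v y)) (≋-sym (≋-trans (·-* B α v y) (*-congˡ (Bv y))))))
      }
      where
      to-cong : ∀ a b → proj₁ a ≈ᵛ proj₁ b → proj₁ (to a) ≈ᵛ proj₁ (to b)
      to-cong (a , a∈) (b , b∈) a≈b = multiple-cong (coordinate p {a} a∈) (coordinate p {b} b∈)
        (determined {a} a∈ (coordinate p {b} b∈)
          (λ y → ≋-trans (≈⇒≋ a b a≈b y) (coordinate-≋ p {b} b∈ y)))
      to-injective : ∀ a b → proj₁ (to a) ≈ᵛ proj₁ (to b) → proj₁ a ≈ᵛ proj₁ b
      to-injective (a , a∈) (b , b∈) ta≈tb = ≋⇒≈ a b (λ y → ≋-trans (coordinate-≋ p {a} a∈ y)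
        (≋-trans (*-congʳ (coordinate-unique Q (coordinate p {a} a∈) (coordinate p {b} b∈)
          (≈⇒≋ (multiple (coordinate p {a} a∈)) (multiple (coordinate p {b} b∈)) ta≈tb)))
        (≋-sym (coordinate-≋ p {b} b∈ y))))

  -- The sizes are 1 only up to an equation, so that families whose size is computed from an index
  -- can be supplied.
  one-dimensional-≅ : ∀ {k l} {v : Fin k → V} {w : Fin l → V} {m n σ τ} →
    (P : IsPureFamily v m σ) (Q : IsPureFamily w n τ) → k ≡ 1 → l ≡ 1 → (∀ a b → σ a ≡ τ b) → ∀ α →
    (∀ a → A · v a ≋ᵛ (λ y → α * v a y)) → (∀ b → A · w b ≋ᵛ (λ y → α * w b y)) →
    IsPureFamily.W P ≅ IsPureFamily.W Q
  one-dimensional-≅ P Q refl refl σ≡τ α Av Aw = OneDimensional.isomorphic P Q (σ≡τ 0F 0F) (α , Av 0F , Aw 0F)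

  -- Decompositions of V into modules with pure bases

  module Families {K : ℕ} (size : Fin K → ℕ) (family : ∀ i → Vec V (size i))
    (norm : ∀ i → Fin (size i) → ℤ) (σ : ∀ i → Fin (size i) → ℕ)
    (pure : ∀ i → IsPureFamily (lookup (family i)) (norm i) (σ i)) where

    W : Fin K → TModule
    W i = IsPureFamily.W (pure i)

    modules : Vec TModule K
    modules = tabulate W

    decomposition :
      (∀ i → IsIrreducible (W i)) →
      (∀ {i j} → i ≢ j → ∀ a b → ⟨ lookup (family i) a , lookup (family j) b ⟩ ≋ 0ℂ) →
      (∀ v → ∃[ w ] (∀ i → Span (lookup (family i)) (w i)) × v ≋ᵛ (λ y → ∑ (λ i → w i y))) →
      IsOrthogonalDecomposition modules
    decomposition irreducible cross spans = record
      { irreducible = λ i → subst IsIrreducible (sym (lookup∘tabulate W i)) (irreducible i)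
      ; orthogonal = λ {i} {j} i≢j {u} {v} u∈ v∈ →
          ⟫ spans-orthogonal (lookup (family i)) (lookup (family j)) (cross i≢j) {u} {v} (member i u u∈) (member j v v∈) ⟪
      ; spanning = λ v →
          let w , w∈ , v≋ = spans v
          in w , (λ i → subst (λ U → space U (w i)) (sym (lookup∘tabulate W i)) (w∈ i))
             , ≋⇒≈ v (total w) (λ y → ≋-trans (v≋ y) (≋-sym (total≋ w y)))
      -- Pairing the vanishing sum with a basis vector of the i-th module leaves only the pairing
      -- with the i-th summand, which lies in the span of that basis and is therefore 0.
      ; direct = λ w w∈ total≈0 i → ≋⇒≈ (w i) (λ _ → 0ℂ)
          (IsOrthogonal.span-0 (IsPureFamily.isOrthogonal (pure i)) {w i} (member i (w i) (w∈ i)) (λ a →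
            let u = lookup (family i) a in begin
            ⟨ w i , u ⟩
              ≈⟨ ∑-single (λ j → ⟨ w j , u ⟩) i (λ j j≢i → ⟨⟩-span-0 (lookup (family j)) u
                   (λ b → cross j≢i b a) {w j} (member j (w j) (w∈ j))) ⟨
            ∑ (λ j → ⟨ w j , u ⟩)
              ≈⟨ ⟨⟩-∑ w u ⟨
            ⟨ (λ y → ∑ (λ j → w j y)) , u ⟩
              ≈⟨ ⟨⟩-congˡ u (λ y → ≋-trans (≋-sym (total≋ w y)) (≈⇒≋ (total w) (λ _ → 0ℂ) total≈0 y)) ⟩
            ⟨ (λ _ → 0ℂ) , u ⟩
              ≈⟨ ∑-0 (λ y → *-zeroˡ (conj (u y))) ⟩
            0ℂ ∎))
      }
      where
      open ≋-Reasoning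
      member : ∀ i u → space (lookup modules i) u → Span (lookup (family i)) u
      member i u = subst (λ U → space U u) (lookup∘tabulate W i)

    -- An expansion in one family spanning V is cut into blocks, the i-th partial sum being the
    -- component in the i-th module.
    blockwise : ∀ {N} (place-in : ∀ i → Fin (size i) → Fin N) →
      (∀ f → ∑ f ≋ ∑ (λ i → ∑ (λ a → f (place-in i a)))) →
      (all : Fin N → V) → (∀ i a → all (place-in i a) ≡ lookup (family i) a) → (∀ v → Span all v) →
      ∀ v → ∃[ w ] (∀ i → Span (lookup (family i)) (w i)) × v ≋ᵛ (λ y → ∑ (λ i → w i y))
    blockwise {N} place-in ∑-blocks all all-at spans v = part
      , (λ i → span-intro (lookup (family i)) (λ a → c (place-in i a)) (part i) (λ y → ≋-refl))
      , (λ y → begin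
          v y
            ≈⟨ proj₂ (span-elim all v (spans v)) y ⟩
          ∑ (λ p → c p * all p y)
            ≈⟨ ∑-blocks (λ p → c p * all p y) ⟩
          ∑ (λ i → ∑ (λ a → c (place-in i a) * all (place-in i a) y))
            ≈⟨ ∑-cong (λ i → ∑-cong (λ a → *-congˡ (≋-reflexive (cong (λ u → u y) (all-at i a))))) ⟩
          ∑ (λ i → part i y) ∎)
      where
      open ≋-Reasoning
      c : Fin N → ℂ
      c = proj₁ (span-elim all v (spans v))
      part : Fin K → V
      part i = lin (λ a → c (place-in i a)) (lookup (family i))

    family-≅ : ∀ i j → size i ≡ 1 → size j ≡ 1 → (∀ a b → σ i a ≡ σ j b) → ∀ α →
      (∀ a → A · lookup (family i) a ≋ᵛ (λ y → α * lookup (family i) a y)) →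
      (∀ b → A · lookup (family j) b ≋ᵛ (λ y → α * lookup (family j) b y)) → W i ≅ W j
    family-≅ i j = one-dimensional-≅ (pure i) (pure j)

    -- An isomorphism preserves the set of distances from x that a module occupies; a distance
    -- occupied by only one of two modules thus refutes their isomorphism.
    levels-⇒ : ∀ i j → W i ≅ W j → ∀ s → s ≤ D → ∃[ a ] σ i a ≡ s → ∃[ b ] σ j b ≡ s
    levels-⇒ i j iso s s≤D a = Equivalence.to (IsPureFamily.occupied (pure j) s)
      (Iso.component-⇒ {W i} {W j} iso s s≤D (Equivalence.from (IsPureFamily.occupied (pure i) s) a))

    levels-⇐ : ∀ i j → W i ≅ W j → ∀ s → s ≤ D → ∃[ b ] σ j b ≡ s → ∃[ a ] σ i a ≡ s
    levels-⇐ i j iso s s≤D b = Equivalence.to (IsPureFamily.occupied (pure i) s)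
      (Iso.component-⇐ {W i} {W j} iso s s≤D (Equivalence.from (IsPureFamily.occupied (pure j) s) b))

    module Classified {C : Set} (type : Fin K → C) (_≟ᶜ_ : (s t : C) → Dec (s ≡ t))
      (classification : ∀ i j → (W i ≅ W j) ⇔ (type i ≡ type j)) where

      modules-classification : ∀ i j → (lookup modules i ≅ lookup modules j) ⇔ (type i ≡ type j)
      modules-classification i j = subst₂ (λ U Y → (U ≅ Y) ⇔ (type i ≡ type j))
        (sym (lookup∘tabulate W i)) (sym (lookup∘tabulate W j)) (classification i j)

      multiplicity : ∀ j {m} → ∣ comprehension (λ i → type i ≟ᶜ type j) ∣ ≡ m → HasMultiplicityIn modules (W j) m
      multiplicity j size≡ = comprehension (λ i → type i ≟ᶜ type j) , (λ i → subst
          (λ U → (i ∈ comprehension (λ i → type i ≟ᶜ type j)) ⇔ (U ≅ W j)) (sym (lookup∘tabulate W i))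
          (mk⇔ (λ i∈ → Equivalence.from (classification i j) (Equivalence.to (∈-comprehension (λ i → type i ≟ᶜ type j) i) i∈))
               (λ iso → Equivalence.from (∈-comprehension (λ i → type i ≟ᶜ type j) i) (Equivalence.to (classification i j) iso))))
        , size≡

    dimension : ∀ i → HasDim (space (W i)) (size i)
    dimension i = lookup (family i) , IsPureFamily.isBasis (pure i)

    pureBasis : ∀ i → (∀ a b → a Fin.≤ b → σ i a ≤ σ i b) → IsPureBasis (W i) (family i)
    pureBasis i increasing = record
      { isBasis = IsPureFamily.isBasis (pure i)
      ; support = σ i
      ; pure = IsPureFamily.isPure (pure i)
      ; increasing = increasing
      }

-- Vectors given by an essential part

module EssentialParts {n : ℕ} (Γ : Graph n) (x : Fin n) where
  open Terwilliger Γ x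

  essential-own : ∀ i {k} (order : Fin k ↔ Sphere Γ i x) row j →
    withEssentialPart i order row (proj₁ (Inverse.to order j)) ≡ fromℤ (lookup row j)
  essential-own i order row j with dist Γ x (proj₁ (Inverse.to order j)) ℕ.≟ i
  -- The distance proof found by the test need not be the one stored in the ordering; equality
  -- proofs in ℕ are unique, so both name the same point of the sphere.
  ... | yes d≡i = cong (fromℤ ∘ lookup row) (trans
        (cong (λ eq → Inverse.from order (proj₁ (Inverse.to order j) , eq)) (ℕ.≡-irrelevant d≡i (proj₂ (Inverse.to order j))))
        (Inverse.strictlyInverseʳ order j))
  ... | no  d≢i = ⊥-elim (d≢i (proj₂ (Inverse.to order j)))

  essential-other : ∀ i {k} (order : Fin k ↔ Sphere Γ i x) row {y} →
    dist Γ x y ≢ i → withEssentialPart i order row y ≡ 0ℂ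
  essential-other i order row {y} d≢i with dist Γ x y ℕ.≟ i
  ... | yes d≡i = ⊥-elim (d≢i d≡i)
  ... | no  _   = refl

-- In the enumeration x, Γ₁(x), Γ₂(x) of the vertices, everything depends on the distance to x only.

level : Fin 6 → ℕ
level = lookup (0 ∷ 1 ∷ 1 ∷ 1 ∷ 2 ∷ 2 ∷ [])

-- Γ₁(x) is the part not containing x, so two vertices are adjacent exactly when one of them, and
-- not the other, is at distance 1.
opposite : ℕ → ℕ → Bool
opposite i j = (i ≡ᵇ 1) xor (j ≡ᵇ 1)

A₀ : Fin 6 → Fin 6 → ℤ
A₀ k l = if opposite (level k) (level l) then 1ℤ else 0ℤ

e₀ : ℕ → Fin 6 → ℤ
e₀ i l = if does (level l ℕ.≟ i) then 1ℤ else 0ℤ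

E₀ : ℕ → Fin 6 → Fin 6 → ℤ
E₀ i = Kronecker (e₀ i)

private
  adjacency? : Dec (∀ x y z → does (Graph._~?_ K₃₃ y z) ≡ opposite (dist K₃₃ x y) (dist K₃₃ x z))
  adjacency? = all? {6} (λ x → all? {6} (λ y → all? {6} (λ z →
    does (Graph._~?_ K₃₃ y z) Bool.≟ opposite (dist K₃₃ x y) (dist K₃₃ x z))))

adjacency-by-distance : ∀ x y z → does (Graph._~?_ K₃₃ y z) ≡ opposite (dist K₃₃ x y) (dist K₃₃ x z)
adjacency-by-distance = from-yes adjacency?

in₁ : Fin 3 → Fin 6
in₁ 0F = 1F
in₁ 1F = 2F
in₁ 2F = 3F

in₂ : Fin 2 → Fin 6
in₂ 0F = 4F
in₂ 1F = 5F

-- A view of the six places that retains the index within the sphere, where the two given orderings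
-- act.
data Position : Fin 6 → Set where
  base   : Position 0F
  first  : ∀ k → Position (in₁ k)
  second : ∀ k → Position (in₂ k)

position : ∀ l → Position l
position 0F = base
position 1F = first 0F
position 2F = first 1F
position 3F = first 2F
position 4F = second 0F
position 5F = second 1F

-- The enumeration x, Γ₁(x), Γ₂(x) as a permutation of the vertices

module Coordinates (x : Fin 6) (order₁ : Fin 3 ↔ Sphere K₃₃ 1 x) (order₂ : Fin 2 ↔ Sphere K₃₃ 2 x) where
  open Distances K₃₃
  open Terwilliger K₃₃ x
  open TModules K₃₃ x
  open EssentialParts K₃₃ x

  place : Fin 6 → Fin 6
  place 0F = x
  place 1F = proj₁ (Inverse.to order₁ 0F)
  place 2F = proj₁ (Inverse.to order₁ 1F)
  place 3F = proj₁ (Inverse.to order₁ 2F)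
  place 4F = proj₁ (Inverse.to order₂ 0F)
  place 5F = proj₁ (Inverse.to order₂ 1F)

  place-in₁ : ∀ k → place (in₁ k) ≡ proj₁ (Inverse.to order₁ k)
  place-in₁ 0F = refl
  place-in₁ 1F = refl
  place-in₁ 2F = refl

  place-in₂ : ∀ k → place (in₂ k) ≡ proj₁ (Inverse.to order₂ k)
  place-in₂ 0F = refl
  place-in₂ 1F = refl

  dist-place : ∀ l → dist K₃₃ x (place l) ≡ level l
  dist-place 0F = dist-refl x
  dist-place 1F = proj₂ (Inverse.to order₁ 0F)
  dist-place 2F = proj₂ (Inverse.to order₁ 1F)
  dist-place 3F = proj₂ (Inverse.to order₁ 2F)
  dist-place 4F = proj₂ (Inverse.to order₂ 0F)
  dist-place 5F = proj₂ (Inverse.to order₂ 1F)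

  private
    sphere-injective : ∀ {i k} (order : Fin k ↔ Sphere K₃₃ i x) {a b} →
      proj₁ (Inverse.to order a) ≡ proj₁ (Inverse.to order b) → a ≡ b
    sphere-injective order {a} {b} eq = trans (sym (Inverse.strictlyInverseʳ order a))
      (trans (cong (Inverse.from order) (pair (Inverse.to order a) (Inverse.to order b) eq))
             (Inverse.strictlyInverseʳ order b))
      where
      pair : ∀ (p q : Sphere K₃₃ _ x) → proj₁ p ≡ proj₁ q → p ≡ q
      pair (y , d) (.y , d′) refl = cong (y ,_) (ℕ.≡-irrelevant d d′)

    level-in₁ : ∀ k → level (in₁ k) ≡ 1
    level-in₁ 0F = refl
    level-in₁ 1F = refl
    level-in₁ 2F = refl

    level-in₂ : ∀ k → level (in₂ k) ≡ 2
    level-in₂ 0F = refl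
    level-in₂ 1F = refl

  -- Equal vertices have equal distance from x, so k and l have the same level; within one level the
  -- ordering of the sphere is injective.
  place-injective : ∀ {k l} → place k ≡ place l → k ≡ l
  place-injective {k} {l} eq = go (position k) (position l) eq
    (trans (sym (dist-place k)) (trans (cong (dist K₃₃ x) eq) (dist-place l)))
    where
    go : ∀ {k l} → Position k → Position l → place k ≡ place l → level k ≡ level l → k ≡ l
    go base       base       _  _ = refl
    go base       (first b)  _  d with () ← trans d (level-in₁ b)
    go base       (second b) _  d with () ← trans d (level-in₂ b)
    go (first a)  base       _  d with () ← trans (sym d) (level-in₁ a)
    go (first a)  (first b)  eq _ = cong in₁ (sphere-injective order₁
      (trans (sym (place-in₁ a)) (trans eq (place-in₁ b))))
    go (first a)  (second b) _  d with () ← trans (sym (level-in₁ a)) (trans d (level-in₂ b))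
    go (second a) base       _  d with () ← trans (sym d) (level-in₂ a)
    go (second a) (first b)  _  d with () ← trans (sym (level-in₂ a)) (trans d (level-in₁ b))
    go (second a) (second b) eq _ = cong in₂ (sphere-injective order₂
      (trans (sym (place-in₂ a)) (trans eq (place-in₂ b))))

  locate : ∀ y → ∃[ l ] place l ≡ y
  locate y = go (dist K₃₃ x y) refl (dist-≤-diameter x y)
    where
    go : ∀ d → dist K₃₃ x y ≡ d → d ≤ 2 → ∃[ l ] place l ≡ y
    go 0 d≡0 _ = 0F , dist≡0⇒≡ d≡0
    go 1 d≡1 _ = in₁ (Inverse.from order₁ (y , d≡1))
      , trans (place-in₁ (Inverse.from order₁ (y , d≡1))) (cong proj₁ (Inverse.strictlyInverseˡ order₁ (y , d≡1)))
    go 2 d≡2 _ = in₂ (Inverse.from order₂ (y , d≡2))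
      , trans (place-in₂ (Inverse.from order₂ (y , d≡2))) (cong proj₁ (Inverse.strictlyInverseˡ order₂ (y , d≡2)))
    go (suc (suc (suc _))) _ (s≤s (s≤s ()))

  φ : Permutation′ 6
  φ = permutation place (λ y → proj₁ (locate y)) (λ y → proj₂ (locate y))
        (λ l → place-injective (proj₂ (locate (place l))))

  open Tables φ public
  open Spectra φ public

  adjacency-∼ : adjacency K₃₃ ∼ᵐ A₀
  adjacency-∼ k l = ≋-trans (indicator (does (Graph._~?_ K₃₃ (place k) (place l))))
    (≋-reflexive (cong (λ b → fromℤ (if b then 1ℤ else 0ℤ))
      (trans (adjacency-by-distance x (place k) (place l)) (cong₂ opposite (dist-place k) (dist-place l)))))

  e*-∼ : ∀ i → e* i ∼ e₀ i
  e*-∼ i l = ≋-trans (indicator (does (dist K₃₃ x (place l) ℕ.≟ i)))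
    (≋-reflexive (cong (λ d → fromℤ (if does (d ℕ.≟ i) then 1ℤ else 0ℤ)) (dist-place l)))

  E*-∼ : ∀ i → E* i ∼ᵐ E₀ i
  E*-∼ i = ∼ᵐ-diagonal {e* i} {e₀ i} (e*-∼ i)

  essential₁-∼ : ∀ a b c → withEssentialPart 1 order₁ (a ∷ b ∷ c ∷ []) ∼ lookup (0ℤ ∷ a ∷ b ∷ c ∷ 0ℤ ∷ 0ℤ ∷ [])
  essential₁-∼ a b c l = ≋-reflexive (go l)
    where
    row : Vec ℤ 3
    row = a ∷ b ∷ c ∷ []
    outside : ∀ l → level l ≢ 1 → withEssentialPart 1 order₁ row (place l) ≡ 0ℂ
    outside l l≢1 = essential-other 1 order₁ row (λ d≡1 → l≢1 (trans (sym (dist-place l)) d≡1))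
    go : ∀ l → withEssentialPart 1 order₁ row (place l) ≡ fromℤ (lookup (0ℤ ∷ a ∷ b ∷ c ∷ 0ℤ ∷ 0ℤ ∷ []) l)
    go 0F = outside 0F (λ ())
    go 1F = essential-own 1 order₁ row 0F
    go 2F = essential-own 1 order₁ row 1F
    go 3F = essential-own 1 order₁ row 2F
    go 4F = outside 4F (λ ())
    go 5F = outside 5F (λ ())

  essential₂-∼ : ∀ a b → withEssentialPart 2 order₂ (a ∷ b ∷ []) ∼ lookup (0ℤ ∷ 0ℤ ∷ 0ℤ ∷ 0ℤ ∷ a ∷ b ∷ [])
  essential₂-∼ a b l = ≋-reflexive (go l)
    where
    row : Vec ℤ 2
    row = a ∷ b ∷ []
    outside : ∀ l → level l ≢ 2 → withEssentialPart 2 order₂ row (place l) ≡ 0ℂ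
    outside l l≢2 = essential-other 2 order₂ row (λ d≡2 → l≢2 (trans (sym (dist-place l)) d≡2))
    go : ∀ l → withEssentialPart 2 order₂ row (place l) ≡ fromℤ (lookup (0ℤ ∷ 0ℤ ∷ 0ℤ ∷ 0ℤ ∷ a ∷ b ∷ []) l)
    go 0F = outside 0F (λ ())
    go 1F = outside 1F (λ ())
    go 2F = outside 2F (λ ())
    go 3F = outside 3F (λ ())
    go 4F = essential-own 2 order₂ row 0F
    go 5F = essential-own 2 order₂ row 1F

-- The orbits of the stabilizer of the base vertex on pairs of vertices

orbit : Fin 6 → Fin 6 → Fin 11
orbit k l = lookup (lookup
  -- Each of the nine blocks is one orbit, except that Γ₁ × Γ₁ and Γ₂ × Γ₂ split into equal pairs (4
  -- and 9) and distinct pairs (5 and 10).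
  ( (0F ∷ 1F ∷ 1F ∷ 1F ∷ 2F ∷ 2F ∷ [])
  ∷ (3F ∷ 4F ∷ 5F ∷ 5F ∷ 6F ∷ 6F ∷ [])
  ∷ (3F ∷ 5F ∷ 4F ∷ 5F ∷ 6F ∷ 6F ∷ [])
  ∷ (3F ∷ 5F ∷ 5F ∷ 4F ∷ 6F ∷ 6F ∷ [])
  ∷ (7F ∷ 8F ∷ 8F ∷ 8F ∷ 9F ∷ suc 9F ∷ [])
  ∷ (7F ∷ 8F ∷ 8F ∷ 8F ∷ suc 9F ∷ 9F ∷ []) ∷ []) k) l

-- Together they give a representative pair of each orbit.
row col : Fin 11 → Fin 6
row = lookup (0F ∷ 0F ∷ 0F ∷ 1F ∷ 1F ∷ 1F ∷ 1F ∷ 4F ∷ 4F ∷ 4F ∷ 4F ∷ [])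
col = lookup (0F ∷ 1F ∷ 4F ∷ 0F ∷ 1F ∷ 2F ∷ 4F ∷ 0F ∷ 1F ∷ 4F ∷ 5F ∷ [])

-- The first two generate the symmetric group on the places of Γ₁(x), the third that on the places
-- of Γ₂(x).
generator : Fin 3 → Permutation′ 6
generator 0F = transpose 1F 2F
generator 1F = transpose 2F 3F
generator 2F = transpose 4F 5F

apply : List (Fin 3) → Fin 6 → Fin 6
apply []       k = k
apply (g ∷ gs) k = generator g ⟨$⟩ʳ apply gs k

private
  -- One word for each of the twelve elements of S₃ × S₂: the six reduced words of S₃, without and
  -- with the swap of Γ₂(x).
  word : Fin 12 → List (Fin 3)
  word = lookup
    ( []                    ∷ (0F ∷ [])           ∷ (1F ∷ [])           ∷ (0F ∷ 1F ∷ [])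
    ∷ (1F ∷ 0F ∷ [])        ∷ (0F ∷ 1F ∷ 0F ∷ [])
    ∷ (2F ∷ [])             ∷ (2F ∷ 0F ∷ [])      ∷ (2F ∷ 1F ∷ [])      ∷ (2F ∷ 0F ∷ 1F ∷ [])
    ∷ (2F ∷ 1F ∷ 0F ∷ [])   ∷ (2F ∷ 0F ∷ 1F ∷ 0F ∷ []) ∷ [])

  transitive? : Dec (∀ k l → ∃[ w ] apply (word w) (row (orbit k l)) ≡ k × apply (word w) (col (orbit k l)) ≡ l)
  transitive? = all? {6} (λ k → all? {6} (λ l → any? {12} (λ w →
    (apply (word w) (row (orbit k l)) Fin.≟ k) ×-dec (apply (word w) (col (orbit k l)) Fin.≟ l))))

  orbit-row? : Dec (∀ o → orbit (row o) (col o) ≡ o)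
  orbit-row? = all? {11} (λ o → orbit (row o) (col o) Fin.≟ o)

  A₀-invariant? : Dec (∀ g k l → A₀ (generator g ⟨$⟩ʳ k) (generator g ⟨$⟩ʳ l) ≡ A₀ k l)
  A₀-invariant? = all? {3} (λ g → all? {6} (λ k → all? {6} (λ l →
    A₀ (generator g ⟨$⟩ʳ k) (generator g ⟨$⟩ʳ l) ℤ.≟ A₀ k l)))

  level-invariant? : Dec (∀ g k → level (generator g ⟨$⟩ʳ k) ≡ level k)
  level-invariant? = all? {3} (λ g → all? {6} (λ k → level (generator g ⟨$⟩ʳ k) ℕ.≟ level k))

-- The table of A² + 3 A, with its vanishing constant term kept so that it is literally the one
-- produced by `∼ᵐ-quadratic`.
P₀ : Fin 6 → Fin 6 → ℤ
P₀ k l = 1ℤ ℤ.* (A₀ ⊗ℤ A₀) k l ℤ.+ (+ 3 ℤ.* A₀ k l ℤ.+ 0ℤ ℤ.* Kronecker (λ _ → 1ℤ) k l)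

-- Since A² + 3 A is three times the all-ones matrix, three times the matrix of an orbit
-- is s Eᵢ (A² + 3 A) Eⱼ + t Eᵢ with (s , t) = (1 , 0), or, for i = j, (0 , 3) or (1 , -3).
source target : Fin 11 → ℕ
source = level ∘ row
target = level ∘ col

s-weight t-weight : Fin 11 → ℤ
s-weight = lookup (1ℤ ∷ 1ℤ ∷ 1ℤ ∷ 1ℤ ∷ 0ℤ ∷ 1ℤ ∷ 1ℤ ∷ 1ℤ ∷ 1ℤ ∷ 0ℤ ∷ 1ℤ ∷ [])
t-weight = lookup (0ℤ ∷ 0ℤ ∷ 0ℤ ∷ 0ℤ ∷ + 3 ∷ -[1+ 2 ] ∷ 0ℤ ∷ 0ℤ ∷ 0ℤ ∷ + 3 ∷ -[1+ 2 ] ∷ [])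

orbit₀ : Fin 11 → Fin 6 → Fin 6 → ℤ
orbit₀ o k l = if does (orbit k l Fin.≟ o) then 1ℤ else 0ℤ

private
  combined? : Dec (∀ o k l → s-weight o ℤ.* (E₀ (source o) ⊗ℤ (P₀ ⊗ℤ E₀ (target o))) k l ℤ.+ t-weight o ℤ.* E₀ (source o) k l
                          ≡ + 3 ℤ.* orbit₀ o k l)
  combined? = all? {11} (λ o → ≡-table?
    (λ k l → s-weight o ℤ.* (E₀ (source o) ⊗ℤ (P₀ ⊗ℤ E₀ (target o))) k l ℤ.+ t-weight o ℤ.* E₀ (source o) k l)
    (λ k l → + 3 ℤ.* orbit₀ o k l))

  level-≤? : Dec (∀ k → level k ≤ 2)
  level-≤? = all? {6} (λ k → level k ℕ.≤? 2)

abstract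
  transitive : ∀ k l → ∃[ w ] apply (word w) (row (orbit k l)) ≡ k × apply (word w) (col (orbit k l)) ≡ l
  transitive = from-yes transitive?

  orbit-row : ∀ o → orbit (row o) (col o) ≡ o
  orbit-row = from-yes orbit-row?

  A₀-invariant : ∀ g k l → A₀ (generator g ⟨$⟩ʳ k) (generator g ⟨$⟩ʳ l) ≡ A₀ k l
  A₀-invariant = from-yes A₀-invariant?

  level-invariant : ∀ g k → level (generator g ⟨$⟩ʳ k) ≡ level k
  level-invariant = from-yes level-invariant?

  combined : ∀ o k l → s-weight o ℤ.* (E₀ (source o) ⊗ℤ (P₀ ⊗ℤ E₀ (target o))) k l ℤ.+ t-weight o ℤ.* E₀ (source o) k l
                       ≡ + 3 ℤ.* orbit₀ o k l
  combined = from-yes combined?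

  level-≤ : ∀ k → level k ≤ 2
  level-≤ = from-yes level-≤?

matrix-combination-at : ∀ {n k} (c : Fin k → ℂ) (M : Fin k → Mat n) y z →
  LinearAlgebra.combination (matrices n) c M y z ≡ ∑ (λ i → c i * M i y z)
matrix-combination-at {k = zero}  c M y z = refl
matrix-combination-at {k = suc k} c M y z = cong (c zero * M zero y z +ᶜ_) (matrix-combination-at (c ∘ suc) (M ∘ suc) y z)

≋ᵐ⇒≈ : ∀ {n} (B C : Mat n) → B ≋ᵐ C → B ≈ᵐ C
≋ᵐ⇒≈ B C B≋C y z = ⟫ B≋C y z ⟪

≈⇒≋ᵐ : ∀ {n} (B C : Mat n) → B ≈ᵐ C → B ≋ᵐ C
≈⇒≋ᵐ B C B≈C y z = ⟪ B≈C y z ⟫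

-- From integer identities to membership in T and in its modules

module Sandwich {n : ℕ} (Γ : Graph n) (x : Fin n) (φ : Permutation′ n) where
  open Terwilliger Γ x using (T; TModule; add; scale; mul; respects)
  open Tables φ

  -- The identity s B C B′ + t B = m O is verified on integer tables and then divided by m, which is
  -- possible only in ℂ.
  sandwich∈T : ∀ {B B₀ C C₀ B′ B₀′ O O₀} →
    B ∼ᵐ B₀ → C ∼ᵐ C₀ → B′ ∼ᵐ B₀′ → O ∼ᵐ O₀ → ∀ s t m → m ≢ 0ℤ →
    (∀ k l → s ℤ.* (B₀ ⊗ℤ (C₀ ⊗ℤ B₀′)) k l ℤ.+ t ℤ.* B₀ k l ≡ m ℤ.* O₀ k l) →
    T B → T C → T B′ → T O
  sandwich∈T {B} {B₀} {C} {C₀} {B′} {B₀′} {O} {O₀} B∼ C∼ B′∼ O∼ s t m m≢0 eq b c b′ =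
    respects (≋ᵐ⇒≈ (λ y z → m⁻¹ * M y z) O scaled) (scale m⁻¹ (add (scale (fromℤ s) (mul b (mul c b′))) (scale (fromℤ t) b)))
    where
    open ≋-Reasoning
    m⁻¹ : ℂ
    m⁻¹ = proj₁ (fromℤ-invertible m≢0)
    M : Mat n
    M y z = fromℤ s * (B ⊗ (C ⊗ B′)) y z +ᶜ fromℤ t * B y z
    M₀ : Fin n → Fin n → ℤ
    M₀ k l = s ℤ.* (B₀ ⊗ℤ (C₀ ⊗ℤ B₀′)) k l ℤ.+ t ℤ.* B₀ k l
    M-∼ : M ∼ᵐ M₀
    M-∼ = ∼ᵐ-+ {λ y z → fromℤ s * (B ⊗ (C ⊗ B′)) y z} {λ k l → s ℤ.* (B₀ ⊗ℤ (C₀ ⊗ℤ B₀′)) k l}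
      {λ y z → fromℤ t * B y z} {λ k l → t ℤ.* B₀ k l}
      (∼ᵐ-* {B ⊗ (C ⊗ B′)} {B₀ ⊗ℤ (C₀ ⊗ℤ B₀′)} s
        (∼ᵐ-⊗ {B} {B₀} {C ⊗ B′} {C₀ ⊗ℤ B₀′} B∼ (∼ᵐ-⊗ {C} {C₀} {B′} {B₀′} C∼ B′∼)))
      (∼ᵐ-* {B} {B₀} t B∼)
    M≋ : M ≋ᵐ (λ y z → fromℤ m * O y z)
    M≋ = ∼ᵐ-unique {M} {λ y z → fromℤ m * O y z} {M₀} {λ k l → m ℤ.* O₀ k l} M-∼ (∼ᵐ-* {O} {O₀} m O∼) eq
    scaled : (λ y z → m⁻¹ * M y z) ≋ᵐ O
    scaled y z = begin
      m⁻¹ * M y z               ≈⟨ *-congˡ (M≋ y z) ⟩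
      m⁻¹ * (fromℤ m * O y z)   ≈⟨ *-assoc m⁻¹ (fromℤ m) (O y z) ⟨
      (m⁻¹ * fromℤ m) * O y z   ≈⟨ *-congʳ (proj₂ (fromℤ-invertible m≢0)) ⟩
      1ℂ * O y z                ≈⟨ *-identityˡ (O y z) ⟩
      O y z                     ∎

  -- B C u is a nonzero integer multiple of v, and the multiple is removed by scaling within Y.
  sandwich-reaches : ∀ (Y : TModule) {B B₀ C C₀ u U v V} →
    B ∼ᵐ B₀ → C ∼ᵐ C₀ → u ∼ U → v ∼ V → ∀ m → m ≢ 0ℤ →
    (∀ l → (B₀ ·ℤ (C₀ ·ℤ U)) l ≡ m ℤ.* V l) →
    T B → T C → TModule.space Y u → TModule.space Y v
  sandwich-reaches Y {B} {B₀} {C} {C₀} {u} {U} {v} {V} B∼ C∼ u∼ v∼ m m≢0 eq b c u∈Y =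
    respects-≋ {W = TModule.space Y} (TModule.isSubspace Y) (λ y → m⁻¹ * (B · (C · u)) y) v
      (λ y → begin
        m⁻¹ * (B · (C · u)) y     ≈⟨ *-congˡ (BCu≋ y) ⟩
        m⁻¹ * (fromℤ m * v y)     ≈⟨ *-assoc m⁻¹ (fromℤ m) (v y) ⟨
        (m⁻¹ * fromℤ m) * v y     ≈⟨ *-congʳ (proj₂ (fromℤ-invertible m≢0)) ⟩
        1ℂ * v y                  ≈⟨ *-identityˡ (v y) ⟩
        v y                       ∎)
      (TModule.*ₗ-closed Y m⁻¹ {B · (C · u)} (TModule.closed Y b (TModule.closed Y c u∈Y)))
    where
    open ≋-Reasoning
    m⁻¹ : ℂ
    m⁻¹ = proj₁ (fromℤ-invertible m≢0)
    BCu≋ : B · (C · u) ≋ᵛ (λ y → fromℤ m * v y)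
    BCu≋ = ∼-unique {B · (C · u)} {λ y → fromℤ m * v y} {B₀ ·ℤ (C₀ ·ℤ U)} {λ l → m ℤ.* V l}
      (∼-· {B} {B₀} {C · u} {C₀ ·ℤ U} B∼ (∼-· {C} {C₀} {u} {U} C∼ u∼)) (∼-* {v} {V} m v∼) eq

-- The orbit matrices as a basis of T

module Dimension (x : Fin 6) (order₁ : Fin 3 ↔ Sphere K₃₃ 1 x) (order₂ : Fin 2 ↔ Sphere K₃₃ 2 x) where
  open Coordinates x order₁ order₂
  open Terwilliger K₃₃ x using (T; T-HasDim; E*; e*; gen-A; gen-E*; identity; add; scale; mul; respects)
  open TModules K₃₃ x using (quadratic∈T)
  open Sandwich K₃₃ x φ

  private
    A = adjacency K₃₃

  Invariant : Mat 6 → Set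
  Invariant B = ∀ g k l → B (place (generator g ⟨$⟩ʳ k)) (place (generator g ⟨$⟩ʳ l)) ≋ B (place k) (place l)

  ∼ᵐ-invariant : ∀ {B B₀} → B ∼ᵐ B₀ → (∀ g k l → B₀ (generator g ⟨$⟩ʳ k) (generator g ⟨$⟩ʳ l) ≡ B₀ k l) → Invariant B
  ∼ᵐ-invariant B∼ B₀-inv g k l = ≋-trans (B∼ (generator g ⟨$⟩ʳ k) (generator g ⟨$⟩ʳ l))
    (≋-trans (≋-reflexive (cong fromℤ (B₀-inv g k l))) (≋-sym (B∼ k l)))

  Kronecker-invariant : ∀ d → (∀ g k → d (generator g ⟨$⟩ʳ k) ≡ d k) →
    ∀ g k l → Kronecker {6} d (generator g ⟨$⟩ʳ k) (generator g ⟨$⟩ʳ l) ≡ Kronecker d k l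
  Kronecker-invariant d d-inv g k l with k Fin.≟ l
  ... | yes refl = trans (Kronecker-same d (generator g ⟨$⟩ʳ k)) (d-inv g k)
  ... | no k≢l  = Kronecker-distinct d (λ eq → k≢l (trans (sym (inverseˡ (generator g)))
      (trans (cong (generator g ⟨$⟩ˡ_) eq) (inverseˡ (generator g)))))

  T-invariant : ∀ {B} → T B → Invariant B
  T-invariant gen-A = ∼ᵐ-invariant {A} {A₀} adjacency-∼ A₀-invariant
  T-invariant (gen-E* i _) = ∼ᵐ-invariant {E* i} {E₀ i} (E*-∼ i)
    (Kronecker-invariant (e₀ i) (λ g k → cong (λ d → if does (d ℕ.≟ i) then 1ℤ else 0ℤ) (level-invariant g k)))
  T-invariant identity = ∼ᵐ-invariant {diagonal (λ _ → 1ℂ)} {Kronecker (λ _ → 1ℤ)} ∼ᵐ-identity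
    (Kronecker-invariant (λ _ → 1ℤ) (λ _ _ → refl))
  T-invariant (add b c) g k l = +ᶜ-cong (T-invariant b g k l) (T-invariant c g k l)
  T-invariant (scale a b) g k l = *-congˡ (T-invariant b g k l)
  T-invariant (mul {B} {C} b c) g k l = begin
    ∑ (λ w → B k′ w * C w l′)
      ≈⟨ ∑-permute (λ w → B k′ w * C w l′) φ ⟩
    ∑ (λ m → B k′ (place m) * C (place m) l′)
      -- Moving the middle vertex by the same symmetry as the outer ones lets the invariance of both
      -- factors apply.
      ≈⟨ ∑-permute (λ m → B k′ (place m) * C (place m) l′) (generator g) ⟩
    ∑ (λ m → B k′ (place (generator g ⟨$⟩ʳ m)) * C (place (generator g ⟨$⟩ʳ m)) l′)
      ≈⟨ ∑-cong (λ m → *-cong (T-invariant b g k m) (T-invariant c g m l)) ⟩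
    ∑ (λ m → B (place k) (place m) * C (place m) (place l))
      ≈⟨ ∑-permute (λ w → B (place k) w * C w (place l)) φ ⟨
    ∑ (λ w → B (place k) w * C w (place l)) ∎
    where
    open ≋-Reasoning
    k′ = place (generator g ⟨$⟩ʳ k)
    l′ = place (generator g ⟨$⟩ʳ l)
  T-invariant (respects {B} {C} B≈C b) g k l =
    ≋-trans (≋-sym (≈⇒≋ᵐ B C B≈C (place (generator g ⟨$⟩ʳ k)) (place (generator g ⟨$⟩ʳ l))))
      (≋-trans (T-invariant b g k l) (≈⇒≋ᵐ B C B≈C (place k) (place l)))

  apply-invariant : ∀ B → Invariant B → ∀ w k l → B (place (apply w k)) (place (apply w l)) ≋ B (place k) (place l)
  apply-invariant B inv []      k l = ≋-refl
  apply-invariant B inv (g ∷ w) k l = ≋-trans (inv g (apply w k) (apply w l)) (apply-invariant B inv w k l)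

  orbitMatrix : Fin 11 → Mat 6
  orbitMatrix o y z = δ (orbit (φ ⟨$⟩ˡ y) (φ ⟨$⟩ˡ z)) o

  orbitMatrix-place : ∀ o k l → orbitMatrix o (place k) (place l) ≡ δ (orbit k l) o
  orbitMatrix-place o k l = cong₂ (λ k l → δ (orbit k l) o) (inverseˡ φ {k}) (inverseˡ φ {l})

  orbitMatrix-∼ : ∀ o → orbitMatrix o ∼ᵐ orbit₀ o
  orbitMatrix-∼ o k l = ≋-trans (≋-reflexive (orbitMatrix-place o k l)) (indicator (does (orbit k l Fin.≟ o)))

  orbit-combination : ∀ c k l → LinearAlgebra.combination (matrices 6) c orbitMatrix (place k) (place l) ≋ c (orbit k l)
  orbit-combination c k l = begin
    LinearAlgebra.combination (matrices 6) c orbitMatrix (place k) (place l)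
      ≈⟨ ≋-reflexive (matrix-combination-at c orbitMatrix (place k) (place l)) ⟩
    ∑ (λ o → c o * orbitMatrix o (place k) (place l))
      ≈⟨ ∑-cong (λ o → ≋-trans (*-comm (c o) (orbitMatrix o (place k) (place l)))
                        (*-congʳ (≋-reflexive (orbitMatrix-place o k l)))) ⟩
    ∑ (λ o → δ (orbit k l) o * c o)
      ≈⟨ ∑-δ (orbit k l) c ⟩
    c (orbit k l) ∎
    where open ≋-Reasoning

  orbitMatrix∈T : ∀ o → T (orbitMatrix o)
  orbitMatrix∈T o = sandwich∈T {B = E* (source o)} {E₀ (source o)} {C = quadratic 1ℤ (+ 3) 0ℤ A} {P₀}
    {B′ = E* (target o)} {E₀ (target o)} {O = orbitMatrix o} {orbit₀ o}
    (E*-∼ (source o)) (∼ᵐ-quadratic {A} {A₀} 1ℤ (+ 3) 0ℤ adjacency-∼) (E*-∼ (target o)) (orbitMatrix-∼ o)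
    (s-weight o) (t-weight o) (+ 3) (λ ()) (combined o)
    (gen-E* (source o) (level-≤ (row o))) (quadratic∈T 1ℤ (+ 3) 0ℤ) (gen-E* (target o) (level-≤ (col o)))

  -- The coefficient at an orbit is the entry at its representative pair. Evaluating a combination
  -- there proves independence; for spanning, a word moving the representative to a given pair shows
  -- that the entries of an element of T agree along the orbit.
  T-dimension : T-HasDim 11
  T-dimension = orbitMatrix , record
    { members = orbitMatrix∈T
    ; independent = λ c c≈0 o → ⟫ (begin
        c o
          ≈⟨ ≋-reflexive (cong c (orbit-row o)) ⟨
        c (orbit (row o) (col o))
          ≈⟨ orbit-combination c (row o) (col o) ⟨
        LinearAlgebra.combination (matrices 6) c orbitMatrix (place (row o)) (place (col o))
          ≈⟨ ≈⇒≋ᵐ (LinearAlgebra.combination (matrices 6) c orbitMatrix) (λ _ _ → 0ℂ) c≈0 (place (row o)) (place (col o)) ⟩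
        0ℂ ∎) ⟪
    ; spanning = λ {B} b →
        let c = λ o → B (place (row o)) (place (col o))
        in c , ≋ᵐ⇒≈ B (LinearAlgebra.combination (matrices 6) c orbitMatrix)
          (everywhere (λ k → everywhere (λ l →
            let w , wk , wl = transitive k l in begin
            B (place k) (place l)
              ≈⟨ ≋-reflexive (cong₂ (λ k l → B (place k) (place l)) wk wl) ⟨
            B (place (apply (word w) (row (orbit k l)))) (place (apply (word w) (col (orbit k l))))
              ≈⟨ apply-invariant B (T-invariant b) (word w) (row (orbit k l)) (col (orbit k l)) ⟩
            c (orbit k l)
              ≈⟨ orbit-combination c k l ⟨
            LinearAlgebra.combination (matrices 6) c orbitMatrix (place k) (place l) ∎)))
    }
    where open ≋-Reasoning

-- The spectrum of K₃,₃

module K₃₃-Spectrum where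

  module S = Spectra {6} Permutation.id
  module Tb = Tables {6} Permutation.id

  A₁ : Fin 6 → Fin 6 → ℤ
  A₁ k l = if does (Graph._~?_ K₃₃ k l) then 1ℤ else 0ℤ

  A₁-∼ : Tables._∼ᵐ_ Permutation.id (adjacency K₃₃) A₁
  A₁-∼ k l = indicator (does (Graph._~?_ K₃₃ k l))

  spectrum : Vec ℤ 3
  spectrum = + 3 ∷ 0ℤ ∷ -[1+ 2 ] ∷ []

  multiplicity : Fin 3 → ℕ
  multiplicity = lookup (1 ∷ 4 ∷ 1 ∷ [])

  -- The eigenvalues 3 and -3 belong to the constant vector and to the sign vector of the
  -- bipartition; the kernel consists of the vectors with sum 0 on each part and gets an orthogonal
  -- basis on each part.
  eigenvectors : ∀ i → Fin (multiplicity i) → Fin 6 → ℤ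
  eigenvectors 0F 0F = λ _ → 1ℤ
  eigenvectors 1F a  = lookup (lookup
    ( (1ℤ ∷ -1ℤ ∷ 0ℤ ∷ 0ℤ ∷ 0ℤ ∷ 0ℤ ∷ [])
    ∷ (1ℤ ∷ 1ℤ ∷ -[1+ 1 ] ∷ 0ℤ ∷ 0ℤ ∷ 0ℤ ∷ [])
    ∷ (0ℤ ∷ 0ℤ ∷ 0ℤ ∷ 1ℤ ∷ -1ℤ ∷ 0ℤ ∷ [])
    ∷ (0ℤ ∷ 0ℤ ∷ 0ℤ ∷ 1ℤ ∷ 1ℤ ∷ -[1+ 1 ] ∷ []) ∷ []) a)
  eigenvectors 2F 0F = lookup (1ℤ ∷ 1ℤ ∷ 1ℤ ∷ -1ℤ ∷ -1ℤ ∷ -1ℤ ∷ [])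

  norms : ∀ i → Fin (multiplicity i) → ℤ
  norms 0F _ = + 6
  norms 1F   = lookup (+ 2 ∷ + 6 ∷ + 2 ∷ + 6 ∷ [])
  norms 2F _ = + 6

  -- A² + 3A, -2A² + 18 and A² - 3A are multiples of the projections onto the three eigenspaces.
  a-coefficient b-coefficient c-coefficient : Fin 3 → ℤ
  a-coefficient = lookup (1ℤ ∷ -[1+ 1 ] ∷ 1ℤ ∷ [])
  b-coefficient = lookup (+ 3 ∷ 0ℤ ∷ -[1+ 2 ] ∷ [])
  c-coefficient = lookup (0ℤ ∷ + 18 ∷ 0ℤ ∷ [])

  -- Each quadratic takes the value 18 at its eigenvalue, so it is 18 times the projection, and v vᵗ
  -- enters that with coefficient 18 divided by the norm of v.
  weights : ∀ i → Fin (multiplicity i) → ℤ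
  weights 0F _ = + 3
  weights 1F   = lookup (+ 9 ∷ + 3 ∷ + 9 ∷ + 3 ∷ [])
  weights 2F _ = + 3

  eigen? : Dec (∀ i a l → (A₁ ·ℤ eigenvectors i a) l ≡ lookup spectrum i ℤ.* eigenvectors i a l)
  eigen? = all? {3} (λ i → all? {multiplicity i} (λ a → all? {6} (λ l →
    (A₁ ·ℤ eigenvectors i a) l ℤ.≟ lookup spectrum i ℤ.* eigenvectors i a l)))

  gram? : Dec (∀ i a b → ⟨ eigenvectors i a , eigenvectors i b ⟩ℤ ≡ Kronecker (norms i) a b)
  gram? = all? {3} (λ i → all? {multiplicity i} (λ a → all? {multiplicity i} (λ b →
    ⟨ eigenvectors i a , eigenvectors i b ⟩ℤ ℤ.≟ Kronecker (norms i) a b)))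

  norms≢0? : Dec (∀ i a → norms i a ≢ 0ℤ)
  norms≢0? = all? {3} (λ i → all? {multiplicity i} (λ a → ¬? (norms i a ℤ.≟ 0ℤ)))

  projection? : Dec (∀ i k l →
    a-coefficient i ℤ.* (A₁ ⊗ℤ A₁) k l ℤ.+ (b-coefficient i ℤ.* A₁ k l ℤ.+ c-coefficient i ℤ.* Kronecker (λ _ → 1ℤ) k l)
    ≡ ∑ℤ (λ a → weights i a ℤ.* (eigenvectors i a k ℤ.* eigenvectors i a l)))
  projection? = all? {3} (λ i → ≡-table?
    (λ k l → a-coefficient i ℤ.* (A₁ ⊗ℤ A₁) k l ℤ.+ (b-coefficient i ℤ.* A₁ k l ℤ.+ c-coefficient i ℤ.* Kronecker (λ _ → 1ℤ) k l))
    (λ k l → ∑ℤ (λ a → weights i a ℤ.* (eigenvectors i a k ℤ.* eigenvectors i a l))))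

  value? : Dec (∀ i → a-coefficient i ℤ.* (lookup spectrum i ℤ.* lookup spectrum i)
                        ℤ.+ (b-coefficient i ℤ.* lookup spectrum i ℤ.+ c-coefficient i) ≢ 0ℤ)
  value? = all? {3} (λ i → ¬? (a-coefficient i ℤ.* (lookup spectrum i ℤ.* lookup spectrum i)
                        ℤ.+ (b-coefficient i ℤ.* lookup spectrum i ℤ.+ c-coefficient i) ℤ.≟ 0ℤ))

  cubic? : Dec (∀ k l → (A₁ ⊗ℤ (A₁ ⊗ℤ A₁)) k l ≡ + 9 ℤ.* A₁ k l)
  cubic? = ≡-table? (A₁ ⊗ℤ (A₁ ⊗ℤ A₁)) (λ k l → + 9 ℤ.* A₁ k l)

  first-eigenvector : Fin 3 → Fin 6 → ℤ
  first-eigenvector 0F = eigenvectors 0F 0F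
  first-eigenvector 1F = eigenvectors 1F 0F
  first-eigenvector 2F = eigenvectors 2F 0F

  first-eigen : ∀ i l → (A₁ ·ℤ first-eigenvector i) l ≡ lookup spectrum i ℤ.* first-eigenvector i l
  first-eigen 0F = from-yes eigen? 0F 0F
  first-eigen 1F = from-yes eigen? 1F 0F
  first-eigen 2F = from-yes eigen? 2F 0F

  eigenspace-dim : ∀ i → LinearAlgebra.HasDim (columns 6) (Eigenspace (adjacency K₃₃) (fromℤ (lookup spectrum i))) (multiplicity i)
  eigenspace-dim i = (λ a → S.column (eigenvectors i a))
    , S.eigenspace-basis {adjacency K₃₃} {A₁} A₁-∼ {v = λ a → S.column (eigenvectors i a)} {eigenvectors i} {norms i}
        (λ a → S.column-∼ (eigenvectors i a))
        (Tb.isOrthogonal {v = λ a → S.column (eigenvectors i a)} {eigenvectors i} (norms i)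
          (λ a → S.column-∼ (eigenvectors i a)) (from-yes norms≢0? i) (from-yes gram? i))
        (lookup spectrum i) (a-coefficient i) (b-coefficient i) (c-coefficient i) (weights i)
        (from-yes eigen? i) (from-yes projection? i) (from-yes value? i)

  hasSpectrum : HasSpectrum (adjacency K₃₃) (map fromℤ (+ 3 ∷ 0ℤ ∷ -[1+ 2 ] ∷ [])) (1 ∷ 4 ∷ 1 ∷ [])
  hasSpectrum = S.cubic-eigenvalues {adjacency K₃₃} {A₁} A₁-∼ (from-yes cubic?) first-eigenvector first-eigen
      (λ { 0F → 0F , λ () ; 1F → 0F , λ () ; 2F → 0F , λ () })
    , λ { 0F → eigenspace-dim 0F ; 1F → eigenspace-dim 1F ; 2F → eigenspace-dim 2F }

-- The irreducible modules of K₃,₃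

size : Fin 4 → ℕ
size = lookup (3 ∷ 1 ∷ 1 ∷ 1 ∷ [])

type : Fin 4 → ModuleType
type = lookup (I ∷ II ∷ II ∷ III ∷ [])

table : ∀ i → Fin (size i) → Fin 6 → ℤ
table 0F a  = e₀ (toℕ a)
table 1F 0F = lookup (0ℤ ∷ 1ℤ ∷ -1ℤ ∷ 0ℤ ∷ 0ℤ ∷ 0ℤ ∷ [])
table 2F 0F = lookup (0ℤ ∷ 1ℤ ∷ 1ℤ ∷ -[1+ 1 ] ∷ 0ℤ ∷ 0ℤ ∷ [])
table 3F 0F = lookup (0ℤ ∷ 0ℤ ∷ 0ℤ ∷ 0ℤ ∷ 1ℤ ∷ -1ℤ ∷ [])

norm : ∀ i → Fin (size i) → ℤ
norm 0F   = lookup (1ℤ ∷ + 3 ∷ + 2 ∷ [])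
norm 1F _ = + 2
norm 2F _ = + 6
norm 3F _ = + 2

σ : ∀ i → Fin (size i) → ℕ
σ 0F a = toℕ a
σ 1F _ = 1
σ 2F _ = 1
σ 3F _ = 2

representation : ∀ i → Vec (Vec ℤ (size i)) (size i)
representation 0F = (0ℤ ∷ + 3 ∷ 0ℤ ∷ []) ∷ (1ℤ ∷ 0ℤ ∷ + 2 ∷ []) ∷ (0ℤ ∷ + 3 ∷ 0ℤ ∷ []) ∷ []
representation 1F = (0ℤ ∷ []) ∷ []
representation 2F = (0ℤ ∷ []) ∷ []
representation 3F = (0ℤ ∷ []) ∷ []

entry : ∀ i → Fin (size i) → Fin (size i) → ℤ
entry i a b = lookup (lookup (representation i) a) b

private
  norm≢0? : Dec (∀ i a → norm i a ≢ 0ℤ)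
  norm≢0? = all? {4} (λ i → all? {size i} (λ a → ¬? (norm i a ℤ.≟ 0ℤ)))

  gram? : Dec (∀ i a b → ⟨ table i a , table i b ⟩ℤ ≡ Kronecker (norm i) a b)
  gram? = all? {4} (λ i → all? {size i} (λ a → all? {size i} (λ b →
    ⟨ table i a , table i b ⟩ℤ ℤ.≟ Kronecker (norm i) a b)))

  cross? : Dec (∀ i j → i ≢ j → ∀ a b → ⟨ table i a , table j b ⟩ℤ ≡ 0ℤ)
  cross? = all? {4} (λ i → all? {4} (λ j → ¬? (i Fin.≟ j) →-dec
    all? {size i} (λ a → all? {size j} (λ b → ⟨ table i a , table j b ⟩ℤ ℤ.≟ 0ℤ))))

  supported? : Dec (∀ i a l → level l ≢ σ i a → table i a l ≡ 0ℤ)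
  supported? = all? {4} (λ i → all? {size i} (λ a → all? {6} (λ l →
    ¬? (level l ℕ.≟ σ i a) →-dec (table i a l ℤ.≟ 0ℤ))))

  represents? : Dec (∀ i b l → (A₀ ·ℤ table i b) l ≡ ∑ℤ (λ a → entry i a b ℤ.* table i a l))
  represents? = all? {4} (λ i → all? {size i} (λ b → all? {6} (λ l →
    (A₀ ·ℤ table i b) l ℤ.≟ ∑ℤ (λ a → entry i a b ℤ.* table i a l))))

  annihilated? : Dec (∀ i a → i ≢ 0F → ∀ l → (A₀ ·ℤ table i a) l ≡ 0ℤ ℤ.* table i a l)
  annihilated? = all? {4} (λ i → all? {size i} (λ a → ¬? (i Fin.≟ 0F) →-dec all? {6} (λ l →
    (A₀ ·ℤ table i a) l ℤ.≟ 0ℤ ℤ.* table i a l)))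

  σ-≤2? : Dec (∀ i a → σ i a ≤ 2)
  σ-≤2? = all? {4} (λ i → all? {size i} (λ a → σ i a ℕ.≤? 2))

  σ-injective? : Dec (∀ i a b → σ i a ≡ σ i b → a ≡ b)
  σ-injective? = all? {4} (λ i → all? {size i} (λ a → all? {size i} (λ b → (σ i a ℕ.≟ σ i b) →-dec (a Fin.≟ b))))

  σ-increasing? : Dec (∀ i a b → a Fin.≤ b → σ i a ≤ σ i b)
  σ-increasing? = all? {4} (λ i → all? {size i} (λ a → all? {size i} (λ b → (a Fin.≤? b) →-dec (σ i a ℕ.≤? σ i b))))

  all-vectors : Fin 6 → Fin 6 → ℤ
  all-vectors = lookup (table 0F 0F ∷ table 0F 1F ∷ table 0F 2F ∷ table 1F 0F ∷ table 2F 0F ∷ table 3F 0F ∷ [])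

  -- The least common multiple 6 of the norms 1, 3, 2, 2, 6, 2, divided by each of them: for an
  -- orthogonal basis, the sum of v vᵗ / norm is the identity.
  parseval-weight : Fin 6 → ℤ
  parseval-weight = lookup (+ 6 ∷ + 2 ∷ + 3 ∷ + 3 ∷ 1ℤ ∷ + 3 ∷ [])

  parseval? : Dec (∀ k l → + 6 ℤ.* Kronecker (λ _ → 1ℤ) k l
                           ≡ ∑ℤ (λ a → parseval-weight a ℤ.* (all-vectors a k ℤ.* all-vectors a l)))
  parseval? = ≡-table? (λ k l → + 6 ℤ.* Kronecker (λ _ → 1ℤ) k l)
    (λ k l → ∑ℤ (λ a → parseval-weight a ℤ.* (all-vectors a k ℤ.* all-vectors a l)))

  -- E*ⱼ (A² + 3 A) e*ᵢ = 3 ∣Γᵢ(x)∣ e*ⱼ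
  reach-weight : Fin 3 → ℤ
  reach-weight = lookup (+ 3 ∷ + 9 ∷ + 6 ∷ [])

  reach? : Dec (∀ (a b : Fin 3) l → (E₀ (toℕ b) ·ℤ (P₀ ·ℤ e₀ (toℕ a))) l ≡ reach-weight a ℤ.* e₀ (toℕ b) l)
  reach? = all? {3} (λ a → all? {3} (λ b → all? {6} (λ l →
    (E₀ (toℕ b) ·ℤ (P₀ ·ℤ e₀ (toℕ a))) l ℤ.≟ reach-weight a ℤ.* e₀ (toℕ b) l)))

  reach-weight≢0? : Dec (∀ a → reach-weight a ≢ 0ℤ)
  reach-weight≢0? = all? {3} (λ a → ¬? (reach-weight a ℤ.≟ 0ℤ))

abstract
  norm≢0 : ∀ i a → norm i a ≢ 0ℤ
  norm≢0 = from-yes norm≢0?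
  gram : ∀ i a b → ⟨ table i a , table i b ⟩ℤ ≡ Kronecker (norm i) a b
  gram = from-yes gram?
  cross : ∀ i j → i ≢ j → ∀ a b → ⟨ table i a , table j b ⟩ℤ ≡ 0ℤ
  cross = from-yes cross?
  supported : ∀ i a l → level l ≢ σ i a → table i a l ≡ 0ℤ
  supported = from-yes supported?
  represents : ∀ i b l → (A₀ ·ℤ table i b) l ≡ ∑ℤ (λ a → entry i a b ℤ.* table i a l)
  represents = from-yes represents?
  annihilated : ∀ i a → i ≢ 0F → ∀ l → (A₀ ·ℤ table i a) l ≡ 0ℤ ℤ.* table i a l
  annihilated = from-yes annihilated?
  σ-≤2 : ∀ i a → σ i a ≤ 2
  σ-≤2 = from-yes σ-≤2?
  σ-injective : ∀ i a b → σ i a ≡ σ i b → a ≡ b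
  σ-injective = from-yes σ-injective?
  σ-increasing : ∀ i a b → a Fin.≤ b → σ i a ≤ σ i b
  σ-increasing = from-yes σ-increasing?
  parseval : ∀ k l → + 6 ℤ.* Kronecker (λ _ → 1ℤ) k l
                     ≡ ∑ℤ (λ a → parseval-weight a ℤ.* (all-vectors a k ℤ.* all-vectors a l))
  parseval = from-yes parseval?
  reach : ∀ (a b : Fin 3) l → (E₀ (toℕ b) ·ℤ (P₀ ·ℤ e₀ (toℕ a))) l ≡ reach-weight a ℤ.* e₀ (toℕ b) l
  reach = from-yes reach?
  reach-weight≢0 : ∀ a → reach-weight a ≢ 0ℤ
  reach-weight≢0 = from-yes reach-weight≢0?

place-in : ∀ i → Fin (size i) → Fin 6
place-in 0F 0F = 0F
place-in 0F 1F = 1F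
place-in 0F 2F = 2F
place-in 1F _  = 3F
place-in 2F _  = 4F
place-in 3F _  = 5F

∑-blocks : ∀ (f : Fin 6 → ℂ) → ∑ f ≋ ∑ (λ i → ∑ (λ a → f (place-in i a)))
∑-blocks f = solve 6 (λ a b c d e f → a :+ (b :+ (c :+ (d :+ (e :+ (f :+ con 0ℤ)))))
  := (a :+ (b :+ (c :+ con 0ℤ))) :+ ((d :+ con 0ℤ) :+ ((e :+ con 0ℤ) :+ ((f :+ con 0ℤ) :+ con 0ℤ)))) ≋-refl
  (f 0F) (f 1F) (f 2F) (f 3F) (f 4F) (f 5F)
  where open ℂ-Solver

_≟ᵗ_ : (s t : ModuleType) → Dec (s ≡ t)
I   ≟ᵗ I   = yes refl
I   ≟ᵗ II  = no (λ ())
I   ≟ᵗ III = no (λ ())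
II  ≟ᵗ I   = no (λ ())
II  ≟ᵗ II  = yes refl
II  ≟ᵗ III = no (λ ())
III ≟ᵗ I   = no (λ ())
III ≟ᵗ II  = no (λ ())
III ≟ᵗ III = yes refl

-- The four summands, their irreducibility and their types

module Modules (x : Fin 6) (order₁ : Fin 3 ↔ Sphere K₃₃ 1 x) (order₂ : Fin 2 ↔ Sphere K₃₃ 2 x) where
  open Coordinates x order₁ order₂
  open Terwilliger K₃₃ x
  open TModule
  open TModules K₃₃ x
  open Sandwich K₃₃ x φ

  private
    A : Mat 6
    A = adjacency K₃₃

  family : ∀ i → Vec V (size i)
  family 0F = e* 0 ∷ e* 1 ∷ e* 2 ∷ []
  family 1F = withEssentialPart 1 order₁ (1ℤ ∷ -1ℤ ∷ 0ℤ ∷ []) ∷ []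
  family 2F = withEssentialPart 1 order₁ (1ℤ ∷ 1ℤ ∷ -[1+ 1 ] ∷ []) ∷ []
  family 3F = withEssentialPart 2 order₂ (1ℤ ∷ -1ℤ ∷ []) ∷ []

  family-∼ : ∀ i a → lookup (family i) a ∼ table i a
  family-∼ 0F 0F = e*-∼ 0
  family-∼ 0F 1F = e*-∼ 1
  family-∼ 0F 2F = e*-∼ 2
  family-∼ 1F 0F = essential₁-∼ 1ℤ -1ℤ 0ℤ
  family-∼ 2F 0F = essential₁-∼ 1ℤ 1ℤ -[1+ 1 ]
  family-∼ 3F 0F = essential₂-∼ 1ℤ -1ℤ

  A-family : ∀ i b → A · lookup (family i) b ≋ᵛ lin (λ a → fromℤ (entry i a b)) (lookup (family i))
  A-family i b = ∼-unique {A · lookup (family i) b} {lin (λ a → fromℤ (entry i a b)) (lookup (family i))}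
    (∼-· {A} {A₀} {lookup (family i) b} {table i b} adjacency-∼ (family-∼ i b))
    (∼-lin {v = lookup (family i)} {table i} (λ a → entry i a b) (family-∼ i)) (represents i b)

  hasRepresentation : ∀ i → Represents (integral (representation i)) A (family i)
  hasRepresentation i b = ≋⇒≈ (A · lookup (family i) b) (combination (λ a → fromℤ (entry i a b)) (lookup (family i)))
    (λ y → ≋-trans (A-family i b y) (≋-sym (combination≋lin (λ a → fromℤ (entry i a b)) (lookup (family i)) y)))

  pure : ∀ i → IsPureFamily (lookup (family i)) (norm i) (σ i)
  pure i = record
    { isOrthogonal = Tables.isOrthogonal φ {v = lookup (family i)} {table i} (norm i) (family-∼ i) (norm≢0 i) (gram i)
    ; A-closed = λ b → span-intro (lookup (family i)) (λ a → fromℤ (entry i a b)) (A · lookup (family i) b) (A-family i b)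
    ; σ-≤ = σ-≤2 i
    ; σ-injective = λ {a} {b} → σ-injective i a b
    ; supported = λ a → everywhere (λ l d≢σ → ≋-trans (family-∼ i a l) (≋-reflexive (cong fromℤ
        (supported i a l (λ level≡σ → d≢σ (trans (dist-place l) level≡σ))))))
    }

  open Families size family norm σ pure public

  cross-orthogonal : ∀ {i j} → i ≢ j → ∀ a b → ⟨ lookup (family i) a , lookup (family j) b ⟩ ≋ 0ℂ
  cross-orthogonal {i} {j} i≢j a b = ≋-trans
    (⟨⟩-∼ {lookup (family i) a} {table i a} {lookup (family j) b} {table j b} (family-∼ i a) (family-∼ j b))
    (≋-reflexive (cong fromℤ (cross i j i≢j a b)))

  reachable : ∀ (Y : TModule) a b → space Y (lookup (family 0F) a) → space Y (lookup (family 0F) b)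
  reachable Y a b = sandwich-reaches Y {E* (toℕ b)} {E₀ (toℕ b)} {quadratic 1ℤ (+ 3) 0ℤ A} {P₀}
    {lookup (family 0F) a} {e₀ (toℕ a)} {lookup (family 0F) b} {e₀ (toℕ b)}
    (E*-∼ (toℕ b)) (∼ᵐ-quadratic {A} {A₀} 1ℤ (+ 3) 0ℤ adjacency-∼) (family-∼ 0F a) (family-∼ 0F b)
    (reach-weight a) (reach-weight≢0 a) (reach a b) (gen-E* (toℕ b) (toℕ≤pred[n] b)) (quadratic∈T 1ℤ (+ 3) 0ℤ)

  irreducible : ∀ i → IsIrreducible (W i)
  irreducible 0F = IsPureFamily.irreducible (pure 0F) 0F reachable
  irreducible 1F = IsPureFamily.irreducible (pure 1F) 0F (λ { Y 0F 0F v∈Y → v∈Y })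
  irreducible 2F = IsPureFamily.irreducible (pure 2F) 0F (λ { Y 0F 0F v∈Y → v∈Y })
  irreducible 3F = IsPureFamily.irreducible (pure 3F) 0F (λ { Y 0F 0F v∈Y → v∈Y })

  private
    all-family : Fin 6 → V
    all-family = lookup (lookup (family 0F) 0F ∷ lookup (family 0F) 1F ∷ lookup (family 0F) 2F
      ∷ lookup (family 1F) 0F ∷ lookup (family 2F) 0F ∷ lookup (family 3F) 0F ∷ [])

    all-family-∼ : ∀ a → all-family a ∼ all-vectors a
    all-family-∼ 0F = family-∼ 0F 0F
    all-family-∼ 1F = family-∼ 0F 1F
    all-family-∼ 2F = family-∼ 0F 2F
    all-family-∼ 3F = family-∼ 1F 0F
    all-family-∼ 4F = family-∼ 2F 0F
    all-family-∼ 5F = family-∼ 3F 0F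

    all-family-at : ∀ i a → all-family (place-in i a) ≡ lookup (family i) a
    all-family-at 0F 0F = refl
    all-family-at 0F 1F = refl
    all-family-at 0F 2F = refl
    all-family-at 1F 0F = refl
    all-family-at 2F 0F = refl
    all-family-at 3F 0F = refl

  modules-decomposition : IsOrthogonalDecomposition modules
  modules-decomposition = decomposition irreducible cross-orthogonal
    (blockwise place-in ∑-blocks all-family all-family-at
      (parseval⇒spanning {v = all-family} {all-vectors} all-family-∼ parseval-weight (+ 6) (λ ()) parseval))

  -- Distance 0 is occupied only in type I, and distance 1 separates type II from type III.
  ≅⇒type≡ : ∀ i j → W i ≅ W j → type i ≡ type j
  ≅⇒type≡ 0F 0F _ = refl
  ≅⇒type≡ 0F 1F iso = ⊥-elim (ℕ.1+n≢0 (proj₂ (levels-⇒ 0F 1F iso 0 z≤n (0F , refl))))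
  ≅⇒type≡ 0F 2F iso = ⊥-elim (ℕ.1+n≢0 (proj₂ (levels-⇒ 0F 2F iso 0 z≤n (0F , refl))))
  ≅⇒type≡ 0F 3F iso = ⊥-elim (ℕ.1+n≢0 (proj₂ (levels-⇒ 0F 3F iso 0 z≤n (0F , refl))))
  ≅⇒type≡ 1F 0F iso = ⊥-elim (ℕ.1+n≢0 (proj₂ (levels-⇐ 1F 0F iso 0 z≤n (0F , refl))))
  ≅⇒type≡ 1F 1F _ = refl
  ≅⇒type≡ 1F 2F _ = refl
  ≅⇒type≡ 1F 3F iso = ⊥-elim (ℕ.1+n≢n (proj₂ (levels-⇒ 1F 3F iso 1 (s≤s z≤n) (0F , refl))))
  ≅⇒type≡ 2F 0F iso = ⊥-elim (ℕ.1+n≢0 (proj₂ (levels-⇐ 2F 0F iso 0 z≤n (0F , refl))))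
  ≅⇒type≡ 2F 1F _ = refl
  ≅⇒type≡ 2F 2F _ = refl
  ≅⇒type≡ 2F 3F iso = ⊥-elim (ℕ.1+n≢n (proj₂ (levels-⇒ 2F 3F iso 1 (s≤s z≤n) (0F , refl))))
  ≅⇒type≡ 3F 0F iso = ⊥-elim (ℕ.1+n≢0 (proj₂ (levels-⇐ 3F 0F iso 0 z≤n (0F , refl))))
  ≅⇒type≡ 3F 1F iso = ⊥-elim (ℕ.1+n≢n (proj₂ (levels-⇐ 3F 1F iso 1 (s≤s z≤n) (0F , refl))))
  ≅⇒type≡ 3F 2F iso = ⊥-elim (ℕ.1+n≢n (proj₂ (levels-⇐ 3F 2F iso 1 (s≤s z≤n) (0F , refl))))
  ≅⇒type≡ 3F 3F _ = refl

  A-annihilates : ∀ i → i ≢ 0F → ∀ a → A · lookup (family i) a ≋ᵛ (λ y → 0ℂ * lookup (family i) a y)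
  A-annihilates i i≢0 a = ∼-eigen {A} {A₀} {lookup (family i) a} {table i a} 0ℤ adjacency-∼ (family-∼ i a) (annihilated i a i≢0)

  type≡⇒≅ : ∀ i j → type i ≡ type j → W i ≅ W j
  type≡⇒≅ 0F 0F _ = ≅-refl {W 0F}
  type≡⇒≅ 1F 1F _ = ≅-refl {W 1F}
  type≡⇒≅ 2F 2F _ = ≅-refl {W 2F}
  type≡⇒≅ 3F 3F _ = ≅-refl {W 3F}
  type≡⇒≅ 1F 2F _ = family-≅ 1F 2F refl refl (λ _ _ → refl) 0ℂ (A-annihilates 1F (λ ())) (A-annihilates 2F (λ ()))
  type≡⇒≅ 2F 1F _ = family-≅ 2F 1F refl refl (λ _ _ → refl) 0ℂ (A-annihilates 2F (λ ())) (A-annihilates 1F (λ ()))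
  type≡⇒≅ 0F 1F ()
  type≡⇒≅ 0F 2F ()
  type≡⇒≅ 0F 3F ()
  type≡⇒≅ 1F 0F ()
  type≡⇒≅ 1F 3F ()
  type≡⇒≅ 2F 0F ()
  type≡⇒≅ 2F 3F ()
  type≡⇒≅ 3F 0F ()
  type≡⇒≅ 3F 1F ()
  type≡⇒≅ 3F 2F ()

  classification : ∀ i j → (W i ≅ W j) ⇔ (type i ≡ type j)
  classification i j = mk⇔ (≅⇒type≡ i j) (type≡⇒≅ i j)

  open Classified type _≟ᵗ_ classification public

-- Eigenvalues of the matrix of type I

private
  B₀-table : Vec (Vec ℤ 3) 3
  B₀-table = (0ℤ ∷ + 3 ∷ 0ℤ ∷ []) ∷ (1ℤ ∷ 0ℤ ∷ + 2 ∷ []) ∷ (0ℤ ∷ + 3 ∷ 0ℤ ∷ []) ∷ []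

  B₀-entry : Fin 3 → Fin 3 → ℤ
  B₀-entry i j = lookup (lookup B₀-table i) j

  -- Coordinates with respect to `e* 0`, `e* 1`, `e* 2` of the eigenvectors of A in W₀: the constant
  -- vector, a vector of the kernel, and the sign vector of the bipartition.
  B₀-eigenvector : Fin 3 → Fin 3 → ℤ
  B₀-eigenvector i = lookup (lookup ((1ℤ ∷ 1ℤ ∷ 1ℤ ∷ []) ∷ (+ 2 ∷ 0ℤ ∷ -1ℤ ∷ []) ∷ (1ℤ ∷ -1ℤ ∷ 1ℤ ∷ []) ∷ []) i)

  B₀-cubic? : Dec (∀ i j → (B₀-entry ⊗ℤ (B₀-entry ⊗ℤ B₀-entry)) i j ≡ + 9 ℤ.* B₀-entry i j)
  B₀-cubic? = ≡-table? (B₀-entry ⊗ℤ (B₀-entry ⊗ℤ B₀-entry)) (λ i j → + 9 ℤ.* B₀-entry i j)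

  B₀-eigen? : Dec (∀ i l → (B₀-entry ·ℤ B₀-eigenvector i) l ≡ lookup (+ 3 ∷ 0ℤ ∷ -[1+ 2 ] ∷ []) i ℤ.* B₀-eigenvector i l)
  B₀-eigen? = ≡-table? (λ i → B₀-entry ·ℤ B₀-eigenvector i) (λ i l → lookup (+ 3 ∷ 0ℤ ∷ -[1+ 2 ] ∷ []) i ℤ.* B₀-eigenvector i l)

B₀-eigenvalues : HasEigenvalues (integral B₀-table) (map fromℤ (+ 3 ∷ 0ℤ ∷ -[1+ 2 ] ∷ []))
B₀-eigenvalues = Spectra.cubic-eigenvalues Permutation.id {integral B₀-table} {B₀-entry} (integral-∼ᵐ B₀-table)
  (from-yes B₀-cubic?) B₀-eigenvector (from-yes B₀-eigen?)
  (λ { 0F → 0F , λ () ; 1F → 0F , λ () ; 2F → 0F , λ () })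

module Summands (x : Fin 6) (order₁ : Fin 3 ↔ Sphere K₃₃ 1 x) (order₂ : Fin 2 ↔ Sphere K₃₃ 2 x) where
  open Modules x order₁ order₂ public
  open Terwilliger K₃₃ x
  open TModules K₃₃ x

  endpoint₀ : HasEndpoint (W 0F) 0
  endpoint₀ = IsPureFamily.endpoint (pure 0F) 0F (λ _ → z≤n)

  endpoint₁ᵃ : HasEndpoint (W 1F) 1
  endpoint₁ᵃ = IsPureFamily.endpoint (pure 1F) 0F (λ _ → ℕ.≤-refl)

  endpoint₁ᵇ : HasEndpoint (W 2F) 1
  endpoint₁ᵇ = IsPureFamily.endpoint (pure 2F) 0F (λ _ → ℕ.≤-refl)

  endpoint₂ : HasEndpoint (W 3F) 2
  endpoint₂ = IsPureFamily.endpoint (pure 3F) 0F (λ _ → ℕ.≤-refl)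

  diameter₀ : HasDiameter (W 0F) 2
  diameter₀ = IsPureFamily.hasDiameter (pure 0F) refl

  diameter₁ᵃ : HasDiameter (W 1F) 0
  diameter₁ᵃ = IsPureFamily.hasDiameter (pure 1F) refl

  diameter₁ᵇ : HasDiameter (W 2F) 0
  diameter₁ᵇ = IsPureFamily.hasDiameter (pure 2F) refl

  diameter₂ : HasDiameter (W 3F) 0
  diameter₂ = IsPureFamily.hasDiameter (pure 3F) refl

  shape₀ : HasShape (W 0F) (1 ∷ 1 ∷ 1 ∷ [])
  shape₀ = IsPureFamily.hasShape (pure 0F) 0F (λ _ → z≤n) refl (1 ∷ 1 ∷ 1 ∷ [])
    (λ { 0F → 0F , refl , refl ; 1F → 1F , refl , refl ; 2F → 2F , refl , refl })

  shape₁ᵃ : HasShape (W 1F) (1 ∷ [])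
  shape₁ᵃ = IsPureFamily.hasShape (pure 1F) 0F (λ _ → ℕ.≤-refl) refl (1 ∷ []) (λ { 0F → 0F , refl , refl })

  shape₁ᵇ : HasShape (W 2F) (1 ∷ [])
  shape₁ᵇ = IsPureFamily.hasShape (pure 2F) 0F (λ _ → ℕ.≤-refl) refl (1 ∷ []) (λ { 0F → 0F , refl , refl })

  shape₂ : HasShape (W 3F) (1 ∷ [])
  shape₂ = IsPureFamily.hasShape (pure 3F) 0F (λ _ → ℕ.≤-refl) refl (1 ∷ []) (λ { 0F → 0F , refl , refl })

mainTheorem2 :
  let Γ = completeBipartite 3 3 in
  HasIntersectionArray Γ (3 ∷ 2 ∷ []) (1 ∷ 3 ∷ [])
  × (∀ (Δ : Graph 6) → HasIntersectionArray Δ (3 ∷ 2 ∷ []) (1 ∷ 3 ∷ []) → Δ ≅ᴳ Γ)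
  × HasSpectrum (adjacency Γ) (map fromℤ (+ 3 ∷ 0ℤ ∷ - + 3 ∷ [])) (1 ∷ 4 ∷ 1 ∷ [])
  × (∀ (x : Fin 6) (order₁ : Fin 3 ↔ Sphere Γ 1 x) (order₂ : Fin 2 ↔ Sphere Γ 2 x) →
      let open Terwilliger Γ x
          open TModule
          A = adjacency Γ
          νa = withEssentialPart 1 order₁ (1ℤ ∷ -1ℤ ∷ 0ℤ ∷ [])
          νb = withEssentialPart 1 order₁ (1ℤ ∷ 1ℤ ∷ - + 2 ∷ [])
          ν₂ = withEssentialPart 2 order₂ (1ℤ ∷ -1ℤ ∷ [])
          B₀ = integral ((0ℤ ∷ + 3 ∷ 0ℤ ∷ []) ∷
                         (1ℤ ∷ 0ℤ  ∷ + 2 ∷ []) ∷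
                         (0ℤ ∷ + 3 ∷ 0ℤ ∷ []) ∷ [])
          B₁ = integral ((0ℤ ∷ []) ∷ [])
      in
      (Σ[ W₀ ∈ TModule ] Σ[ W₁a ∈ TModule ] Σ[ W₁b ∈ TModule ] Σ[ W₂ ∈ TModule ]
        (let W = W₀ ∷ W₁a ∷ W₁b ∷ W₂ ∷ []
             type = I ∷ II ∷ II ∷ III ∷ []
         in
         IsOrthogonalDecomposition W
         × (∀ i j → (lookup W i ≅ lookup W j) ⇔ (lookup type i ≡ lookup type j))
         -- Type I
         × (HasEndpoint W₀ 0 × HasMultiplicityIn W W₀ 1 × HasDim (space W₀) 3
            × HasDiameter W₀ 2 × HasShape W₀ (1 ∷ 1 ∷ 1 ∷ [])
            × IsPureBasis W₀ (e* 0 ∷ e* 1 ∷ e* 2 ∷ [])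
            × Represents B₀ A (e* 0 ∷ e* 1 ∷ e* 2 ∷ [])
            × HasEigenvalues B₀ (map fromℤ (+ 3 ∷ 0ℤ ∷ - + 3 ∷ [])))
         -- Type II, first summand
         × (HasEndpoint W₁a 1 × HasMultiplicityIn W W₁a 2 × HasDim (space W₁a) 1
            × HasDiameter W₁a 0 × HasShape W₁a (1 ∷ [])
            × (component 1 W₁a ≐ Span (lookup (νa ∷ []))) × HasDim (component 1 W₁a) 1
            × IsPureBasis W₁a (νa ∷ [])
            × Represents B₁ A (νa ∷ [])
            × HasEigenvalues B₁ (map fromℤ (0ℤ ∷ [])))
         -- Type II, second summand
         × (HasEndpoint W₁b 1 × HasMultiplicityIn W W₁b 2 × HasDim (space W₁b) 1
            × HasDiameter W₁b 0 × HasShape W₁b (1 ∷ [])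
            × (component 1 W₁b ≐ Span (lookup (νb ∷ []))) × HasDim (component 1 W₁b) 1
            × IsPureBasis W₁b (νb ∷ [])
            × Represents B₁ A (νb ∷ [])
            × HasEigenvalues B₁ (map fromℤ (0ℤ ∷ [])))
         -- Type III
         × (HasEndpoint W₂ 2 × HasMultiplicityIn W W₂ 1 × HasDim (space W₂) 1
            × HasDiameter W₂ 0 × HasShape W₂ (1 ∷ [])
            × (component 2 W₂ ≐ Span (lookup (ν₂ ∷ []))) × HasDim (component 2 W₂) 1
            × IsPureBasis W₂ (ν₂ ∷ [])
            × Represents B₁ A (ν₂ ∷ []))))
      × T-HasDim (3 ^ 2 + 1 ^ 2 + 1 ^ 2)
      × 3 ^ 2 + 1 ^ 2 + 1 ^ 2 ≡ 11)
mainTheorem2 = K₃₃-intersectionArray , Uniqueness.isomorphic , K₃₃-Spectrum.hasSpectrum , λ x order₁ order₂ →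
  let open Summands x order₁ order₂
      open Terwilliger.TModule
      open TModules K₃₃ x
  in (W 0F , W 1F , W 2F , W 3F , modules-decomposition , modules-classification
     , (endpoint₀ , multiplicity 0F refl , dimension 0F , diameter₀ , shape₀ , pureBasis 0F (σ-increasing 0F)
       , hasRepresentation 0F , B₀-eigenvalues)
     , (endpoint₁ᵃ , multiplicity 1F refl , dimension 1F , diameter₁ᵃ , shape₁ᵃ
       , IsPureFamily.component-own (pure 1F) 0F , IsPureFamily.component-dim (pure 1F) 0F
       , pureBasis 1F (σ-increasing 1F) , hasRepresentation 1F , zero-eigenvalues)
     , (endpoint₁ᵇ , multiplicity 2F refl , dimension 2F , diameter₁ᵇ , shape₁ᵇ
       , IsPureFamily.component-own (pure 2F) 0F , IsPureFamily.component-dim (pure 2F) 0F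
       , pureBasis 2F (σ-increasing 2F) , hasRepresentation 2F , zero-eigenvalues)
     , (endpoint₂ , multiplicity 3F refl , dimension 3F , diameter₂ , shape₂
       , IsPureFamily.component-own (pure 3F) 0F , IsPureFamily.component-dim (pure 3F) 0F
       , pureBasis 3F (σ-increasing 3F) , hasRepresentation 3F))
   , Dimension.T-dimension x order₁ order₂ , refl
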